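{- For every $D>0$ there is a constant $K$ such that the following holds. Let $k=k(n)$ be a positive integer with $k<D\log n$ and $k\mid n$, let $m=n/k$, and let $v_1,\dots,v_m$ be $m$ given distinct vertices of $[n]$. Then, with probability tending to $1$ as $n\to\infty$, the random graph $\mathcal{G}(n,K\frac{\log n}{n})$ contains $m$ pairwise vertex-disjoint paths, each on exactly $k$ vertices, such that for each $i\in[m]$ the $i$-th path has $v_i$ as an endpoint.
   Context: $\mathcal{G}(n,p)$ denotes the binomial random graph on vertex set $[n]=\{1,\dots,n\}$ in which each possible edge is present independently with probability $p$. $\log$ denotes the natural logarithm. -}

module Defs where

open import Data.Nat.Base as ℕ using (ℕ; zero; suc; z≤n; s≤s)
import Data.Nat.Properties as ℕ
open import Data.Integer.Base as ℤ using (+_; +[1+_]; -[1+_])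
import Data.Integer.Properties as ℤ
open import Data.Rational.Base as ℚ using (ℚ; mkℚ; 0ℚ; 1ℚ; ½; ∣_∣; *≤*; *<*)
import Data.Rational.Properties as ℚ
import Data.Rational.Unnormalised.Base as ℚᵘ
import Data.Rational.Unnormalised.Properties as ℚᵘ
open import Data.Rational.Solver using (module +-*-Solver)
open import Algebra.Definitions.RawSemiring ℚ.+-*-rawSemiring using (_^_)
open import Data.Fin.Base using (Fin)
import Data.Fin.Properties as Fin
open import Data.Fin.Subset using (Subset; inside; outside) renaming (_∈_ to _∈ₛ_)
open import Data.Fin.Subset.Properties using () renaming (_∈?_ to _∈ₛ?_)
open import Data.List.Base as List using (List; []; _∷_; _++_)
open import Data.Vec.Base as Vec using (Vec; []; _∷_)
open import Data.Vec.Membership.Propositional using (_∈_)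
open import Data.Vec.Membership.DecPropositional using (_∈?_)
open import Data.Vec.Relation.Unary.AllPairs using (allPairs?)
open import Data.Vec.Relation.Unary.Linked using (Linked; linked?)
open import Data.Vec.Relation.Unary.Unique.Propositional using (Unique)
open import Data.Product.Base using (∃; _×_; _,_; proj₁; proj₂)
open import Data.Sum.Base using (_⊎_; inj₁; inj₂)
open import Data.Empty using (⊥)
open import Function.Base using (_∘_)
open import Relation.Nullary using (Dec; yes; no; ¬_)
open import Relation.Nullary.Decidable using (map′; ¬?; _×-dec_; _⊎-dec_; _→-dec_)
open import Relation.Unary using (Pred; Decidable)
open import Relation.Binary.PropositionalEquality
  using (_≡_; _≢_; refl; sym; trans; cong; cong₂; subst; subst₂)
open import Level using (0ℓ)

Cauchy : (ℕ → ℚ) → Set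
Cauchy s = ∀ ε → 0ℚ ℚ.< ε →
  ∃ λ N → ∀ i j → N ℕ.≤ i → N ℕ.≤ j → ∣ s i ℚ.- s j ∣ ℚ.< ε

record ℝ : Set where
  constructor mkℝ
  field
    seq    : ℕ → ℚ
    cauchy : Cauchy seq

open ℝ public

infix 4 _<_

-- x and y are eventually a positive rational distance apart.  Distinct
-- sequences may represent the same real; _<_ respects this.
_<_ : ℝ → ℝ → Set
x < y = ∃ λ ε → 0ℚ ℚ.< ε × ∃ λ N → ∀ i → N ℕ.≤ i → seq x i ℚ.+ ε ℚ.≤ seq y i

private
  0<½ : 0ℚ ℚ.< ½
  0<½ = ℚ.positive⁻¹ ½

  half-pos : ∀ {ε} → 0ℚ ℚ.< ε → 0ℚ ℚ.< ½ ℚ.* ε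
  half-pos {ε} 0<ε =
    subst (ℚ._< ½ ℚ.* ε) (ℚ.*-zeroʳ ½) (ℚ.*-monoʳ-<-pos ½ 0<ε)

  half+half : ∀ ε → ½ ℚ.* ε ℚ.+ ½ ℚ.* ε ≡ ε
  half+half ε = trans (sym (ℚ.*-distribʳ-+ ε ½ ½)) (ℚ.*-identityˡ ε)

  const-cauchy : ∀ q → Cauchy (λ _ → q)
  const-cauchy q ε 0<ε =
    0 , λ _ _ _ _ → subst (λ z → ∣ z ∣ ℚ.< ε) (sym (ℚ.+-inverseʳ q)) 0<ε

  +-cauchy : ∀ s t → Cauchy s → Cauchy t → Cauchy (λ i → s i ℚ.+ t i)
  +-cauchy s t cs ct ε 0<ε = M ℕ.⊔ N , λ i j p q → begin-strict
    ∣ (s i ℚ.+ t i) ℚ.- (s j ℚ.+ t j) ∣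
      ≡⟨ cong ∣_∣ (regroup (s i) (t i) (s j) (t j)) ⟩
    ∣ (s i ℚ.- s j) ℚ.+ (t i ℚ.- t j) ∣
      ≤⟨ ℚ.∣p+q∣≤∣p∣+∣q∣ (s i ℚ.- s j) (t i ℚ.- t j) ⟩
    ∣ s i ℚ.- s j ∣ ℚ.+ ∣ t i ℚ.- t j ∣
      <⟨ ℚ.+-mono-< (near₁ i j (ℕ.m⊔n≤o⇒m≤o M N p) (ℕ.m⊔n≤o⇒m≤o M N q))
                    (near₂ i j (ℕ.m⊔n≤o⇒n≤o M N p) (ℕ.m⊔n≤o⇒n≤o M N q)) ⟩
    ½ ℚ.* ε ℚ.+ ½ ℚ.* ε
      ≡⟨ half+half ε ⟩
    ε ∎
    where
    open ℚ.≤-Reasoning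
    open +-*-Solver
    M = proj₁ (cs (½ ℚ.* ε) (half-pos 0<ε))
    N = proj₁ (ct (½ ℚ.* ε) (half-pos 0<ε))
    near₁ = proj₂ (cs (½ ℚ.* ε) (half-pos 0<ε))
    near₂ = proj₂ (ct (½ ℚ.* ε) (half-pos 0<ε))
    regroup : ∀ a b c d →
      (a ℚ.+ b) ℚ.- (c ℚ.+ d) ≡ (a ℚ.- c) ℚ.+ (b ℚ.- d)
    regroup = solve 4 (λ a b c d →
      (a :+ b) :+ (:- (c :+ d)) := (a :+ (:- c)) :+ (b :+ (:- d))) refl

  neg-cauchy : ∀ s → Cauchy s → Cauchy (λ i → ℚ.- s i)
  neg-cauchy s cs ε 0<ε = N , λ i j p q →
    subst (ℚ._< ε)
      (trans (sym (ℚ.∣-p∣≡∣p∣ (s i ℚ.- s j))) (cong ∣_∣ (ℚ.neg-distrib-+ (s i) (ℚ.- s j))))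
      (near i j p q)
    where
    N = proj₁ (cs ε 0<ε)
    near = proj₂ (cs ε 0<ε)

  bounded : ∀ s → Cauchy s →
    ∃ λ B → 0ℚ ℚ.< B × ∃ λ N → ∀ i → N ℕ.≤ i → ∣ s i ∣ ℚ.≤ B
  bounded s cs = B , 0<B , N , λ i p → begin
    ∣ s i ∣                         ≡⟨ cong ∣_∣ (split (s i) (s N)) ⟩
    ∣ (s i ℚ.- s N) ℚ.+ s N ∣       ≤⟨ ℚ.∣p+q∣≤∣p∣+∣q∣ (s i ℚ.- s N) (s N) ⟩
    ∣ s i ℚ.- s N ∣ ℚ.+ ∣ s N ∣     ≤⟨ ℚ.+-monoˡ-≤ ∣ s N ∣ (ℚ.<⇒≤ (near i N p ℕ.≤-refl)) ⟩
    B ∎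
    where
    open ℚ.≤-Reasoning
    open +-*-Solver
    0<1 = ℚ.positive⁻¹ 1ℚ
    N = proj₁ (cs 1ℚ 0<1)
    near = proj₂ (cs 1ℚ 0<1)
    B = 1ℚ ℚ.+ ∣ s N ∣
    0<B : 0ℚ ℚ.< B
    0<B = ℚ.+-mono-<-≤ 0<1 (ℚ.0≤∣p∣ (s N))
    split : ∀ a b → a ≡ (a ℚ.- b) ℚ.+ b
    split = solve 2 (λ a b → a := (a :+ (:- b)) :+ b) refl

  scale : ∀ {B} → 0ℚ ℚ.< B → ∀ {ε} → 0ℚ ℚ.< ε → ∃ λ δ → 0ℚ ℚ.< δ × B ℚ.* δ ≡ ε
  scale {B} 0<B {ε} 0<ε = 1/B ℚ.* ε , 0<δ , eq
    where
    instance
      B-pos : ℚ.Positive B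
      B-pos = ℚ.positive 0<B
      B≢0 : ℚ.NonZero B
      B≢0 = ℚ.pos⇒nonZero B
    1/B = ℚ.1/ B
    instance
      1/B-pos : ℚ.Positive 1/B
      1/B-pos = ℚ.1/pos⇒pos B
    0<δ : 0ℚ ℚ.< 1/B ℚ.* ε
    0<δ = subst (ℚ._< 1/B ℚ.* ε) (ℚ.*-zeroʳ 1/B) (ℚ.*-monoʳ-<-pos 1/B 0<ε)
    eq : B ℚ.* (1/B ℚ.* ε) ≡ ε
    eq = trans (sym (ℚ.*-assoc B 1/B ε))
           (trans (cong (ℚ._* ε) (ℚ.*-inverseʳ B)) (ℚ.*-identityˡ ε))

  ∣*∣-< : ∀ {a b A B} → 0ℚ ℚ.< A → ∣ a ∣ ℚ.≤ A → ∣ b ∣ ℚ.< B → ∣ a ℚ.* b ∣ ℚ.< A ℚ.* B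
  ∣*∣-< {a} {b} {A} {B} 0<A a≤A b<B = begin-strict
    ∣ a ℚ.* b ∣      ≡⟨ ℚ.∣p*q∣≡∣p∣*∣q∣ a b ⟩
    ∣ a ∣ ℚ.* ∣ b ∣  ≤⟨ ℚ.*-monoʳ-≤-nonNeg ∣ b ∣ {{ℚ.nonNegative (ℚ.0≤∣p∣ b)}} a≤A ⟩
    A ℚ.* ∣ b ∣      <⟨ ℚ.*-monoʳ-<-pos A {{ℚ.positive 0<A}} b<B ⟩
    A ℚ.* B ∎
    where open ℚ.≤-Reasoning

  *-near : ∀ {ε a b c d B C β γ} → 0ℚ ℚ.< B → 0ℚ ℚ.< C →
           B ℚ.* β ≡ ½ ℚ.* ε → C ℚ.* γ ≡ ½ ℚ.* ε →
           ∣ a ∣ ℚ.≤ B → ∣ d ∣ ℚ.≤ C → ∣ b ℚ.- d ∣ ℚ.< β → ∣ a ℚ.- c ∣ ℚ.< γ →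
           ∣ a ℚ.* b ℚ.- c ℚ.* d ∣ ℚ.< ε
  *-near {ε} {a} {b} {c} {d} {B} {C} {β} {γ} 0<B 0<C Bβ Cγ a≤B d≤C b-d a-c = begin-strict
    ∣ a ℚ.* b ℚ.- c ℚ.* d ∣
      ≡⟨ cong ∣_∣ (regroup a b c d) ⟩
    ∣ a ℚ.* (b ℚ.- d) ℚ.+ d ℚ.* (a ℚ.- c) ∣
      ≤⟨ ℚ.∣p+q∣≤∣p∣+∣q∣ (a ℚ.* (b ℚ.- d)) (d ℚ.* (a ℚ.- c)) ⟩
    ∣ a ℚ.* (b ℚ.- d) ∣ ℚ.+ ∣ d ℚ.* (a ℚ.- c) ∣
      <⟨ ℚ.+-mono-< (∣*∣-< 0<B a≤B b-d) (∣*∣-< 0<C d≤C a-c) ⟩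
    B ℚ.* β ℚ.+ C ℚ.* γ
      ≡⟨ cong₂ ℚ._+_ Bβ Cγ ⟩
    ½ ℚ.* ε ℚ.+ ½ ℚ.* ε
      ≡⟨ half+half ε ⟩
    ε ∎
    where
    open ℚ.≤-Reasoning
    open +-*-Solver
    regroup : ∀ a b c d →
      a ℚ.* b ℚ.- c ℚ.* d ≡ a ℚ.* (b ℚ.- d) ℚ.+ d ℚ.* (a ℚ.- c)
    regroup = solve 4 (λ a b c d →
      (a :* b) :+ (:- (c :* d)) := (a :* (b :+ (:- d))) :+ (d :* (a :+ (:- c)))) refl

  max₄ : ∀ a b c d {i} → (a ℕ.⊔ b) ℕ.⊔ (c ℕ.⊔ d) ℕ.≤ i →
         (a ℕ.≤ i × b ℕ.≤ i) × (c ℕ.≤ i × d ℕ.≤ i)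
  max₄ a b c d p =
    (ℕ.m⊔n≤o⇒m≤o a b l , ℕ.m⊔n≤o⇒n≤o a b l) , (ℕ.m⊔n≤o⇒m≤o c d r , ℕ.m⊔n≤o⇒n≤o c d r)
    where
    l = ℕ.m⊔n≤o⇒m≤o (a ℕ.⊔ b) (c ℕ.⊔ d) p
    r = ℕ.m⊔n≤o⇒n≤o (a ℕ.⊔ b) (c ℕ.⊔ d) p

  *-cauchy : ∀ s t → Cauchy s → Cauchy t → Cauchy (λ i → s i ℚ.* t i)
  *-cauchy s t cs ct ε 0<ε = near (bounded s cs) (bounded t ct)
    where
    Bound : (ℕ → ℚ) → Set
    Bound s = ∃ λ B → 0ℚ ℚ.< B × ∃ λ N → ∀ i → N ℕ.≤ i → ∣ s i ∣ ℚ.≤ B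
    near : Bound s → Bound t → ∃ λ N → ∀ i j → N ℕ.≤ i → N ℕ.≤ j →
           ∣ s i ℚ.* t i ℚ.- s j ℚ.* t j ∣ ℚ.< ε
    near (B , 0<B , N₁ , s≤B) (C , 0<C , N₂ , t≤C) =
      let (β , 0<β , Bβ) = scale 0<B (half-pos 0<ε)
          (γ , 0<γ , Cγ) = scale 0<C (half-pos 0<ε)
          (N₃ , t-near)  = ct β 0<β
          (N₄ , s-near)  = cs γ 0<γ
      in (N₁ ℕ.⊔ N₂) ℕ.⊔ (N₃ ℕ.⊔ N₄) , λ i j p q →
        let ((p₁ , _) , (p₃ , p₄)) = max₄ N₁ N₂ N₃ N₄ p
            ((_ , q₂) , (q₃ , q₄)) = max₄ N₁ N₂ N₃ N₄ q
        in *-near {ε} {s i} {t i} {s j} {t j} {B} {C} {β} {γ} 0<B 0<C Bβ Cγ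
             (s≤B i p₁) (t≤C j q₂) (t-near i j p₃ q₃) (s-near i j p₄ q₄)

infixl 6 _+_ _-_
infixl 7 _*_
infix  8 -_

fromℚ : ℚ → ℝ
fromℚ q = mkℝ (λ _ → q) (const-cauchy q)

fromℕ : ℕ → ℝ
fromℕ n = fromℚ (+ n ℚ./ 1)

0ℝ 1ℝ : ℝ
0ℝ = fromℚ 0ℚ
1ℝ = fromℚ 1ℚ

_+_ : ℝ → ℝ → ℝ
x + y = mkℝ (λ i → seq x i ℚ.+ seq y i) (+-cauchy (seq x) (seq y) (cauchy x) (cauchy y))

-_ : ℝ → ℝ
- x = mkℝ (λ i → ℚ.- seq x i) (neg-cauchy (seq x) (cauchy x))

_-_ : ℝ → ℝ → ℝ
x - y = x + - y

_*_ : ℝ → ℝ → ℝ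
x * y = mkℝ (λ i → seq x i ℚ.* seq y i) (*-cauchy (seq x) (seq y) (cauchy x) (cauchy y))

sum : List ℝ → ℝ
sum = List.foldr _+_ 0ℝ

-- Sequences are indexed by the positive integers.
_⟶_ : ((n : ℕ) .{{_ : ℕ.NonZero n}} → ℝ) → ℝ → Set
f ⟶ x = ∀ ε → 0ℝ < ε →
  ∃ λ N → ∀ n .{{_ : ℕ.NonZero n}} → N ℕ.≤ n → x - ε < f n × f n < x + ε

-- The partial sums of  Σ_{j ≥ 1} rʲ / j = - log (1 - r).
mercator : ℚ → ℕ → ℚ
mercator r zero    = 0ℚ
mercator r (suc i) = mercator r i ℚ.+ r ^ suc i ℚ.* (+ 1 ℚ./ suc i)

private
  inv : ℕ → ℚ
  inv i = + 1 ℚ./ suc i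

  -- With q = 1 / (1 - r), the sequence  mercator r i + q rⁱ⁺¹ / (i + 1)
  -- decreases, so it bounds the increasing partial sums from above.
  module Mercator (r q : ℚ) (0≤r : 0ℚ ℚ.≤ r) (r≤1 : r ℚ.≤ 1ℚ) (0≤q : 0ℚ ℚ.≤ q)
                  (q≡ : q ≡ 1ℚ ℚ.+ q ℚ.* r)
                  (arch : ∀ ε → 0ℚ ℚ.< ε → ∃ λ M → q ℚ.* inv M ℚ.< ε) where
    open ℚ.≤-Reasoning

    S U : ℕ → ℚ
    S = mercator r
    U i = S i ℚ.+ q ℚ.* r ^ suc i ℚ.* inv i

    0≤* : ∀ {a b} → 0ℚ ℚ.≤ a → 0ℚ ℚ.≤ b → 0ℚ ℚ.≤ a ℚ.* b
    0≤* {a} {b} 0≤a 0≤b = subst (ℚ._≤ a ℚ.* b) (ℚ.*-zeroʳ a)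
      (ℚ.*-monoˡ-≤-nonNeg a {{ℚ.nonNegative 0≤a}} 0≤b)

    0≤^ : ∀ i → 0ℚ ℚ.≤ r ^ i
    0≤^ zero    = ℚ.<⇒≤ (ℚ.positive⁻¹ 1ℚ)
    0≤^ (suc i) = 0≤* 0≤r (0≤^ i)

    ^≤1 : ∀ i → r ^ i ℚ.≤ 1ℚ
    ^≤1 zero    = ℚ.≤-refl
    ^≤1 (suc i) = begin
      r ℚ.* r ^ i  ≤⟨ ℚ.*-monoʳ-≤-nonNeg (r ^ i) {{ℚ.nonNegative (0≤^ i)}} r≤1 ⟩
      1ℚ ℚ.* r ^ i ≡⟨ ℚ.*-identityˡ (r ^ i) ⟩
      r ^ i        ≤⟨ ^≤1 i ⟩
      1ℚ ∎

    0≤inv : ∀ i → 0ℚ ℚ.≤ inv i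
    0≤inv i = ℚ.nonNegative⁻¹ (inv i) {{ℚ.normalize-nonNeg 1 (suc i)}}

    inv-anti : ∀ i → inv (suc i) ℚ.≤ inv i
    inv-anti i = ℚ.toℚᵘ-cancel-≤ (ℚᵘ.≤-trans
      (ℚᵘ.≤-reflexive (ℚ.toℚᵘ-fromℚᵘ (ℚᵘ.mkℚᵘ (+ 1) (suc i))))
      (ℚᵘ.≤-trans
        (ℚᵘ.*≤* (ℤ.+≤+ (ℕ.+-monoˡ-≤ 0 (ℕ.n≤1+n (suc i)))))
        (ℚᵘ.≤-reflexive (ℚᵘ.≃-sym (ℚ.toℚᵘ-fromℚᵘ (ℚᵘ.mkℚᵘ (+ 1) i))))))

    x≤x+ : ∀ x {y} → 0ℚ ℚ.≤ y → x ℚ.≤ x ℚ.+ y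
    x≤x+ x {y} 0≤y = subst (ℚ._≤ x ℚ.+ y) (ℚ.+-identityʳ x) (ℚ.+-monoʳ-≤ x 0≤y)

    S-step : ∀ i → S i ℚ.≤ S (suc i)
    S-step i = x≤x+ (S i) (0≤* (0≤^ (suc i)) (0≤inv i))

    S≤U : ∀ i → S i ℚ.≤ U i
    S≤U i = x≤x+ (S i) (0≤* (0≤* 0≤q (0≤^ (suc i))) (0≤inv i))

    U-step : ∀ i → U (suc i) ℚ.≤ U i
    U-step i = begin
      S i ℚ.+ P ℚ.* inv i ℚ.+ q ℚ.* (r ℚ.* P) ℚ.* inv (suc i)
        ≤⟨ ℚ.+-monoʳ-≤ (S i ℚ.+ P ℚ.* inv i)
             (ℚ.*-monoˡ-≤-nonNeg (q ℚ.* (r ℚ.* P))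
               {{ℚ.nonNegative (0≤* 0≤q (0≤^ (suc (suc i))))}} (inv-anti i)) ⟩
      S i ℚ.+ P ℚ.* inv i ℚ.+ q ℚ.* (r ℚ.* P) ℚ.* inv i
        ≡⟨ regroup (S i) P (inv i) q r ⟩
      S i ℚ.+ (1ℚ ℚ.+ q ℚ.* r) ℚ.* P ℚ.* inv i
        ≡⟨ cong (λ z → S i ℚ.+ z ℚ.* P ℚ.* inv i) (sym q≡) ⟩
      U i ∎
      where
      P = r ^ suc i
      open +-*-Solver
      regroup : ∀ s p v q r →
        s ℚ.+ p ℚ.* v ℚ.+ q ℚ.* (r ℚ.* p) ℚ.* v ≡ s ℚ.+ (1ℚ ℚ.+ q ℚ.* r) ℚ.* p ℚ.* v
      regroup = solve 5 (λ s p v q r →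
        (s :+ p :* v) :+ (q :* (r :* p)) :* v := s :+ ((con 1ℚ :+ q :* r) :* p) :* v) refl

    S-mono : ∀ M d → S M ℚ.≤ S (d ℕ.+ M)
    S-mono M zero    = ℚ.≤-refl
    S-mono M (suc d) = ℚ.≤-trans (S-mono M d) (S-step (d ℕ.+ M))

    U-anti : ∀ M d → U (d ℕ.+ M) ℚ.≤ U M
    U-anti M zero    = ℚ.≤-refl
    U-anti M (suc d) = ℚ.≤-trans (U-step (d ℕ.+ M)) (U-anti M d)

    lower : ∀ {M i} → M ℕ.≤ i → S M ℚ.≤ S i
    lower {M} {i} p = subst (λ z → S M ℚ.≤ S z) (ℕ.m∸n+n≡m p) (S-mono M (i ℕ.∸ M))

    upper : ∀ {M i} → M ℕ.≤ i → S i ℚ.≤ U M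
    upper {M} {i} p = ℚ.≤-trans (S≤U i)
      (subst (λ z → U z ℚ.≤ U M) (ℕ.m∸n+n≡m p) (U-anti M (i ℕ.∸ M)))

    diff : ∀ {l u x y} → x ℚ.≤ u → l ℚ.≤ y → x ℚ.- y ℚ.≤ u ℚ.- l
    diff x≤u l≤y = ℚ.+-mono-≤ x≤u (ℚ.neg-antimono-≤ l≤y)

    absDiff : ∀ {l u x y} → l ℚ.≤ x → x ℚ.≤ u → l ℚ.≤ y → y ℚ.≤ u → ∣ x ℚ.- y ∣ ℚ.≤ u ℚ.- l
    absDiff {l} {u} {x} {y} l≤x x≤u l≤y y≤u with ℚ.∣p∣≡p∨∣p∣≡-p (x ℚ.- y)
    ... | inj₁ eq = subst (ℚ._≤ u ℚ.- l) (sym eq) (diff x≤u l≤y)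
    ... | inj₂ eq = subst (ℚ._≤ u ℚ.- l) (sym (trans eq (flip x y))) (diff y≤u l≤x)
      where
      open +-*-Solver
      flip : ∀ a b → ℚ.- (a ℚ.- b) ≡ b ℚ.- a
      flip = solve 2 (λ a b → :- (a :+ (:- b)) := b :+ (:- a)) refl

    width : ∀ M → U M ℚ.- S M ℚ.≤ q ℚ.* inv M
    width M = begin
      S M ℚ.+ q ℚ.* P ℚ.* inv M ℚ.- S M  ≡⟨ cancel (S M) q P (inv M) ⟩
      P ℚ.* (q ℚ.* inv M)                ≤⟨ ℚ.*-monoʳ-≤-nonNeg (q ℚ.* inv M)
                                               {{ℚ.nonNegative (0≤* 0≤q (0≤inv M))}} (^≤1 (suc M)) ⟩
      1ℚ ℚ.* (q ℚ.* inv M)               ≡⟨ ℚ.*-identityˡ (q ℚ.* inv M) ⟩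
      q ℚ.* inv M ∎
      where
      P = r ^ suc M
      open +-*-Solver
      cancel : ∀ s q p v → s ℚ.+ q ℚ.* p ℚ.* v ℚ.- s ≡ p ℚ.* (q ℚ.* v)
      cancel = solve 4 (λ s q p v → (s :+ (q :* p) :* v) :+ (:- s) := p :* (q :* v)) refl

    S-cauchy : Cauchy S
    S-cauchy ε 0<ε = M , λ i j p q →
      ℚ.≤-<-trans (ℚ.≤-trans (absDiff (lower p) (upper p) (lower q) (upper q)) (width M))
                  (proj₂ (arch ε 0<ε))
      where M = proj₁ (arch ε 0<ε)

  archimedean : ∀ n ε → 0ℚ ℚ.< ε → ∃ λ M → (+ n ℚ./ 1) ℚ.* inv M ℚ.< ε
  archimedean n (mkℚ (+ 0)      d _) (*<* (ℤ.+<+ ()))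
  archimedean n (mkℚ (-[1+ _ ]) d _) (*<* ())
  archimedean n ε@(mkℚ +[1+ a ] d _) _ = M , ℚ.toℚᵘ-cancel-< (ℚᵘ.≤-<-trans
      (ℚᵘ.≤-reflexive (ℚᵘ.≃-trans (ℚ.toℚᵘ-homo-* (+ n ℚ./ 1) (inv M))
        (ℚᵘ.*-cong (ℚ.toℚᵘ-fromℚᵘ (ℚᵘ.mkℚᵘ (+ n) 0)) (ℚ.toℚᵘ-fromℚᵘ (ℚᵘ.mkℚᵘ (+ 1) M)))))
      (ℚᵘ.*<* (subst₂ ℤ._<_ lhs refl (ℤ.+<+ bound))))
    where
    M = n ℕ.* suc d
    bound : n ℕ.* suc d ℕ.< suc a ℕ.* suc (M ℕ.+ 0)
    bound = ℕ.≤-trans (s≤s (ℕ.≤-reflexive (sym (ℕ.+-identityʳ M)))) (ℕ.m≤m+n _ _)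
    lhs : + (n ℕ.* suc d) ≡ (+ n ℤ.* + 1) ℤ.* + suc d
    lhs = trans (ℤ.pos-* n (suc d)) (cong (ℤ._* + suc d) (sym (ℤ.*-identityʳ (+ n))))

  log-cauchy : ∀ a → Cauchy (mercator (+ a ℚ./ suc a))
  log-cauchy a = Mercator.S-cauchy r q
      (ℚ.nonNegative⁻¹ r {{ℚ.normalize-nonNeg a (suc a)}}) r≤1
      (ℚ.nonNegative⁻¹ q {{ℚ.normalize-nonNeg (suc a) 1}}) q≡ (archimedean (suc a))
    where
    r = + a ℚ./ suc a
    q = + suc a ℚ./ 1
    r≃ = ℚ.toℚᵘ-fromℚᵘ (ℚᵘ.mkℚᵘ (+ a) a)
    q≃ = ℚ.toℚᵘ-fromℚᵘ (ℚᵘ.mkℚᵘ (+ suc a) 0)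
    r≤1 : r ℚ.≤ 1ℚ
    r≤1 = ℚ.toℚᵘ-cancel-≤ (ℚᵘ.≤-trans (ℚᵘ.≤-reflexive r≃)
      (ℚᵘ.*≤* (subst₂ ℤ._≤_ (sym (ℤ.*-identityʳ (+ a))) (sym (ℤ.*-identityˡ (+ suc a)))
        (ℤ.+≤+ (ℕ.n≤1+n a)))))
    a/1 = ℚᵘ.mkℚᵘ (+ a) 0
    prod : ℚᵘ.mkℚᵘ (+ suc a) 0 ℚᵘ.* ℚᵘ.mkℚᵘ (+ a) a ℚᵘ.≃ a/1
    prod = ℚᵘ.*≡* (trans (ℤ.*-identityʳ _) (trans (ℤ.*-comm (+ suc a) (+ a))
      (cong (λ z → + a ℤ.* + suc z) (sym (ℕ.+-identityʳ a)))))
    raw : ℚᵘ.mkℚᵘ (+ suc a) 0 ℚᵘ.≃ ℚᵘ.mkℚᵘ (+ 1) 0 ℚᵘ.+ a/1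
    raw = ℚᵘ.*≡* (cong (λ z → (+ 1 ℤ.+ z) ℤ.* + 1) (sym (ℤ.*-identityʳ (+ a))))
    q≡ : q ≡ 1ℚ ℚ.+ q ℚ.* r
    q≡ = ℚ.toℚᵘ-injective (ℚᵘ.≃-trans q≃ (ℚᵘ.≃-trans raw (ℚᵘ.≃-sym
      (ℚᵘ.≃-trans (ℚ.toℚᵘ-homo-+ 1ℚ (q ℚ.* r))
        (ℚᵘ.+-cong (ℚᵘ.≃-refl {ℚᵘ.mkℚᵘ (+ 1) 0}) (ℚᵘ.≃-trans (ℚ.toℚᵘ-homo-* q r)
          (ℚᵘ.≃-trans (ℚᵘ.*-cong q≃ r≃) prod)))))))

-- The natural logarithm: log n = - log (1 - r)  with  r = (n - 1) / n.
log : (n : ℕ) .{{_ : ℕ.NonZero n}} → ℝ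
log (suc a) = mkℝ (mercator (+ a ℚ./ suc a)) (log-cauchy a)

potentialEdges : ∀ n → List (Fin n × Fin n)
potentialEdges n =
  List.filter (λ e → proj₁ e Fin.<? proj₂ e)
    (List.cartesianProduct (List.allFin n) (List.allFin n))

-- A simple graph on Fin n is its edge set, an edge being represented by its
-- position in the list of potential edges.
Graph : ℕ → Set
Graph n = Subset (List.length (potentialEdges n))

Adjacent : ∀ {n} → Graph n → Fin n → Fin n → Set
Adjacent {n} G x y = ∃ λ e → e ∈ₛ G ×
  (List.lookup (potentialEdges n) e ≡ (x , y) ⊎ List.lookup (potentialEdges n) e ≡ (y , x))

-- xs lists the vertices of a path in order.
IsPath : ∀ {n k} → Graph n → Vec (Fin n) k → Set
IsPath G xs = Unique xs × Linked (Adjacent G) xs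

IsEndpoint : ∀ {n k} → Fin n → Vec (Fin n) k → Set
IsEndpoint v []       = ⊥
IsEndpoint v (x ∷ xs) = v ≡ x ⊎ v ≡ Vec.last (x ∷ xs)

Disjoint : ∀ {n k l} → Vec (Fin n) k → Vec (Fin n) l → Set
Disjoint xs ys = ∀ x → ¬ (x ∈ xs × x ∈ ys)

DisjointPathsFrom : ∀ {n} k m → (Fin m → Fin n) → Graph n → Set
DisjointPathsFrom {n} k m v G = ∃ λ (ps : Vec (Vec (Fin n) k) m) →
  (∀ i → IsPath G (Vec.lookup ps i) × IsEndpoint (v i) (Vec.lookup ps i)) ×
  (∀ i j → i ≢ j → Disjoint (Vec.lookup ps i) (Vec.lookup ps j))

private
  Searchable : Set → Set₁
  Searchable A = ∀ {P : Pred A 0ℓ} → Decidable P → Dec (∃ P)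

  vec-searchable : ∀ {A} → Searchable A → ∀ n → Searchable (Vec A n)
  vec-searchable any zero    P? = map′ (λ p → [] , p) (λ { ([] , p) → p }) (P? [])
  vec-searchable any (suc n) P? =
    map′ (λ { (x , xs , p) → x ∷ xs , p }) (λ { (x ∷ xs , p) → x , xs , p })
      (any λ x → vec-searchable any n λ xs → P? (x ∷ xs))

  pair≟ : ∀ {n} (e f : Fin n × Fin n) → Dec (e ≡ f)
  pair≟ (a , b) (c , d) =
    map′ (λ { (refl , refl) → refl }) (λ { refl → refl , refl }) (a Fin.≟ c ×-dec b Fin.≟ d)

  adjacent? : ∀ {n} (G : Graph n) x y → Dec (Adjacent G x y)
  adjacent? {n} G x y = Fin.any? λ e → e ∈ₛ? G ×-dec
    (pair≟ (List.lookup (potentialEdges n) e) (x , y) ⊎-dec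
     pair≟ (List.lookup (potentialEdges n) e) (y , x))

  isPath? : ∀ {n k} (G : Graph n) (xs : Vec (Fin n) k) → Dec (IsPath G xs)
  isPath? G xs = allPairs? (λ x y → ¬? (x Fin.≟ y)) xs ×-dec linked? (adjacent? G) xs

  isEndpoint? : ∀ {n k} v (xs : Vec (Fin n) k) → Dec (IsEndpoint v xs)
  isEndpoint? v []       = no λ ()
  isEndpoint? v (x ∷ xs) = v Fin.≟ x ⊎-dec v Fin.≟ Vec.last (x ∷ xs)

  disjoint? : ∀ {n k l} (xs : Vec (Fin n) k) (ys : Vec (Fin n) l) → Dec (Disjoint xs ys)
  disjoint? xs ys = Fin.all? λ x → ¬? (_∈?_ Fin._≟_ x xs ×-dec _∈?_ Fin._≟_ x ys)

disjointPathsFrom? : ∀ {n} k m (v : Fin m → Fin n) → Decidable (DisjointPathsFrom k m v)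
disjointPathsFrom? k m v G = vec-searchable (vec-searchable Fin.any? k) m λ ps →
  Fin.all? (λ i → isPath? G (Vec.lookup ps i) ×-dec isEndpoint? (v i) (Vec.lookup ps i)) ×-dec
  Fin.all? (λ i → Fin.all? λ j →
    ¬? (i Fin.≟ j) →-dec disjoint? (Vec.lookup ps i) (Vec.lookup ps j))

subsets : ∀ N → List (Subset N)
subsets zero    = [] ∷ []
subsets (suc N) = List.map (inside ∷_) (subsets N) ++ List.map (outside ∷_) (subsets N)

graphs : ∀ n → List (Graph n)
graphs n = subsets (List.length (potentialEdges n))

-- Each potential edge is present independently with probability p, so S has
-- probability  p ^ |S| · (1 - p) ^ (N - |S|).
weight : ∀ {N} → ℝ → Subset N → ℝ
weight p []            = 1ℝ
weight p (inside  ∷ S) = p * weight p S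
weight p (outside ∷ S) = (1ℝ - p) * weight p S

-- The value is a probability only when 0 ≤ p ≤ 1; with p = K log n / n and
-- K > 0 this fails for only finitely many n, so limits are unaffected.
Pr : ∀ n → ℝ → {A : Pred (Graph n) 0ℓ} → Decidable A → ℝ
Pr n p A? = sum (List.map (weight p) (List.filter A? (graphs n)))

{-# OPTIONS --safe #-}

module Submission where

-- Work with rational densities: at each index of the Cauchy sequences, Pr is a
-- polynomial in p.  The argument is the minimal-fragment proof (Park–Pham;
-- Frankston–Kahn–Narayanan–Park) of the spread lemma for increasing families A
-- of edge sets.  Expose W at density p and let T range over the minimal sets
-- with W ∪ T ∈ A.  The pair (W , T) is determined by Z = W ∪ T and a subset of
-- one fixed member of A inside Z, so large T carry little weight; they are paid
-- for as part of a cover, and the small ones generate a new family of half the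
-- size.  After ⌊log₂ n⌋ + 1 halvings at density O(1/n) and one round at density
-- O(log n / n) the family contains ∅, unless a cover of cost < 1 has been found.
--
-- Such a cover does not exist.  Fill the non-root vertices into the paths in
-- a uniformly random order.  Once each edge of T is oriented, it prescribes the
-- predecessor of one more vertex, and at most (s - |T|)! of the s! orders obey
-- |T| prescriptions; hence a random path system contains T with probability
-- at most 2 ^ |T| (s - |T|)! / s! ≤ (32 / n) ^ |T|.

-- Halvings alone cannot reach ∅: at density proportional to 1/n, a round that brings the size down
-- to r has error about 8^-r, which does not tend to 0 once r is bounded. So the halvings stop at a
-- size h with 4^h ≤ ⌊log₂ n⌋ < 4^(h+1). From there a single round at density 4^h q, where q = 32/n,
-- has error 2^-h; its density is still O(log n / n), and h tends to infinity with n. The same h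
-- controls the halvings, whose errors add up to about log₂ n · 8^-h = O(2^-h).
--
-- The logarithm is given by the partial sums of a series, and the order on the reals asks for a
-- rational gap at all late indices. Hence no estimate is about log n itself: the partial sums are
-- bounded below by a multiple of log₂ n, and above by a small multiple of n, at every index beyond
-- some point depending on n.

-- Weighted sums over subsets

module SubsetSums where

  open import Data.Nat.Base as ℕ using (zero; suc)
  open import Data.Rational.Base using (ℚ; 0ℚ; 1ℚ; _+_; _*_; _-_; -_; _≤_; nonNegative)
  open import Data.Rational.Properties
  open import Data.Rational.Solver using (module +-*-Solver)
  open import Algebra.Definitions.RawSemiring +-*-rawSemiring using (_^_)
  open import Data.Bool.Base using (if_then_else_)
  open import Data.Fin.Base using (zero; suc)
  open import Data.Fin.Subset as Sub using (Subset; inside; outside; _∈_; _⊆_; _∪_; ∣_∣)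
  import Data.Fin.Subset.Properties as Sub
  open import Data.Vec.Base using ([]; _∷_; here; there)
  open import Data.Product.Base using (_×_; _,_)
  open import Data.Empty using (⊥-elim; ⊥)
  open import Function.Base using (_∘_)
  open import Relation.Nullary using (Dec; yes; no; ¬_; does)
  open import Relation.Binary.PropositionalEquality
  import Data.Nat.Properties as ℕ

  0≤1 : 0ℚ ≤ 1ℚ
  0≤1 = nonNegative⁻¹ 1ℚ

  *-monoʳ-≤ : ∀ {a b c} → 0ℚ ≤ c → a ≤ b → c * a ≤ c * b
  *-monoʳ-≤ {c = c} 0≤c = *-monoˡ-≤-nonNeg c {{nonNegative 0≤c}}

  *-monoˡ-≤ : ∀ {a b c} → 0ℚ ≤ c → a ≤ b → a * c ≤ b * c
  *-monoˡ-≤ {c = c} 0≤c = *-monoʳ-≤-nonNeg c {{nonNegative 0≤c}}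

  *-nonNeg : ∀ {a b} → 0ℚ ≤ a → 0ℚ ≤ b → 0ℚ ≤ a * b
  *-nonNeg {a} {b} 0≤a 0≤b = subst (_≤ a * b) (*-zeroʳ a) (*-monoʳ-≤ 0≤a 0≤b)

  *-mono-≤ : ∀ {a b c d} → 0ℚ ≤ a → 0ℚ ≤ d → a ≤ b → c ≤ d → a * c ≤ b * d
  *-mono-≤ 0≤a 0≤d a≤b c≤d = ≤-trans (*-monoʳ-≤ 0≤a c≤d) (*-monoˡ-≤ 0≤d a≤b)

  +-nonNeg : ∀ {a b} → 0ℚ ≤ a → 0ℚ ≤ b → 0ℚ ≤ a + b
  +-nonNeg = +-mono-≤

  ^-nonNeg : ∀ {a} → 0ℚ ≤ a → ∀ n → 0ℚ ≤ a ^ n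
  ^-nonNeg 0≤a zero    = 0≤1
  ^-nonNeg 0≤a (suc n) = *-nonNeg 0≤a (^-nonNeg 0≤a n)

  p≤p+q : ∀ {p q} → 0ℚ ≤ q → p ≤ p + q
  p≤p+q {p} {q} 0≤q = subst (_≤ p + q) (+-identityʳ p) (+-monoʳ-≤ p 0≤q)

  p≤q+p : ∀ {p q} → 0ℚ ≤ q → p ≤ q + p
  p≤q+p {p} {q} 0≤q = subst (_≤ q + p) (+-identityˡ p) (+-monoˡ-≤ p 0≤q)

  p≤q⇒0≤q-p : ∀ {p q} → p ≤ q → 0ℚ ≤ q - p
  p≤q⇒0≤q-p {p} {q} p≤q = subst (_≤ q - p) (+-inverseʳ p) (+-monoˡ-≤ (- p) p≤q)

  0≤q-p⇒p≤q : ∀ {p q} → 0ℚ ≤ q - p → p ≤ q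
  0≤q-p⇒p≤q {p} {q} 0≤ = subst₂ _≤_ (+-identityˡ p) (lem q p) (+-monoˡ-≤ p 0≤)
    where
    open +-*-Solver
    lem : ∀ a b → a - b + b ≡ a
    lem = solve 2 (λ a b → (a :- b) :+ b := a) refl

  indicator : ∀ {P : Set} → Dec P → ℚ
  indicator P? = if does P? then 1ℚ else 0ℚ

  module _ {P : Set} where
    0≤indicator : (P? : Dec P) → 0ℚ ≤ indicator P?
    0≤indicator (yes _) = 0≤1
    0≤indicator (no  _) = ≤-refl

    indicator≤1 : (P? : Dec P) → indicator P? ≤ 1ℚ
    indicator≤1 (yes _) = ≤-refl
    indicator≤1 (no  _) = 0≤1

    indicator-yes : (P? : Dec P) → P → indicator P? ≡ 1ℚ
    indicator-yes (yes _) _ = refl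
    indicator-yes (no ¬p) p = ⊥-elim (¬p p)

    indicator-no : (P? : Dec P) → ¬ P → indicator P? ≡ 0ℚ
    indicator-no (yes p) ¬p = ⊥-elim (¬p p)
    indicator-no (no  _) _  = refl

  indicator-mono : ∀ {P Q : Set} (P? : Dec P) (Q? : Dec Q) → (P → Q) → indicator P? ≤ indicator Q?
  indicator-mono (yes p) Q? P→Q = ≤-reflexive (sym (indicator-yes Q? (P→Q p)))
  indicator-mono (no  _) Q? P→Q = 0≤indicator Q?

  -- The sum over all S of a ^ |S| · b ^ (N - |S|) · f S.
  Σ⟨_,_⟩ : ∀ {N} → ℚ → ℚ → (Subset N → ℚ) → ℚ
  Σ⟨_,_⟩ {zero}  a b f = f []
  Σ⟨_,_⟩ {suc N} a b f = a * Σ⟨ a , b ⟩ (f ∘ (inside ∷_)) + b * Σ⟨ a , b ⟩ (f ∘ (outside ∷_))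

  𝔼 : ∀ {N} → ℚ → (Subset N → ℚ) → ℚ
  𝔼 p = Σ⟨ p , 1ℚ - p ⟩

  Σ-cong : ∀ {N} a b {f g : Subset N → ℚ} → (∀ S → f S ≡ g S) → Σ⟨ a , b ⟩ f ≡ Σ⟨ a , b ⟩ g
  Σ-cong {zero}  a b f≡g = f≡g []
  Σ-cong {suc N} a b f≡g =
    cong₂ (λ x y → a * x + b * y) (Σ-cong a b (f≡g ∘ (inside ∷_))) (Σ-cong a b (f≡g ∘ (outside ∷_)))

  Σ-+ : ∀ {N} a b (f g : Subset N → ℚ) → Σ⟨ a , b ⟩ (λ S → f S + g S) ≡ Σ⟨ a , b ⟩ f + Σ⟨ a , b ⟩ g
  Σ-+ {zero}  a b f g = refl
  Σ-+ {suc N} a b f g = trans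
    (cong₂ (λ x y → a * x + b * y) (Σ-+ a b (f ∘ (inside ∷_)) (g ∘ (inside ∷_)))
                                   (Σ-+ a b (f ∘ (outside ∷_)) (g ∘ (outside ∷_))))
    (regroup a b _ _ _ _)
    where
    open +-*-Solver
    regroup : ∀ a b x y z w → a * (x + y) + b * (z + w) ≡ (a * x + b * z) + (a * y + b * w)
    regroup = solve 6 (λ a b x y z w →
      a :* (x :+ y) :+ b :* (z :+ w) := (a :* x :+ b :* z) :+ (a :* y :+ b :* w)) refl

  Σ-* : ∀ {N} a b c (f : Subset N → ℚ) → Σ⟨ a , b ⟩ (λ S → c * f S) ≡ c * Σ⟨ a , b ⟩ f
  Σ-* {zero}  a b c f = refl
  Σ-* {suc N} a b c f = trans
    (cong₂ (λ x y → a * x + b * y) (Σ-* a b c (f ∘ (inside ∷_))) (Σ-* a b c (f ∘ (outside ∷_))))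
    (regroup a b c _ _)
    where
    open +-*-Solver
    regroup : ∀ a b c x y → a * (c * x) + b * (c * y) ≡ c * (a * x + b * y)
    regroup = solve 5 (λ a b c x y → a :* (c :* x) :+ b :* (c :* y) := c :* (a :* x :+ b :* y)) refl

  Σ-zero : ∀ {N} a b → Σ⟨_,_⟩ {N} a b (λ _ → 0ℚ) ≡ 0ℚ
  Σ-zero {zero}  a b = refl
  Σ-zero {suc N} a b = trans (cong₂ (λ x y → a * x + b * y) (Σ-zero {N} a b) (Σ-zero {N} a b))
    (trans (cong₂ _+_ (*-zeroʳ a) (*-zeroʳ b)) (+-identityʳ 0ℚ))

  module _ {a b : ℚ} (0≤a : 0ℚ ≤ a) (0≤b : 0ℚ ≤ b) where
    Σ-mono : ∀ {N} {f g : Subset N → ℚ} → (∀ S → f S ≤ g S) → Σ⟨ a , b ⟩ f ≤ Σ⟨ a , b ⟩ g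
    Σ-mono {zero}  f≤g = f≤g []
    Σ-mono {suc N} f≤g = +-mono-≤ (*-monoʳ-≤ 0≤a (Σ-mono (f≤g ∘ (inside ∷_))))
                                  (*-monoʳ-≤ 0≤b (Σ-mono (f≤g ∘ (outside ∷_))))

    Σ-nonNeg : ∀ {N} {f : Subset N → ℚ} → (∀ S → 0ℚ ≤ f S) → 0ℚ ≤ Σ⟨ a , b ⟩ f
    Σ-nonNeg {N} {f} 0≤f = subst (_≤ Σ⟨ a , b ⟩ f) (Σ-zero {N} a b) (Σ-mono 0≤f)

    Σ-nonPos : ∀ {N} {f : Subset N → ℚ} → (∀ S → f S ≤ 0ℚ) → Σ⟨ a , b ⟩ f ≤ 0ℚ
    Σ-nonPos {N} {f} f≤0 = subst (Σ⟨ a , b ⟩ f ≤_) (Σ-zero {N} a b) (Σ-mono f≤0)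

  𝔼-const : ∀ {N} p c → 𝔼 {N} p (λ _ → c) ≡ c
  𝔼-const {zero}  p c = refl
  𝔼-const {suc N} p c = trans (cong₂ (λ x y → p * x + (1ℚ - p) * y) (𝔼-const {N} p c) (𝔼-const {N} p c))
                              (total p c)
    where
    open +-*-Solver
    total : ∀ p c → p * c + (1ℚ - p) * c ≡ c
    total = solve 2 (λ p c → p :* c :+ (con 1ℚ :- p) :* c := c) refl

  -- Two rounds of exposure with densities p₁ and p₂ produce a set of density at
  -- most p₁ + p₂.
  𝔼-∪ : ∀ {N} {f : Subset N → ℚ} {p p₁ p₂} →
        (∀ {S T} → S ⊆ T → f T ≤ f S) →
        0ℚ ≤ p₁ → p₁ ≤ 1ℚ → 0ℚ ≤ p₂ → p₂ ≤ 1ℚ → p₁ + p₂ ≤ p → p ≤ 1ℚ →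
        𝔼 p f ≤ 𝔼 p₁ (λ W → 𝔼 p₂ (λ W′ → f (W ∪ W′)))
  𝔼-∪ {zero} {f} anti _ _ _ _ _ _ = ≤-refl
  𝔼-∪ {suc N} {f} {p} {p₁} {p₂} anti 0≤p₁ p₁≤1 0≤p₂ p₂≤1 sum≤p p≤1 = begin
    p * 𝔼 p fᵢ + (1ℚ - p) * 𝔼 p fₒ
      ≡⟨ regroup₁ p (𝔼 p fᵢ) (𝔼 p fₒ) ⟩
    𝔼 p fₒ - p * (𝔼 p fₒ - 𝔼 p fᵢ)
      ≤⟨ +-monoʳ-≤ (𝔼 p fₒ) (neg-antimono-≤ (*-monoˡ-≤ (p≤q⇒0≤q-p decr) p′≤p)) ⟩
    𝔼 p fₒ - p′ * (𝔼 p fₒ - 𝔼 p fᵢ)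
      ≡⟨ regroup₂ p₁ p₂ (𝔼 p fᵢ) (𝔼 p fₒ) ⟩
    p₁ * (p₂ * 𝔼 p fᵢ + (1ℚ - p₂) * 𝔼 p fᵢ) + (1ℚ - p₁) * (p₂ * 𝔼 p fᵢ + (1ℚ - p₂) * 𝔼 p fₒ)
      ≤⟨ +-mono-≤ (*-monoʳ-≤ 0≤p₁ (+-mono-≤ (*-monoʳ-≤ 0≤p₂ IHᵢ) (*-monoʳ-≤ 0≤1-p₂ IHᵢ)))
                  (*-monoʳ-≤ 0≤1-p₁ (+-mono-≤ (*-monoʳ-≤ 0≤p₂ IHᵢ) (*-monoʳ-≤ 0≤1-p₂ IHₒ))) ⟩
    p₁ * (p₂ * Eᵢ + (1ℚ - p₂) * Eᵢ) + (1ℚ - p₁) * (p₂ * Eᵢ + (1ℚ - p₂) * Eₒ)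
      ≡⟨ sym (cong₂ (λ x y → p₁ * x + (1ℚ - p₁) * y) (split fᵢ fᵢ) (split fᵢ fₒ)) ⟩
    𝔼 p₁ (λ W → 𝔼 p₂ (λ W′ → f (W ∪ W′))) ∎
    where
    open ≤-Reasoning
    open +-*-Solver
    fᵢ = f ∘ (inside ∷_)
    fₒ = f ∘ (outside ∷_)
    Eᵢ = 𝔼 p₁ (λ W → 𝔼 p₂ (λ W′ → fᵢ (W ∪ W′)))
    Eₒ = 𝔼 p₁ (λ W → 𝔼 p₂ (λ W′ → fₒ (W ∪ W′)))
    -- The probability that the first coordinate lies in `W ∪ W′`. It is at most `p`, and since `f`
    -- is decreasing, replacing `p` by it can only increase the sum.
    p′ = p₁ + p₂ - p₁ * p₂
    0≤1-p₁ = p≤q⇒0≤q-p p₁≤1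
    0≤1-p₂ = p≤q⇒0≤q-p p₂≤1
    0≤p : 0ℚ ≤ p
    0≤p = ≤-trans (+-nonNeg 0≤p₁ 0≤p₂) sum≤p
    decr : 𝔼 p fᵢ ≤ 𝔼 p fₒ
    decr = Σ-mono 0≤p (p≤q⇒0≤q-p p≤1) {N} {fᵢ} {fₒ} (λ S → anti (Sub.out⊆ Sub.⊆-refl))
    p′≤p : p′ ≤ p
    p′≤p = ≤-trans (≤-trans (+-monoʳ-≤ (p₁ + p₂) (neg-antimono-≤ (*-nonNeg 0≤p₁ 0≤p₂)))
                            (≤-reflexive (+-identityʳ (p₁ + p₂)))) sum≤p
    IHᵢ : 𝔼 p fᵢ ≤ Eᵢ
    IHᵢ = 𝔼-∪ {f = fᵢ} (anti ∘ Sub.s⊆s) 0≤p₁ p₁≤1 0≤p₂ p₂≤1 sum≤p p≤1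
    IHₒ : 𝔼 p fₒ ≤ Eₒ
    IHₒ = 𝔼-∪ {f = fₒ} (anti ∘ Sub.s⊆s) 0≤p₁ p₁≤1 0≤p₂ p₂≤1 sum≤p p≤1
    split : ∀ (g h : Subset N → ℚ) →
      𝔼 p₁ (λ W → p₂ * 𝔼 p₂ (λ W′ → g (W ∪ W′)) + (1ℚ - p₂) * 𝔼 p₂ (λ W′ → h (W ∪ W′))) ≡
      p₂ * 𝔼 p₁ (λ W → 𝔼 p₂ (λ W′ → g (W ∪ W′))) + (1ℚ - p₂) * 𝔼 p₁ (λ W → 𝔼 p₂ (λ W′ → h (W ∪ W′)))
    split g h = trans (Σ-+ {N} p₁ (1ℚ - p₁) _ _) (cong₂ _+_ (Σ-* {N} p₁ (1ℚ - p₁) p₂ _) (Σ-* {N} p₁ (1ℚ - p₁) (1ℚ - p₂) _))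
    regroup₁ : ∀ p x y → p * x + (1ℚ - p) * y ≡ y - p * (y - x)
    regroup₁ = solve 3 (λ p x y → p :* x :+ (con 1ℚ :- p) :* y := y :- p :* (y :- x)) refl
    regroup₂ : ∀ p q x y → y - (p + q - p * q) * (y - x) ≡
      p * (q * x + (1ℚ - q) * x) + (1ℚ - p) * (q * x + (1ℚ - q) * y)
    regroup₂ = solve 4 (λ p q x y → y :- (p :+ q :- p :* q) :* (y :- x) :=
      p :* (q :* x :+ (con 1ℚ :- q) :* x) :+ (con 1ℚ :- p) :* (q :* x :+ (con 1ℚ :- q) :* y)) refl

  2ℚ : ℚ
  2ℚ = 1ℚ + 1ℚ

  0≤2 : 0ℚ ≤ 2ℚ
  0≤2 = +-nonNeg 0≤1 0≤1

  -- The pair (W , T) of disjoint sets is encoded by (W ∪ T , T): moving T into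
  -- the random set costs p per element, and q = ρ p.
  Σ-exchange : ∀ {N p ρ} {f g : Subset N → Subset N → ℚ} →
    0ℚ ≤ p → p ≤ 1ℚ → 0ℚ ≤ ρ →
    (∀ W T x → x ∈ W → x ∈ T → f W T ≤ 0ℚ) →
    (∀ W T → f W T ≤ g (W ∪ T) T) → (∀ Z T → 0ℚ ≤ g Z T) →
    𝔼 p (λ W → Σ⟨ ρ * p , 1ℚ ⟩ (f W)) ≤ 𝔼 p (λ Z → Σ⟨ ρ , 1ℚ ⟩ (g Z))
  Σ-exchange {zero} _ _ _ _ f≤g _ = f≤g [] []
  Σ-exchange {suc N} {p} {ρ} {f} {g} 0≤p p≤1 0≤ρ disj f≤g 0≤g = begin
    p * 𝔼 p (λ W → q * Sf W inside inside + 1ℚ * Sf W inside outside) +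
    (1ℚ - p) * 𝔼 p (λ W → q * Sf W outside inside + 1ℚ * Sf W outside outside)
      ≡⟨ cong₂ (λ x y → p * x + (1ℚ - p) * y) (split q _ _) (split q _ _) ⟩
    p * (q * 𝔼 p (λ W → Sf W inside inside) + 1ℚ * 𝔼 p (λ W → Sf W inside outside)) +
    (1ℚ - p) * (q * 𝔼 p (λ W → Sf W outside inside) + 1ℚ * 𝔼 p (λ W → Sf W outside outside))
      ≤⟨ +-mono-≤
          (*-monoʳ-≤ 0≤p (+-mono-≤ (*-monoʳ-≤ 0≤q inin≤0) (*-monoʳ-≤ 0≤1 (IH inside outside inside disj-io f≤g-io))))
          (*-monoʳ-≤ 0≤1-p (+-mono-≤ (*-monoʳ-≤ 0≤q (IH outside inside inside disj-oi f≤g-oi))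
                                     (*-monoʳ-≤ 0≤1 (IH outside outside outside disj-oo f≤g-oo)))) ⟩
    p * (q * 0ℚ + 1ℚ * Eg inside outside) + (1ℚ - p) * (q * Eg inside inside + 1ℚ * Eg outside outside)
      ≡⟨ regroup p ρ (Eg inside inside) (Eg inside outside) (Eg outside outside) ⟩
    -- An element of `T` outside `W` weighs `(1ℚ - p) * (ρ * p)` before the exchange and `p * ρ`
    -- after it. The excess is split off as the subtracted term, which is then dropped.
    p * (ρ * Eg inside inside + 1ℚ * Eg inside outside) + (1ℚ - p) * (0ℚ + 1ℚ * Eg outside outside)
      - p * (ρ * p * Eg inside inside)
      ≤⟨ +-mono-≤ (+-monoʳ-≤ (p * (ρ * Eg inside inside + 1ℚ * Eg inside outside))
           (*-monoʳ-≤ 0≤1-p (+-monoˡ-≤ (1ℚ * Eg outside outside) (*-nonNeg 0≤ρ (0≤Eg outside inside)))))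
           (neg-antimono-≤ (*-nonNeg 0≤p (*-nonNeg 0≤q (0≤Eg inside inside)))) ⟩
    p * (ρ * Eg inside inside + 1ℚ * Eg inside outside) +
    (1ℚ - p) * (ρ * Eg outside inside + 1ℚ * Eg outside outside) - 0ℚ
      ≡⟨ +-identityʳ _ ⟩
    p * (ρ * Eg inside inside + 1ℚ * Eg inside outside) +
    (1ℚ - p) * (ρ * Eg outside inside + 1ℚ * Eg outside outside)
      ≡⟨ sym (cong₂ (λ x y → p * x + (1ℚ - p) * y) (split ρ _ _) (split ρ _ _)) ⟩
    𝔼 p (λ Z → Σ⟨ ρ , 1ℚ ⟩ (g Z)) ∎
    where
    open ≤-Reasoning
    open +-*-Solver
    q = ρ * p
    0≤q = *-nonNeg 0≤ρ 0≤p
    0≤1-p = p≤q⇒0≤q-p p≤1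
    Sf = λ W s t → Σ⟨_,_⟩ {N} q 1ℚ (λ T → f (s ∷ W) (t ∷ T))
    Eg = λ s t → 𝔼 {N} p (λ Z → Σ⟨_,_⟩ {N} ρ 1ℚ (λ T → g (s ∷ Z) (t ∷ T)))
    split : ∀ c (h k : Subset N → ℚ) → 𝔼 p (λ W → c * h W + 1ℚ * k W) ≡ c * 𝔼 p h + 1ℚ * 𝔼 p k
    split c h k = trans (Σ-+ {N} p (1ℚ - p) _ _) (cong₂ _+_ (Σ-* {N} p (1ℚ - p) c h) (Σ-* {N} p (1ℚ - p) 1ℚ k))
    inin≤0 : 𝔼 {N} p (λ W → Sf W inside inside) ≤ 0ℚ
    inin≤0 = Σ-nonPos 0≤p 0≤1-p {N} (λ W → Σ-nonPos 0≤q 0≤1 {N} (λ T → disj (inside ∷ W) (inside ∷ T) zero here here))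
    0≤Eg : ∀ s t → 0ℚ ≤ Eg s t
    0≤Eg s t = Σ-nonNeg 0≤p 0≤1-p {N} (λ Z → Σ-nonNeg 0≤ρ 0≤1 {N} (λ T → 0≤g (s ∷ Z) (t ∷ T)))
    IH : ∀ s t u → (∀ W T x → x ∈ W → x ∈ T → f (s ∷ W) (t ∷ T) ≤ 0ℚ) →
         (∀ W T → f (s ∷ W) (t ∷ T) ≤ g (u ∷ (W ∪ T)) (t ∷ T)) → 𝔼 {N} p (λ W → Sf W s t) ≤ Eg u t
    IH s t u disj′ f≤g′ = Σ-exchange {N} 0≤p p≤1 0≤ρ disj′ f≤g′ (λ Z T → 0≤g (u ∷ Z) (t ∷ T))
    disj-io = λ W T x (x∈W : x ∈ W) (x∈T : x ∈ T) → disj (inside ∷ W) (outside ∷ T) (suc x) (there x∈W) (there x∈T)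
    disj-oi = λ W T x (x∈W : x ∈ W) (x∈T : x ∈ T) → disj (outside ∷ W) (inside ∷ T) (suc x) (there x∈W) (there x∈T)
    disj-oo = λ W T x (x∈W : x ∈ W) (x∈T : x ∈ T) → disj (outside ∷ W) (outside ∷ T) (suc x) (there x∈W) (there x∈T)
    f≤g-io = λ W T → f≤g (inside ∷ W) (outside ∷ T)
    f≤g-oi = λ W T → f≤g (outside ∷ W) (inside ∷ T)
    f≤g-oo = λ W T → f≤g (outside ∷ W) (outside ∷ T)
    regroup : ∀ p ρ x y z →
      p * (ρ * p * 0ℚ + 1ℚ * y) + (1ℚ - p) * (ρ * p * x + 1ℚ * z) ≡
      p * (ρ * x + 1ℚ * y) + (1ℚ - p) * (0ℚ + 1ℚ * z) - p * (ρ * p * x)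
    regroup = solve 5 (λ p ρ x y z →
      p :* (ρ :* p :* con 0ℚ :+ con 1ℚ :* y) :+ (con 1ℚ :- p) :* (ρ :* p :* x :+ con 1ℚ :* z) :=
      p :* (ρ :* x :+ con 1ℚ :* y) :+ (con 1ℚ :- p) :* (con 0ℚ :+ con 1ℚ :* z) :- p :* (ρ :* p :* x)) refl

  ^-monoʳ-≤ : ∀ {a} → 1ℚ ≤ a → 0ℚ ≤ a → ∀ {m n} → m ℕ.≤ n → a ^ m ≤ a ^ n
  ^-monoʳ-≤ 1≤a 0≤a {n = zero}  ℕ.z≤n = ≤-refl
  ^-monoʳ-≤ {a} 1≤a 0≤a {n = suc n} ℕ.z≤n = ≤-trans (^-monoʳ-≤ 1≤a 0≤a {n = n} ℕ.z≤n)
    (subst (_≤ a * a ^ n) (*-identityˡ (a ^ n)) (*-monoˡ-≤ (^-nonNeg 0≤a n) 1≤a))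
  ^-monoʳ-≤ 1≤a 0≤a (ℕ.s≤s m≤n) = *-monoʳ-≤ 0≤a (^-monoʳ-≤ 1≤a 0≤a m≤n)

  -- Each `T` that contributes weighs `ρ ^ ∣ T ∣ ≤ ρ ^ j`, and there are at most `2ℚ ^ ∣ S ∣` of
  -- them.
  Σ-tail : ∀ {N ρ} j (S : Subset N) {f : Subset N → ℚ} → 0ℚ ≤ ρ → ρ ≤ 1ℚ →
    (∀ T → f T ≤ 1ℚ) → (∀ T → ¬ (T ⊆ S × j ℕ.≤ ∣ T ∣) → f T ≤ 0ℚ) →
    Σ⟨ ρ , 1ℚ ⟩ f ≤ ρ ^ j * 2ℚ ^ ∣ S ∣
  Σ-tail {zero} zero [] {f} 0≤ρ ρ≤1 f≤1 f≤0 = f≤1 []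
  Σ-tail {zero} {ρ} (suc j) [] {f} 0≤ρ ρ≤1 f≤1 f≤0 =
    ≤-trans (f≤0 [] (λ ())) (*-nonNeg (^-nonNeg 0≤ρ (suc j)) (^-nonNeg 0≤2 0))
  Σ-tail {suc N} {ρ} j (outside ∷ S) {f} 0≤ρ ρ≤1 f≤1 f≤0 = begin
    ρ * Σ⟨_,_⟩ {N} ρ 1ℚ (f ∘ (inside ∷_)) + 1ℚ * Σ⟨_,_⟩ {N} ρ 1ℚ (f ∘ (outside ∷_))
      ≤⟨ +-mono-≤ (*-monoʳ-≤ 0≤ρ (Σ-nonPos 0≤ρ 0≤1 {N} (λ T → f≤0 (inside ∷ T) (λ (T⊆ , _) → absurd (T⊆ here)))))
                  (*-monoʳ-≤ 0≤1 (Σ-tail j S 0≤ρ ρ≤1 (f≤1 ∘ (outside ∷_))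
                     (λ T ¬T → f≤0 (outside ∷ T) (λ (T⊆ , j≤) → ¬T (Sub.drop-∷-⊆ T⊆ , j≤))))) ⟩
    ρ * 0ℚ + 1ℚ * (ρ ^ j * 2ℚ ^ ∣ S ∣)
      ≡⟨ trans (cong₂ _+_ (*-zeroʳ ρ) (*-identityˡ (ρ ^ j * 2ℚ ^ ∣ S ∣))) (+-identityˡ (ρ ^ j * 2ℚ ^ ∣ S ∣)) ⟩
    ρ ^ j * 2ℚ ^ ∣ S ∣ ∎
    where
    open ≤-Reasoning
    absurd : ∀ {S : Subset N} → zero ∈ (outside ∷ S) → ⊥
    absurd ()
  Σ-tail {suc N} {ρ} j (inside ∷ S) {f} 0≤ρ ρ≤1 f≤1 f≤0 = begin
    ρ * Σ⟨_,_⟩ {N} ρ 1ℚ (f ∘ (inside ∷_)) + 1ℚ * Σ⟨_,_⟩ {N} ρ 1ℚ (f ∘ (outside ∷_))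
      ≤⟨ +-mono-≤ (inside-part j f≤0)
                  (*-monoʳ-≤ 0≤1 (Σ-tail j S 0≤ρ ρ≤1 (f≤1 ∘ (outside ∷_))
                     (λ T ¬T → f≤0 (outside ∷ T) (λ (T⊆ , j≤) → ¬T (Sub.out⊆-⇔ .from T⊆ , j≤))))) ⟩
    ρ ^ j * P + 1ℚ * (ρ ^ j * P)
      ≡⟨ double (ρ ^ j) P ⟩
    ρ ^ j * (2ℚ * P) ∎
    where
    open ≤-Reasoning
    open +-*-Solver
    open import Function.Bundles using (Equivalence)
    open Equivalence
    P = 2ℚ ^ ∣ S ∣
    0≤P = ^-nonNeg 0≤2 ∣ S ∣
    double : ∀ x y → x * y + 1ℚ * (x * y) ≡ x * (2ℚ * y)
    double = solve 2 (λ x y → x :* y :+ con 1ℚ :* (x :* y) := x :* ((con 1ℚ :+ con 1ℚ) :* y)) refl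
    inside-part : ∀ j → (∀ T → ¬ (T ⊆ (inside ∷ S) × j ℕ.≤ ∣ T ∣) → f T ≤ 0ℚ) →
                  ρ * Σ⟨_,_⟩ {N} ρ 1ℚ (f ∘ (inside ∷_)) ≤ ρ ^ j * P
    inside-part zero f≤0 = *-mono-≤ 0≤ρ 0≤P ρ≤1 (subst (Σ⟨_,_⟩ {N} ρ 1ℚ (f ∘ (inside ∷_)) ≤_) (*-identityˡ P)
      (Σ-tail 0 S 0≤ρ ρ≤1 (f≤1 ∘ (inside ∷_))
        (λ T ¬T → f≤0 (inside ∷ T) (λ (T⊆ , _) → ¬T (Sub.drop-∷-⊆ T⊆ , ℕ.z≤n)))))
    inside-part (suc j) f≤0 = subst (ρ * Σ⟨_,_⟩ {N} ρ 1ℚ (f ∘ (inside ∷_)) ≤_) (sym (*-assoc ρ (ρ ^ j) P))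
      (*-monoʳ-≤ 0≤ρ (Σ-tail j S 0≤ρ ρ≤1 (f≤1 ∘ (inside ∷_))
        (λ T ¬T → f≤0 (inside ∷ T) (λ (T⊆ , j≤) → ¬T (Sub.drop-∷-⊆ T⊆ , ℕ.s≤s⁻¹ j≤)))))

-- Minimal fragments and families without a cheap cover

module Survival where

  open import Data.Nat.Base as ℕ using (ℕ; zero; suc)
  import Data.Nat.Properties as ℕ
  open import Data.Rational.Base using (ℚ; 0ℚ; 1ℚ; _+_; _*_; _-_; -_; _≤_)
  open import Data.Rational.Properties
  open import Data.Rational.Solver using (module +-*-Solver)
  open import Algebra.Definitions.RawSemiring +-*-rawSemiring using (_^_)
  open import Data.Fin.Base using (Fin; zero; suc)
  import Data.Fin.Properties as Fin
  open import Data.Fin.Subset as Sub using (Subset; inside; outside; _∈_; _⊆_; _∪_; _─_; ∣_∣)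
  import Data.Fin.Subset.Properties as Sub
  open import Data.Vec.Base using (_∷_; here; there)
  open import Data.Product.Base using (∃; _×_; _,_; proj₁; proj₂)
  open import Data.Sum.Base using (_⊎_; inj₁; inj₂; [_,_]′)
  open import Data.Empty using (⊥-elim; ⊥)
  open import Function.Base using (_∘_; id)
  open import Relation.Nullary using (Dec; yes; no; ¬_)
  open import Relation.Nullary.Decidable using (¬?; _×-dec_; _→-dec_; _⊎-dec_; decidable-stable)
  open import Relation.Unary using (Pred; Decidable)
  open import Relation.Binary.PropositionalEquality
  open import Level using (0ℓ)
  open SubsetSums

  module _ {N : ℕ} where

    Increasing : Pred (Subset N) 0ℓ → Set
    Increasing A = ∀ {S T} → S ⊆ T → A S → A T

    Covers : Pred (Subset N) 0ℓ → Pred (Subset N) 0ℓ → Set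
    Covers U A = ∀ S → A S → ∃ λ T → U T × T ⊆ S

    -- The size bound is put on generators, since a nonempty increasing family always contains the
    -- full set.
    GeneratedBelow : ℕ → Pred (Subset N) 0ℓ → Set
    GeneratedBelow ℓ A = ∀ S → A S → ∃ λ T → A T × T ⊆ S × ∣ T ∣ ℕ.≤ ℓ

    -- The expected number of members of `U` inside a random set of density `q`: the second weight
    -- `1ℚ` leaves `q ^ ∣ T ∣` for each member `T`.
    cost : ℚ → {U : Pred (Subset N) 0ℓ} → Decidable U → ℚ
    cost q U? = Σ⟨ q , 1ℚ ⟩ (λ T → indicator (U? T))

    cost-nonNeg : ∀ {q} {U : Pred (Subset N) 0ℓ} (U? : Decidable U) → 0ℚ ≤ q → 0ℚ ≤ cost q U?
    cost-nonNeg U? 0≤q = Σ-nonNeg 0≤q 0≤1 {N} (λ T → 0≤indicator (U? T))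

    missing : {A : Pred (Subset N) 0ℓ} → Decidable A → Subset N → ℚ
    missing A? S = indicator (¬? (A? S))

    ∪-mono : ∀ {S T S′ T′ : Subset N} → S ⊆ S′ → T ⊆ T′ → S ∪ T ⊆ S′ ∪ T′
    ∪-mono {S} {T} S⊆ T⊆ x∈ = Sub.x∈p∪q⁺ ([ inj₁ ∘ S⊆ , inj₂ ∘ T⊆ ]′ (Sub.x∈p∪q⁻ S T x∈))

    ∪-monoʳ-⊆ : ∀ (W S T : Subset N) → T ⊆ S → W ∪ T ⊆ W ∪ S
    ∪-monoʳ-⊆ W S T = ∪-mono {W} {T} {W} {S} id

    -- Testing the removal of single elements is enough: when `A` is increasing it rules out all
    -- proper subsets of `T`, as `minimal-⊆` shows.
    Minimal : Pred (Subset N) 0ℓ → Subset N → Subset N → Set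
    Minimal A W T = A (W ∪ T) × (∀ x → x ∈ T → ¬ A (W ∪ (T Sub.- x)))

    module Fragments {A : Pred (Subset N) 0ℓ} (A? : Decidable A) (inc : Increasing A) where

      minimal? : ∀ W T → Dec (Minimal A W T)
      minimal? W T = A? (W ∪ T) ×-dec Fin.all? (λ x → (x Sub.∈? T) →-dec ¬? (A? (W ∪ (T Sub.- x))))

      minimal-exists : ∀ n W S → ∣ S ∣ ℕ.< n → A (W ∪ S) → ∃ λ T → Minimal A W T × T ⊆ S
      minimal-exists (suc n) W S ∣S∣<n a
        with Fin.any? (λ x → (x Sub.∈? S) ×-dec A? (W ∪ (S Sub.- x)))
      ... | no ∄x = S , (a , λ x x∈S a′ → ∄x (x , x∈S , a′)) , id
      ... | yes (x , x∈S , a′)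
        with minimal-exists n W (S Sub.- x) (ℕ.<-≤-trans (Sub.x∈p⇒∣p-x∣<∣p∣ x∈S) (ℕ.s≤s⁻¹ ∣S∣<n)) a′
      ... | T , min , T⊆ = T , min , (λ y∈T → Sub.p─q⊆p S Sub.⁅ x ⁆ (T⊆ y∈T))

      minimal-⊆ : ∀ {W T} → Minimal A W T → ∀ {T′} → A (W ∪ T′) → T′ ⊆ T → T ⊆ T′
      minimal-⊆ {W} {T} (_ , min) {T′} a T′⊆T {x} x∈T = decidable-stable (x Sub.∈? T′) λ x∉T′ →
        min x x∈T (inc (∪-monoʳ-⊆ W (T Sub.- x) T′
          λ y∈T′ → Sub.x∈p∧x≢y⇒x∈p-y (T′⊆T y∈T′) (λ y≡x → x∉T′ (subst (_∈ T′) y≡x y∈T′))) a)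

      minimal-disjoint : ∀ {W T} → Minimal A W T → ∀ x → x ∈ W → x ∈ T → ⊥
      minimal-disjoint {W} {T} (a , min) x x∈W x∈T = min x x∈T (inc sub a)
        where
        sub : W ∪ T ⊆ W ∪ (T Sub.- x)
        sub {y} y∈ with y Fin.≟ x | Sub.x∈p∪q⁻ W T y∈
        ... | yes refl | _         = Sub.x∈p∪q⁺ (inj₁ x∈W)
        ... | no  _    | inj₁ y∈W  = Sub.x∈p∪q⁺ (inj₁ y∈W)
        ... | no  y≢x  | inj₂ y∈T  = Sub.x∈p∪q⁺ (inj₂ (Sub.x∈p∧x≢y⇒x∈p-y y∈T y≢x))

      -- The key point of the argument: W need not be known to locate T, since T
      -- lies in any member of A inside W ∪ T.
      minimal-⊆-member : ∀ {W T S} → Minimal A W T → A S → S ⊆ W ∪ T → T ⊆ S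
      minimal-⊆-member {W} {T} {S} min a S⊆ x∈T =
        -- `S ─ W` lies inside `T` and already completes `W` to a member of `A`, so minimality gives
        -- `T ⊆ S ─ W`.
        Sub.p─q⊆p S W (minimal-⊆ min (inc S⊆W∪S─W a) S─W⊆T x∈T)
        where
        S⊆W∪S─W : S ⊆ W ∪ (S ─ W)
        S⊆W∪S─W {x} x∈S with x Sub.∈? W
        ... | yes x∈W = Sub.x∈p∪q⁺ (inj₁ x∈W)
        ... | no  x∉W = Sub.x∈p∪q⁺ (inj₂ (Sub.x∈p∧x∉q⇒x∈p─q x∈S x∉W))
        S─W⊆T : S ─ W ⊆ T
        S─W⊆T {x} x∈ with Sub.x∈p∪q⁻ W T (S⊆ (Sub.p─q⊆p S W x∈))
        ... | inj₂ x∈T = x∈T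
        ... | inj₁ x∈W = ⊥-elim (∉-─ S W x∈ x∈W)
          where
          ∉-─ : ∀ {n} (S W : Subset n) {x : Fin n} → x ∈ S ─ W → x ∈ W → ⊥
          ∉-─ (s ∷ S) (inside ∷ W)  {zero}  () here
          ∉-─ (s ∷ S) (inside ∷ W)  {suc x} (there x∈) (there x∈W) = ∉-─ S W x∈ x∈W
          ∉-─ (s ∷ S) (outside ∷ W) {suc x} (there x∈) (there x∈W) = ∉-─ S W x∈ x∈W

      Large : ℕ → Subset N → Pred (Subset N) 0ℓ
      Large r W T = Minimal A W T × r ℕ.< ∣ T ∣

      large? : ∀ r W → Decidable (Large r W)
      large? r W T = minimal? W T ×-dec (r ℕ.<? ∣ T ∣)

      -- Closed upwards so that the next round can be applied to it as an increasing family.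
      Small : ℕ → Subset N → Pred (Subset N) 0ℓ
      Small r W S = ∃ λ T → (Minimal A W T × ∣ T ∣ ℕ.≤ r) × T ⊆ S

      small? : ∀ r W → Decidable (Small r W)
      small? r W S = Sub.anySubset? (λ T → (minimal? W T ×-dec (∣ T ∣ ℕ.≤? r)) ×-dec (T Sub.⊆? S))

      𝔼-cost-large : ∀ {ℓ p ρ} r → GeneratedBelow ℓ A → 0ℚ ≤ p → p ≤ 1ℚ → 0ℚ ≤ ρ → ρ ≤ 1ℚ →
        𝔼 p (λ W → cost (ρ * p) (large? r W)) ≤ ρ ^ suc r * 2ℚ ^ ℓ
      𝔼-cost-large {ℓ} {p} {ρ} r gen 0≤p p≤1 0≤ρ ρ≤1 = begin
        𝔼 p (λ W → cost (ρ * p) (large? r W))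
          ≤⟨ Σ-exchange {N} {g = λ Z → g Z (A? Z)} 0≤p p≤1 0≤ρ disj f≤g (λ Z → 0≤g Z (A? Z)) ⟩
        𝔼 p (λ Z → Σ⟨ ρ , 1ℚ ⟩ (g Z (A? Z)))
          ≤⟨ Σ-mono 0≤p (p≤q⇒0≤q-p p≤1) {N} (λ Z → bound Z (A? Z)) ⟩
        𝔼 {N} p (λ _ → ρ ^ suc r * 2ℚ ^ ℓ)
          ≡⟨ 𝔼-const {N} p _ ⟩
        ρ ^ suc r * 2ℚ ^ ℓ ∎
        where
        open ≤-Reasoning
        G? : ∀ Z (a : A Z) T → Dec (T ⊆ proj₁ (gen Z a) × suc r ℕ.≤ ∣ T ∣)
        G? Z a T = (T Sub.⊆? proj₁ (gen Z a)) ×-dec (suc r ℕ.≤? ∣ T ∣)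
        g : ∀ Z → Dec (A Z) → Subset N → ℚ
        g Z (yes a) T = indicator (G? Z a T)
        -- No pair is encoded by such a `Z`, because a minimal `T` puts `W ∪ T` into `A`.
        g Z (no  _) T = 0ℚ
        0≤g : ∀ Z d T → 0ℚ ≤ g Z d T
        0≤g Z (yes a) T = 0≤indicator (G? Z a T)
        0≤g Z (no  _) T = ≤-refl
        disj : ∀ W T x → x ∈ W → x ∈ T → indicator (large? r W T) ≤ 0ℚ
        disj W T x x∈W x∈T = ≤-reflexive (indicator-no (large? r W T)
          (λ (min , _) → minimal-disjoint min x x∈W x∈T))
        f≤g : ∀ W T → indicator (large? r W T) ≤ g (W ∪ T) (A? (W ∪ T)) T
        f≤g W T = f≤g′ W T (A? (W ∪ T))
          where
          f≤g′ : ∀ W T d → indicator (large? r W T) ≤ g (W ∪ T) d T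
          f≤g′ W T (yes a) = indicator-mono (large? r W T) (G? (W ∪ T) a T)
            (λ (min , r<) → minimal-⊆-member min (proj₁ (proj₂ (gen (W ∪ T) a)))
                              (proj₁ (proj₂ (proj₂ (gen (W ∪ T) a)))) , r<)
          f≤g′ W T (no ¬a) = ≤-reflexive (indicator-no (large? r W T) (λ ((a , _) , _) → ¬a a))
        bound : ∀ Z d → Σ⟨ ρ , 1ℚ ⟩ (g Z d) ≤ ρ ^ suc r * 2ℚ ^ ℓ
        bound Z (no _)  = ≤-trans (≤-reflexive (Σ-zero {N} ρ 1ℚ))
                            (*-nonNeg (^-nonNeg 0≤ρ (suc r)) (^-nonNeg 0≤2 ℓ))
        bound Z (yes a) = ≤-trans
          (Σ-tail (suc r) (proj₁ (gen Z a)) 0≤ρ ρ≤1 (λ T → indicator≤1 (G? Z a T))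
            (λ T ¬T → ≤-reflexive (indicator-no (G? Z a T) ¬T)))
          (*-monoʳ-≤ (^-nonNeg 0≤ρ (suc r))
            (^-monoʳ-≤ (p≤p+q 0≤1) 0≤2 (proj₂ (proj₂ (proj₂ (gen Z a))))))

  -- The deficit d replaces an application of Markov's inequality in each round:
  -- whatever a round spends on the cover is added to d.
  SurvivalBound : (N : ℕ) (q : ℚ) (ℓ : ℕ) (p₀ ε : ℚ) → Set₁
  SurvivalBound N q ℓ p₀ ε = ∀ {A : Pred (Subset N) 0ℓ} (A? : Decidable A) → Increasing A → GeneratedBelow ℓ A →
    ∀ d → 0ℚ ≤ d →
    (∀ {U : Pred (Subset N) 0ℓ} (U? : Decidable U) → Covers U A → 1ℚ ≤ cost q U? + d) →
    ∀ p → p₀ ≤ p → p ≤ 1ℚ → 𝔼 p (missing A?) ≤ ε + d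

  -- All generators are ∅, so `A` holds of every set or of none. In the second case the empty family
  -- is a cover of cost 0, which forces `1ℚ ≤ d`.
  survival-zero : ∀ {N q} → SurvivalBound N q 0 0ℚ 0ℚ
  survival-zero {N} {q} {A} A? inc gen d 0≤d uncov p 0≤p p≤1 = subst (𝔼 p (missing A?) ≤_) (sym (+-identityˡ d)) bound
    where
    bound : 𝔼 p (missing A?) ≤ d
    bound with A? Sub.⊥
    ... | yes a = ≤-trans (Σ-nonPos 0≤p (p≤q⇒0≤q-p p≤1) {N}
            (λ S → ≤-reflexive (indicator-no (¬? (A? S)) (λ ¬a → ¬a (inc (Sub.⊆-min S) a))))) 0≤d
    ... | no ¬a = begin
      𝔼 p (missing A?)     ≤⟨ Σ-mono 0≤p (p≤q⇒0≤q-p p≤1) {N} (λ S → indicator≤1 (¬? (A? S))) ⟩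
      𝔼 {N} p (λ _ → 1ℚ)   ≡⟨ 𝔼-const {N} p 1ℚ ⟩
      1ℚ                   ≤⟨ uncov (λ _ → no id) (λ S a → ⊥-elim (empty S a)) ⟩
      Σ⟨_,_⟩ {N} q 1ℚ (λ _ → 0ℚ) + d    ≡⟨ cong (_+ d) (Σ-zero {N} q 1ℚ) ⟩
      0ℚ + d               ≡⟨ +-identityˡ d ⟩
      d ∎
      where
      open ≤-Reasoning
      empty : ∀ S → A S → ⊥
      empty S a with gen S a
      ... | T , aT , _ , ∣T∣≤0 = ¬a (subst A (Sub.Empty-unique λ (x , x∈T) →
              ℕ.<⇒≱ (Sub.x∈p⇒∣p-x∣<∣p∣ x∈T) (ℕ.≤-trans ∣T∣≤0 ℕ.z≤n)) aT)

  -- For fixed `W` the cost of the large fragments is added to the deficit, and the second exposure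
  -- is left to `next`, applied to `Small r W`. That cost depends on `W` and may be large for some;
  -- only its average, bounded by `𝔼-cost-large`, matters in the end.
  survival-step : ∀ {N ℓ r p₁ p₀ ρ ε} →
    0ℚ ≤ p₁ → 0ℚ ≤ p₀ → 0ℚ ≤ ρ → ρ ≤ 1ℚ →
    SurvivalBound N (ρ * p₁) r p₀ ε →
    SurvivalBound N (ρ * p₁) ℓ (p₁ + p₀) (ε + ρ ^ suc r * 2ℚ ^ ℓ)
  survival-step {N} {ℓ} {r} {p₁} {p₀} {ρ} {ε} 0≤p₁ 0≤p₀ 0≤ρ ρ≤1 next {A} A? inc gen d 0≤d uncov p p₁+p₀≤p p≤1 = begin
    𝔼 p (missing A?)
      ≤⟨ 𝔼-∪ {N} (λ {S} {T} S⊆T → indicator-mono (¬? (A? T)) (¬? (A? S)) (λ ¬a a → ¬a (inc S⊆T a)))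
            0≤p₁ p₁≤1 0≤p₀ p₀≤1 p₁+p₀≤p p≤1 ⟩
    𝔼 p₁ (λ W → 𝔼 p₀ (λ W′ → missing A? (W ∪ W′)))
      ≤⟨ Σ-mono 0≤p₁ 0≤1-p₁ {N} step ⟩
    𝔼 p₁ (λ W → (ε + d) + cost q (large? r W))
      ≡⟨ Σ-+ {N} p₁ (1ℚ - p₁) _ _ ⟩
    𝔼 {N} p₁ (λ W → ε + d) + 𝔼 p₁ (λ W → cost q (large? r W))
      ≤⟨ +-mono-≤ (≤-reflexive (𝔼-const {N} p₁ (ε + d))) (𝔼-cost-large r gen 0≤p₁ p₁≤1 0≤ρ ρ≤1) ⟩
    (ε + d) + ρ ^ suc r * 2ℚ ^ ℓ
      ≡⟨ regroup ε d (ρ ^ suc r * 2ℚ ^ ℓ) ⟩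
    (ε + ρ ^ suc r * 2ℚ ^ ℓ) + d ∎
    where
    open ≤-Reasoning
    open +-*-Solver
    open Fragments A? inc
    q = ρ * p₁
    0≤q = *-nonNeg 0≤ρ 0≤p₁
    p₁≤1 : p₁ ≤ 1ℚ
    p₁≤1 = ≤-trans (p≤p+q 0≤p₀) (≤-trans p₁+p₀≤p p≤1)
    p₀≤1 : p₀ ≤ 1ℚ
    p₀≤1 = ≤-trans (p≤q+p 0≤p₁) (≤-trans p₁+p₀≤p p≤1)
    0≤1-p₁ = p≤q⇒0≤q-p p₁≤1
    regroup : ∀ a b c → (a + b) + c ≡ (a + c) + b
    regroup = solve 3 (λ a b c → (a :+ b) :+ c := (a :+ c) :+ b) refl
    step : ∀ W → 𝔼 p₀ (λ W′ → missing A? (W ∪ W′)) ≤ (ε + d) + cost q (large? r W)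
    step W = begin
      𝔼 p₀ (λ W′ → missing A? (W ∪ W′))
        ≤⟨ Σ-mono 0≤p₀ (p≤q⇒0≤q-p p₀≤1) {N} (λ W′ → indicator-mono (¬? (A? (W ∪ W′))) (¬? (small? r W W′))
             (λ ¬a (T , ((a , _) , _) , T⊆) → ¬a (inc (∪-monoʳ-⊆ W W′ T T⊆) a))) ⟩
      𝔼 p₀ (missing (small? r W))
        ≤⟨ next (small? r W) (λ S⊆T (F , min , F⊆) → F , min , (λ x∈F → S⊆T (F⊆ x∈F)))
             (λ S (F , min , F⊆) → F , (F , min , id) , F⊆ , proj₂ min)
             (d + cost q (large? r W)) (+-nonNeg 0≤d (cost-nonNeg (large? r W) 0≤q)) uncov′ p₀ ≤-refl p₀≤1 ⟩
      ε + (d + cost q (large? r W))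
        ≡⟨ sym (+-assoc ε d _) ⟩
      (ε + d) + cost q (large? r W) ∎
      where
      uncov′ : ∀ {U : Pred (Subset N) 0ℓ} (U? : Decidable U) → Covers U (Small r W) →
               1ℚ ≤ cost q U? + (d + cost q (large? r W))
      uncov′ {U} U? cov = begin
        1ℚ
          ≤⟨ uncov U∪L? cov′ ⟩
        cost q U∪L? + d
          ≤⟨ +-monoˡ-≤ d (Σ-mono 0≤q 0≤1 {N} (λ T → either (U? T) (large? r W T))) ⟩
        Σ⟨ q , 1ℚ ⟩ (λ T → indicator (U? T) + indicator (large? r W T)) + d
          ≡⟨ cong (_+ d) (Σ-+ {N} q 1ℚ _ _) ⟩
        cost q U? + cost q (large? r W) + d
          ≡⟨ trans (+-assoc (cost q U?) _ d) (cong (cost q U? +_) (+-comm _ d)) ⟩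
        cost q U? + (d + cost q (large? r W)) ∎
        where
        U∪L? : Decidable (λ T → U T ⊎ Large r W T)
        U∪L? T = U? T ⊎-dec large? r W T
        either : ∀ {P Q : Set} (P? : Dec P) (Q? : Dec Q) → indicator (P? ⊎-dec Q?) ≤ indicator P? + indicator Q?
        either (yes _) Q? = p≤p+q (0≤indicator Q?)
        either (no _)  (yes _) = ≤-reflexive (sym (+-identityˡ 1ℚ))
        either (no _)  (no _)  = ≤-reflexive (sym (+-identityˡ 0ℚ))
        -- Each `S` in `A` contains a minimal fragment `F` for `W`. A large `F` is itself in the
        -- cover; a small one belongs to `Small r W`, so a member of `U` lies inside it.
        cov′ : Covers (λ T → U T ⊎ Large r W T) A
        cov′ S a with minimal-exists (suc ∣ S ∣) W S ℕ.≤-refl (inc (Sub.q⊆p∪q W S) a)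
        ... | F , min , F⊆S with ℕ._≤?_ ∣ F ∣ r
        ...   | no ∣F∣≰r = F , inj₂ (min , ℕ.≰⇒> ∣F∣≰r) , F⊆S
        ...   | yes ∣F∣≤r with cov F (F , (min , ∣F∣≤r) , id)
        ...     | T , u , T⊆F = T , inj₁ u , (λ x∈T → F⊆S (T⊆F x∈T))

-- Counting in lists, and the orderings of a list

module Counting where

  open import Data.Nat.Base
  open import Data.Nat.Properties
  open import Data.Bool.Base using (if_then_else_)
  open import Data.List.Base using (List; []; _∷_; _++_; map; concatMap; length)
  open import Data.Nat.ListAction using (sum)
  open import Algebra.Properties.CommutativeSemigroup +-commutativeSemigroup using (interchange)
  open import Data.List.Properties using (map-∘)
  open import Data.List.Membership.Propositional using (_∈_; find)
  open import Data.List.Membership.Propositional.Properties using (∈-map⁻; ∈-concatMap⁻)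
  open import Data.List.Relation.Unary.Any using (here; there)
  open import Data.List.Relation.Unary.All as All using ([]; _∷_)
  import Data.List.Relation.Unary.All.Properties as All
  open import Data.List.Relation.Unary.AllPairs using ([]; _∷_)
  open import Data.List.Relation.Unary.Unique.Propositional using (Unique)
  open import Data.List.Relation.Binary.Permutation.Propositional as ↭ using (_↭_; ↭-refl; ↭-trans; ↭⇒↭ₛ)
  open import Data.List.Relation.Binary.Permutation.Propositional.Properties using (↭-length)
  import Data.List.Relation.Binary.Permutation.Setoid.Properties as Permₛ
  open import Data.Vec.Base using (Vec; []; _∷_; toList)
  open import Data.Product.Base using (_×_; _,_; proj₁)
  open import Data.Sum.Base using (_⊎_; [_,_]′)
  open import Data.Unit.Base using (⊤; tt)
  open import Data.Empty using (⊥-elim)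
  open import Function.Base using (_∘_; id)
  open import Relation.Nullary using (Dec; yes; no; ¬_; does)
  open import Relation.Unary using (Pred; Decidable)
  open import Relation.Binary.PropositionalEquality
  open import Level using (0ℓ)

  Unique-resp-↭ : ∀ {A : Set} {xs ys : List A} → xs ↭ ys → Unique xs → Unique ys
  Unique-resp-↭ {A} = Permₛ.Unique-resp-↭ (setoid A) ∘ ↭⇒↭ₛ

  ⟦_⟧ : ∀ {P : Set} → Dec P → ℕ
  ⟦ P? ⟧ = if does P? then 1 else 0

  ⟦⟧-mono : ∀ {P Q : Set} (P? : Dec P) (Q? : Dec Q) → (P → Q) → ⟦ P? ⟧ ≤ ⟦ Q? ⟧
  ⟦⟧-mono (no _)  Q?      f = z≤n
  ⟦⟧-mono (yes p) (yes q) f = ≤-refl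
  ⟦⟧-mono (yes p) (no ¬q) f = ⊥-elim (¬q (f p))

  ⟦⟧-⊎ : ∀ {P Q R : Set} (P? : Dec P) (Q? : Dec Q) (R? : Dec R) → (P → Q ⊎ R) → ⟦ P? ⟧ ≤ ⟦ Q? ⟧ + ⟦ R? ⟧
  ⟦⟧-⊎ (no _)  Q?      R?      f = z≤n
  ⟦⟧-⊎ (yes p) (yes q) R?      f = s≤s z≤n
  ⟦⟧-⊎ (yes p) (no ¬q) (yes _) f = ≤-refl
  ⟦⟧-⊎ (yes p) (no ¬q) (no ¬r) f = ⊥-elim ([ ¬q , ¬r ]′ (f p))

  # : ∀ {A : Set} {P : Pred A 0ℓ} → Decidable P → List A → ℕ
  # P? xs = sum (map (λ x → ⟦ P? x ⟧) xs)

  module _ {A : Set} where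

    sum-mono : ∀ {f g : A → ℕ} xs → (∀ x → x ∈ xs → f x ≤ g x) → sum (map f xs) ≤ sum (map g xs)
    sum-mono []       f≤g = z≤n
    sum-mono (x ∷ xs) f≤g = +-mono-≤ (f≤g x (here refl)) (sum-mono xs (λ y y∈ → f≤g y (there y∈)))

    sum-*ʳ : ∀ (f : A → ℕ) c xs → sum (map (λ x → f x * c) xs) ≡ sum (map f xs) * c
    sum-*ʳ f c []       = refl
    sum-*ʳ f c (x ∷ xs) = trans (cong (f x * c +_) (sum-*ʳ f c xs)) (sym (*-distribʳ-+ c (f x) _))

    sum-zero : ∀ (xs : List A) → sum (map (λ _ → 0) xs) ≡ 0
    sum-zero []       = refl
    sum-zero (x ∷ xs) = sum-zero xs

    module _ {P Q : Pred A 0ℓ} (P? : Decidable P) (Q? : Decidable Q) where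

      #-mono : ∀ xs → (∀ x → x ∈ xs → P x → Q x) → # P? xs ≤ # Q? xs
      #-mono xs P→Q = sum-mono xs (λ x x∈ → ⟦⟧-mono (P? x) (Q? x) (P→Q x x∈))

    module _ {P : Pred A 0ℓ} (P? : Decidable P) where

      #-none : ∀ xs → (∀ x → x ∈ xs → ¬ P x) → # P? xs ≡ 0
      #-none xs ¬P = n≤0⇒n≡0 (≤-trans (#-mono P? (λ _ → no id) xs ¬P) (≤-reflexive (sum-zero xs)))

      #-⊎ : ∀ {Q R : Pred A 0ℓ} (Q? : Decidable Q) (R? : Decidable R) xs →
            (∀ x → x ∈ xs → P x → Q x ⊎ R x) → # P? xs ≤ # Q? xs + # R? xs
      #-⊎ Q? R? []       f = z≤n
      #-⊎ Q? R? (x ∷ xs) f = ≤-trans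
        (+-mono-≤ (⟦⟧-⊎ (P? x) (Q? x) (R? x) (f x (here refl))) (#-⊎ Q? R? xs (λ y y∈ → f y (there y∈))))
        (≤-reflexive (interchange ⟦ Q? x ⟧ ⟦ R? x ⟧ (# Q? xs) (# R? xs)))

      #-++ : ∀ xs ys → # P? (xs ++ ys) ≡ # P? xs + # P? ys
      #-++ []       ys = refl
      #-++ (x ∷ xs) ys = trans (cong (⟦ P? x ⟧ +_) (#-++ xs ys)) (sym (+-assoc ⟦ P? x ⟧ _ _))

      #-map : ∀ {B : Set} (f : B → A) xs → # P? (map f xs) ≡ # (λ x → P? (f x)) xs
      #-map f xs = cong sum (sym (map-∘ xs))

      #-concatMap : ∀ {B : Set} (f : B → List A) xs → # P? (concatMap f xs) ≡ sum (map (λ x → # P? (f x)) xs)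
      #-concatMap f []       = refl
      #-concatMap f (x ∷ xs) = trans (#-++ (f x) (concatMap f xs)) (cong (# P? (f x) +_) (#-concatMap f xs))

      #-↭ : ∀ {xs ys} → xs ↭ ys → # P? xs ≡ # P? ys
      #-↭ ↭.refl         = refl
      #-↭ (↭.prep x p)   = cong (⟦ P? x ⟧ +_) (#-↭ p)
      #-↭ {x ∷ y ∷ xs} (↭.swap x y p) = trans (sym (+-assoc ⟦ P? x ⟧ ⟦ P? y ⟧ _))
        (trans (cong₂ _+_ (+-comm ⟦ P? x ⟧ ⟦ P? y ⟧) (#-↭ p)) (+-assoc ⟦ P? y ⟧ ⟦ P? x ⟧ _))
      #-↭ (↭.trans p q)  = trans (#-↭ p) (#-↭ q)

      #-unique≤1 : ∀ {xs} → Unique xs → (∀ {x y} → P x → P y → x ≡ y) → # P? xs ≤ 1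
      #-unique≤1 []                   P-prop = z≤n
      #-unique≤1 {x ∷ xs} (x∉ ∷ uniq) P-prop with P? x
      ... | yes p = s≤s (≤-reflexive (#-none xs (λ y y∈ q → All.lookup x∉ y∈ (P-prop p q))))
      ... | no  _ = #-unique≤1 uniq P-prop

  picks : ∀ {A : Set} → List A → List (A × List A)
  picks []       = []
  picks (x ∷ xs) = (x , xs) ∷ map (λ (y , ys) → y , x ∷ ys) (picks xs)

  -- For `length R ≡ s` these are the `s !` orderings of `R`. Listing them by their first entry lets
  -- later counts condition on the vertex placed next.
  arrangements : ∀ {A : Set} s → List A → List (Vec A s)
  arrangements zero    R = [] ∷ []
  arrangements (suc s) R = concatMap (λ (x , R′) → map (x ∷_) (arrangements s R′)) (picks R)

  module _ {A : Set} where

    picks-↭ : ∀ (R : List A) {x R′} → (x , R′) ∈ picks R → R ↭ x ∷ R′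
    picks-↭ (x ∷ R) (here refl) = ↭-refl
    picks-↭ (x ∷ R) (there p) with ∈-map⁻ _ p
    ... | (y , ys) , q , refl = ↭-trans (↭.prep x (picks-↭ R q)) (↭.swap x y ↭-refl)

    -- Used to sum a bound that depends on the chosen entry but not on the remaining list.
    sum-picks : ∀ (f : A → ℕ) R → sum (map (f ∘ proj₁) (picks R)) ≡ sum (map f R)
    sum-picks f []      = refl
    sum-picks f (x ∷ R) = cong (f x +_) (trans (cong sum (sym (map-∘ (picks R)))) (sum-picks f R))

    arrangements-↭ : ∀ s {R : List A} {σ} → length R ≡ s → σ ∈ arrangements s R → R ↭ toList σ
    arrangements-↭ zero {[]} len (here refl) = ↭-refl
    arrangements-↭ (suc s) {R} len σ∈ with find (∈-concatMap⁻ _ {xs = picks R} σ∈)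
    ... | (x , R′) , pick , σ∈′ with ∈-map⁻ _ σ∈′
    ... | τ , τ∈ , refl = ↭-trans R↭ (↭.prep x (arrangements-↭ s (suc-injective (trans (sym (↭-length R↭)) len)) τ∈))
      where R↭ = picks-↭ R pick

    length-arrangements : ∀ s (R : List A) → length R ≡ s → length (arrangements s R) ≡ s !
    length-arrangements s R len = trans (length≡# (arrangements s R)) (count s R len)
      where
      always? : ∀ {B : Set} → Decidable {A = B} (λ _ → ⊤)
      always? _ = yes tt
      length≡# : ∀ {B : Set} (xs : List B) → length xs ≡ # always? xs
      length≡# []       = refl
      length≡# (x ∷ xs) = cong suc (length≡# xs)
      const-sum : ∀ {B : Set} {f : B → ℕ} c xs → (∀ x → x ∈ xs → f x ≡ c) → sum (map f xs) ≡ length xs * c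
      const-sum c []       f≡c = refl
      const-sum c (x ∷ xs) f≡c = cong₂ _+_ (f≡c x (here refl)) (const-sum c xs (λ y y∈ → f≡c y (there y∈)))
      length-picks : ∀ (R : List A) → length (picks R) ≡ length R
      length-picks R = trans (length≡# (picks R)) (trans (sum-picks (λ _ → 1) R) (sym (length≡# R)))
      count : ∀ s (R : List A) → length R ≡ s → # always? (arrangements s R) ≡ s !
      count zero    R len = refl
      count (suc s) R len = begin
        # always? (arrangements (suc s) R)
          ≡⟨ #-concatMap always? _ (picks R) ⟩
        sum (map (λ (x , R′) → # always? (map (x ∷_) (arrangements s R′))) (picks R))
          ≡⟨ const-sum (s !) (picks R) (λ (x , R′) pick →
               trans (#-map always? (x ∷_) (arrangements s R′))
                 (count s R′ (suc-injective (trans (sym (↭-length (picks-↭ R pick))) len)))) ⟩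
        length (picks R) * s !
          ≡⟨ cong (_* s !) (trans (length-picks R) len) ⟩
        suc s * s ! ∎
        where open ≡-Reasoning

-- Orders that obey prescribed predecessors

module Walks where

  open import Data.Nat.Base
  open import Data.Nat.Properties
  open import Data.Bool.Base using (if_then_else_)
  open import Data.Maybe.Base using (Maybe; just; nothing; fromMaybe)
  open import Data.Maybe.Properties using (just-injective)
  open import Data.List.Base using (List; []; _∷_; _++_; map; length)
  open import Data.Nat.ListAction using (sum)
  open import Data.List.Properties using (map-cong)
  open import Data.List.Membership.Propositional using (_∈_; find)
  open import Data.List.Membership.Propositional.Properties using (∈-++⁺ˡ; ∈-++⁺ʳ)
  open import Data.List.Relation.Unary.Any as Any using (Any; here; there)
  open import Data.List.Relation.Unary.All as All using (All; []; _∷_)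
  import Data.List.Relation.Unary.All.Properties as All
  open import Data.List.Relation.Unary.AllPairs as AllPairs using (AllPairs; []; _∷_)
  open import Data.List.Relation.Unary.Unique.Propositional using (Unique)
  open import Data.List.Relation.Binary.Permutation.Propositional using (_↭_; ↭-sym)
  open import Data.List.Relation.Binary.Permutation.Propositional.Properties using (∈-resp-↭; ↭-length; ++⁺ˡ; shift)
  open import Data.Vec.Base using (Vec; []; _∷_; toList)
  open import Data.Product.Base using (∃; _×_; _,_; proj₁; swap)
  open import Data.Sum.Base using (_⊎_; inj₁; inj₂; [_,_]′)
  open import Data.Empty using (⊥; ⊥-elim)
  open import Function.Base using (_∘_)
  open import Relation.Nullary using (Dec; yes; no; ¬_; does)
  open import Relation.Nullary.Decidable using (_×-dec_; _⊎-dec_)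
  open import Relation.Unary using (Pred; Decidable)
  open import Relation.Binary.Definitions using (DecidableEquality)
  open import Relation.Binary.PropositionalEquality
  open import Level using (0ℓ)
  open Counting

  module Arcs {V : Set} (_≟_ : DecidableEquality V) where

    open import Data.List.Membership.DecPropositional _≟_ using (_∈?_)
    open import Data.Product.Properties using (≡-dec)

    _≟₂_ : DecidableEquality (V × V)
    _≟₂_ = ≡-dec _≟_ _≟_

    open import Data.List.Membership.DecPropositional _≟₂_ using () renaming (_∈?_ to _∈₂?_)

    -- A slot  just v  says that its vertex follows the root v, a slot  nothing
    -- that it follows the vertex in the previous slot.
    Slots : ℕ → Set
    Slots s = Vec (Maybe V) s

    -- `u` is the vertex preceding the first slot; a slot `just v` overrides it.
    arcs : ∀ {s} → V → Slots s → Vec V s → List (V × V)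
    arcs u []       []       = []
    arcs u (l ∷ ls) (x ∷ xs) = (fromMaybe u l , x) ∷ arcs x ls xs

    roots : ∀ {s} → Slots s → List V
    roots []             = []
    roots (just v ∷ ls)  = v ∷ roots ls
    roots (nothing ∷ ls) = roots ls

    length-arcs : ∀ {s} u (ls : Slots s) xs → length (arcs u ls xs) ≡ s
    length-arcs u []       []       = refl
    length-arcs u (l ∷ ls) (x ∷ xs) = cong suc (length-arcs x ls xs)

    head∈ : ∀ {s} {u} (ls : Slots s) {xs a b} → (a , b) ∈ arcs u ls xs → b ∈ toList xs
    head∈ [] {[]} ()
    head∈ (l ∷ ls) {x ∷ xs} (here refl) = here refl
    head∈ (l ∷ ls) {x ∷ xs} (there p)   = there (head∈ ls p)

    tail∈ : ∀ {s} {u} (ls : Slots s) {xs a b} → (a , b) ∈ arcs u ls xs → a ≡ u ⊎ a ∈ roots ls ⊎ a ∈ toList xs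
    tail∈ [] {[]} ()
    tail∈ (just v  ∷ ls) {x ∷ xs} (here refl) = inj₂ (inj₁ (here refl))
    tail∈ (nothing ∷ ls) {x ∷ xs} (here refl) = inj₁ refl
    tail∈ (l ∷ ls)       {x ∷ xs} (there p) with tail∈ ls p
    ... | inj₁ refl        = inj₂ (inj₂ (here refl))
    ... | inj₂ (inj₂ a∈)   = inj₂ (inj₂ (there a∈))
    ... | inj₂ (inj₁ a∈) with l
    ...   | just v  = inj₂ (inj₁ (there a∈))
    ...   | nothing = inj₂ (inj₁ a∈)

    tail-unique : ∀ {s} {u} (ls : Slots s) {xs a a′ b} → Unique (toList xs) →
                  (a , b) ∈ arcs u ls xs → (a′ , b) ∈ arcs u ls xs → a ≡ a′
    tail-unique [] {[]} _ ()
    tail-unique (l ∷ ls) {x ∷ xs} (x∉ ∷ uniq) (here refl) (here refl) = refl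
    tail-unique (l ∷ ls) {x ∷ xs} (x∉ ∷ uniq) (here refl) (there q)   = ⊥-elim (All.lookup x∉ (head∈ ls q) refl)
    tail-unique (l ∷ ls) {x ∷ xs} (x∉ ∷ uniq) (there p)   (here refl) = ⊥-elim (All.lookup x∉ (head∈ ls p) refl)
    tail-unique (l ∷ ls) {x ∷ xs} (x∉ ∷ uniq) (there p)   (there q)   = tail-unique ls uniq p q

    ∈-arcs : ∀ {s} {u} (ls : Slots s) {xs b} → b ∈ toList xs → ∃ λ a → (a , b) ∈ arcs u ls xs
    ∈-arcs (l ∷ ls) {x ∷ xs} (here refl) = _ , here refl
    ∈-arcs (l ∷ ls) {x ∷ xs} (there b∈) with ∈-arcs ls b∈
    ... | a , p = a , there p

    -- h b = just a  prescribes that b be preceded by a.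
    Allowed : (V → Maybe V) → Pred (V × V) 0ℓ
    Allowed h (a , b) = ∀ w → h b ≡ just w → w ≡ a

    allowed? : ∀ h → Decidable (Allowed h)
    allowed? h (a , b) with h b
    ... | nothing = yes λ _ ()
    ... | just w with w ≟ a
    ...   | yes w≡a = yes λ { _ refl → w≡a }
    ...   | no  w≢a = no λ f → w≢a (f w refl)

    Obeys : ∀ {s} → (V → Maybe V) → V → Slots s → Pred (Vec V s) 0ℓ
    Obeys h u ls σ = All (Allowed h) (arcs u ls σ)

    obeys? : ∀ {s} h u (ls : Slots s) → Decidable (Obeys h u ls)
    obeys? h u ls σ = All.all? (allowed? h) (arcs u ls σ)

    Free : (V → Maybe V) → Pred V 0ℓ
    Free h x = h x ≡ nothing

    free? : ∀ h → Decidable (Free h)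
    free? h x with h x
    ... | nothing = yes refl
    ... | just _  = no λ ()

    -- Ensures that the tail of the next arc never is the tail of a later one: later tails are roots
    -- still to come or vertices of `R`. With no slot left there is no next arc, and `u` does not
    -- occur.
    Fresh : ∀ {s} → V → Slots s → List V → Set
    Fresh u []       R = Unique R
    Fresh u (l ∷ ls) R = Unique (fromMaybe u l ∷ roots ls ++ R)

    fresh-next : ∀ {s} x (ls : Slots s) {R} → Unique (roots ls ++ x ∷ R) → Fresh x ls R
    fresh-next x []            (_ ∷ uniq) = uniq
    fresh-next x (just v ∷ ls) {R} uniq = AllPairs.tail (Unique-resp-↭ (shift x (v ∷ roots ls) R) uniq)
    fresh-next x (nothing ∷ ls) {R} uniq = Unique-resp-↭ (shift x (roots ls) R) uniq

    unique-++ʳ : ∀ xs {ys : List V} → Unique (xs ++ ys) → Unique ys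
    unique-++ʳ []       uniq       = uniq
    unique-++ʳ (x ∷ xs) (_ ∷ uniq) = unique-++ʳ xs uniq

    fresh-unique : ∀ {s} u (ls : Slots s) {R} → Fresh u ls R → Unique R
    fresh-unique u []       uniq       = uniq
    fresh-unique u (l ∷ ls) (_ ∷ uniq) = unique-++ʳ (roots ls) uniq

    -- Condition on the vertex placed next, after the tail `t`. If some `b` in `R` is prescribed to
    -- follow `t`, it must be placed now, because `t` is never a tail again: there is one choice,
    -- and the number of free vertices stays the same. Otherwise only a free vertex can be placed,
    -- and each of the f free choices leaves f - 1 of them.
    #-obeys : ∀ s h u (ls : Slots s) R → length R ≡ s → Fresh u ls R →
              # (obeys? h u ls) (arrangements s R) ≤ (# (free? h) R) !
    #-obeys zero    h u []       []  len fresh = ≤-refl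
    #-obeys (suc s) h u (l ∷ ls) R len fresh@(t∉ ∷ uniq) = begin
      # (obeys? h u (l ∷ ls)) (arrangements (suc s) R)
        ≡⟨ #-concatMap (obeys? h u (l ∷ ls)) _ (picks R) ⟩
      sum (map (λ (x , R′) → # (obeys? h u (l ∷ ls)) (map (x ∷_) (arrangements s R′))) (picks R))
        ≡⟨ cong sum (map-cong (λ (x , R′) → #-map (obeys? h u (l ∷ ls)) (x ∷_) (arrangements s R′)) (picks R)) ⟩
      sum (map count (picks R))
        ≤⟨ cases (Any.any? (λ b → forced? b) R) ⟩
      (# (free? h) R) ! ∎
      where
      open ≤-Reasoning
      t = fromMaybe u l
      M = (# (free? h) R) !
      uniqR = unique-++ʳ (roots ls) uniq
      forced? : ∀ b → Dec (h b ≡ just t)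
      forced? b with h b
      ... | nothing = no λ ()
      ... | just w with w ≟ t
      ...   | yes refl = yes refl
      ...   | no  w≢t  = no λ eq → w≢t (just-injective eq)
      count : V × List V → ℕ
      count (x , R′) = # (λ σ → obeys? h u (l ∷ ls) (x ∷ σ)) (arrangements s R′)
      length-rest : ∀ {x R′} → (x , R′) ∈ picks R → length R′ ≡ s
      length-rest pick = suc-injective (trans (sym (↭-length (picks-↭ R pick))) len)
      count≤ : ∀ {x R′} → (x , R′) ∈ picks R → count (x , R′) ≤ (# (free? h) R′) !
      count≤ {x} {R′} pick = ≤-trans
        (#-mono (λ σ → obeys? h u (l ∷ ls) (x ∷ σ)) (obeys? h x ls) (arrangements s R′) (λ { _ _ (_ ∷ ok) → ok }))
        (#-obeys s h x ls R′ (length-rest pick)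
          (fresh-next x ls (Unique-resp-↭ (++⁺ˡ (roots ls) (picks-↭ R pick)) uniq)))
      free-R : ∀ {x R′} → (x , R′) ∈ picks R → # (free? h) R ≡ ⟦ free? h x ⟧ + # (free? h) R′
      free-R pick = #-↭ (free? h) (picks-↭ R pick)
      t∉roots : ∀ {w} → w ∈ roots ls → t ≢ w
      t∉roots w∈ = All.lookup t∉ (∈-++⁺ˡ w∈)
      t∉R : ∀ {w} → w ∈ R → t ≢ w
      t∉R w∈ = All.lookup t∉ (∈-++⁺ʳ (roots ls) w∈)
      -- If b must follow t and another vertex is put after t, the prescription
      -- for b can no longer be met.
      dead : ∀ {b} → b ∈ R → h b ≡ just t → ∀ {x R′} → (x , R′) ∈ picks R → x ≢ b → count (x , R′) ≡ 0
      dead {b} b∈ hb {x} {R′} pick x≢b = #-none (λ σ → obeys? h u (l ∷ ls) (x ∷ σ)) (arrangements s R′) λ σ σ∈ ok →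
        let R↭ = picks-↭ R pick
            R′↭ = arrangements-↭ s (length-rest pick) σ∈
            (a , p) = ∈-arcs {u = x} ls (∈-resp-↭ R′↭ (strip (∈-resp-↭ R↭ b∈)))
            t≡a = All.lookup (All.tail ok) p t hb
        in contra R↭ R′↭ t≡a (tail∈ ls p)
        where
        strip : b ∈ x ∷ R′ → b ∈ R′
        strip (here b≡x) = ⊥-elim (x≢b (sym b≡x))
        strip (there b∈) = b∈
        contra : ∀ {σ a} → R ↭ x ∷ R′ → R′ ↭ toList σ → t ≡ a → a ≡ x ⊎ a ∈ roots ls ⊎ a ∈ toList {n = s} σ → ⊥
        contra R↭ R′↭ refl (inj₁ t≡x)       = t∉R (∈-resp-↭ (↭-sym R↭) (here refl)) t≡x
        contra R↭ R′↭ refl (inj₂ (inj₁ t∈)) = t∉roots t∈ refl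
        contra R↭ R′↭ refl (inj₂ (inj₂ t∈)) =
          t∉R (∈-resp-↭ (↭-sym R↭) (there (∈-resp-↭ (↭-sym R′↭) t∈))) refl
      through : ∀ {P : Pred V 0ℓ} (P? : Decidable P) c →
                (∀ x R′ → (x , R′) ∈ picks R → count (x , R′) ≤ ⟦ P? x ⟧ * c) →
                sum (map count (picks R)) ≤ # P? R * c
      through P? c bound = begin
        sum (map count (picks R))
          ≤⟨ sum-mono (picks R) (λ (x , R′) → bound x R′) ⟩
        sum (map (λ (x , _) → ⟦ P? x ⟧ * c) (picks R))
          ≡⟨ sum-picks (λ x → ⟦ P? x ⟧ * c) R ⟩
        sum (map (λ x → ⟦ P? x ⟧ * c) R)
          ≡⟨ sum-*ʳ (λ x → ⟦ P? x ⟧) c R ⟩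
        # P? R * c ∎
      cases : Dec (Any (λ b → h b ≡ just t) R) → sum (map count (picks R)) ≤ M
      cases (yes any) with find any
      ... | b , b∈ , hb = begin
        sum (map count (picks R)) ≤⟨ through (_≟ b) M bound ⟩
        # (_≟ b) R * M            ≤⟨ *-monoˡ-≤ M (#-unique≤1 (_≟ b) uniqR (λ p q → trans p (sym q))) ⟩
        1 * M                     ≡⟨ *-identityˡ M ⟩
        M ∎
        where
        bound : ∀ x R′ → (x , R′) ∈ picks R → count (x , R′) ≤ ⟦ x ≟ b ⟧ * M
        bound x R′ pick with x ≟ b
        ... | no x≢b   = ≤-reflexive (dead b∈ hb pick x≢b)
        ... | yes refl = ≤-trans (count≤ pick) (≤-reflexive
                (trans (cong _! (sym (trans (free-R pick) (cong (_+ _) (not-free (free? h x)))))) (sym (+-identityʳ M))))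
          where
          not-free : (d : Dec (Free h x)) → ⟦ d ⟧ ≡ 0
          not-free (no _) = refl
          not-free (yes e) with trans (sym hb) e
          ... | ()
      cases (no none) = begin
        -- If no vertex is free, the product is 0 whatever value `pred` takes.
        sum (map count (picks R))                     ≤⟨ through (free? h) (pred (# (free? h) R) !) bound ⟩
        # (free? h) R * pred (# (free? h) R) !        ≤⟨ n*pred!≤n! (# (free? h) R) ⟩
        M ∎
        where
        n*pred!≤n! : ∀ n → n * pred n ! ≤ n !
        n*pred!≤n! zero    = z≤n
        n*pred!≤n! (suc n) = ≤-refl
        bound : ∀ x R′ → (x , R′) ∈ picks R → count (x , R′) ≤ ⟦ free? h x ⟧ * pred (# (free? h) R) !
        bound x R′ pick with free? h x | free-R pick
        ... | yes _ | eq = ≤-trans (count≤ pick) (≤-reflexive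
                (trans (cong _! (sym (cong pred eq))) (sym (+-identityʳ _))))
        ... | no ¬free | _ = ≤-reflexive (#-none (λ σ → obeys? h u (l ∷ ls) (x ∷ σ)) (arrangements s R′)
                λ { _ _ (ok ∷ _) → not-allowed ok })
          where
          not-allowed : ¬ Allowed h (t , x)
          not-allowed ok with h x in eq
          ... | nothing = ¬free refl
          ... | just w with ok w refl
          ...   | refl = none (Any.map (λ { refl → eq }) (∈-resp-↭ (↭-sym (picks-↭ R pick)) (here refl)))

  infix 8 _!∸_

  -- (m - n) ! , but 0 when n > m.
  _!∸_ : ℕ → ℕ → ℕ
  m     !∸ zero  = m !
  zero  !∸ suc n = 0
  suc m !∸ suc n = m !∸ n

  module Traversals {V : Set} (_≟_ : DecidableEquality V) where
    open Arcs _≟_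
    open import Data.List.Membership.DecPropositional _≟_ using (_∈?_)
    open import Data.List.Membership.DecPropositional _≟₂_ using () renaming (_∈?_ to _∈₂?_)

    Traversed : List (V × V) → Pred (V × V) 0ℓ
    Traversed as e = e ∈ as ⊎ swap e ∈ as

    traversed? : ∀ as → Decidable (Traversed as)
    traversed? as e = (e ∈₂? as) ⊎-dec (swap e ∈₂? as)

    Distinct : V × V → V × V → Set
    Distinct e e′ = e ≢ e′ × e ≢ swap e′

    -- An edge with a direction already prescribed would use up no further free vertex, and the
    -- factorial would not drop.
    Unprescribed : (V → Maybe V) → Pred (V × V) 0ℓ
    Unprescribed h (a , b) = h b ≢ just a × h a ≢ just b

    prescribe : V → V → (V → Maybe V) → V → Maybe V
    prescribe a b h x = if does (x ≟ b) then just a else h x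

    prescribe-inv : ∀ a b h x {w} → prescribe a b h x ≡ just w → (x ≡ b × w ≡ a) ⊎ h x ≡ just w
    prescribe-inv a b h x eq with x ≟ b
    prescribe-inv a b h x refl | yes x≡b = inj₁ (x≡b , refl)
    prescribe-inv a b h x eq   | no  _   = inj₂ eq

    free-prescribe-≢ : ∀ a b h {y} → y ≢ b → ⟦ free? h y ⟧ ≡ ⟦ free? (prescribe a b h) y ⟧
    free-prescribe-≢ a b h {y} y≢b with y ≟ b
    ... | yes y≡b = ⊥-elim (y≢b y≡b)
    ... | no _ with h y
    ...   | nothing = refl
    ...   | just _  = refl

    #-free-prescribe : ∀ a b h {R} → h b ≡ nothing → b ∈ R → Unique R →
                       # (free? h) R ≡ suc (# (free? (prescribe a b h)) R)
    #-free-prescribe a b h {x ∷ R} hb (here refl) (b∉ ∷ _) = cong₂ _+_ free-before (begin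
        # (free? h) R                              ≡⟨ same R b∉ ⟩
        # (free? (prescribe a b h)) R              ≡⟨ cong (_+ # (free? (prescribe a b h)) R) (sym free-after) ⟩
        ⟦ free? (prescribe a b h) b ⟧ + # (free? (prescribe a b h)) R ∎)
      where
      open ≡-Reasoning
      free-before : ⟦ free? h b ⟧ ≡ 1
      free-before with h b
      free-before | nothing = refl
      free-after : ⟦ free? (prescribe a b h) b ⟧ ≡ 0
      free-after with b ≟ b
      ... | yes _  = refl
      ... | no b≢b = ⊥-elim (b≢b refl)
      same : ∀ R → All (b ≢_) R → # (free? h) R ≡ # (free? (prescribe a b h)) R
      same []      []         = refl
      same (y ∷ R) (b≢y ∷ b∉) = cong₂ _+_ (free-prescribe-≢ a b h (b≢y ∘ sym)) (same R b∉)
    #-free-prescribe a b h {x ∷ R} hb (there b∈) (x∉ ∷ uniq) =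
      trans (cong₂ _+_ (free-prescribe-≢ a b h (All.lookup x∉ b∈)) (#-free-prescribe a b h hb b∈ uniq))
            (+-suc ⟦ free? (prescribe a b h) x ⟧ _)

    module _ {s : ℕ} (u : V) (ls : Slots s) (R : List V) (len : length R ≡ s) (fresh : Fresh u ls R) where

      Ω : List (Vec V s)
      Ω = arrangements s R

      Realises : (V → Maybe V) → List (V × V) → Pred (Vec V s) 0ℓ
      Realises h es σ = Obeys h u ls σ × All (Traversed (arcs u ls σ)) es

      realises? : ∀ h es → Decidable (Realises h es)
      realises? h es σ = obeys? h u ls σ ×-dec All.all? (traversed? (arcs u ls σ)) es

      -- Each edge is traversed in one of two directions, and the direction
      -- prescribes the predecessor of one more vertex.
      #-realises : ∀ h es → All (Unprescribed h) es → AllPairs Distinct es →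
                   # (realises? h es) Ω ≤ 2 ^ length es * (# (free? h) R) !∸ length es
      #-realises h [] _ _ = begin
        # (realises? h []) Ω    ≤⟨ #-mono (realises? h []) (obeys? h u ls) Ω (λ _ _ → proj₁) ⟩
        # (obeys? h u ls) Ω     ≤⟨ #-obeys s h u ls R len fresh ⟩
        (# (free? h) R) !       ≡⟨ sym (+-identityʳ _) ⟩
        1 * (# (free? h) R) ! ∎
        where open ≤-Reasoning
      #-realises h ((a , b) ∷ es) ((hb≢a , ha≢b) ∷ unpres) (dist ∷ dists) = begin
        # (realises? h ((a , b) ∷ es)) Ω
          ≤⟨ #-⊎ (realises? h ((a , b) ∷ es)) (forward? a b) (forward? b a) Ω
               (λ { σ _ (ok , inj₁ p ∷ ps) → inj₁ (p , ok , ps)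
                  ; σ _ (ok , inj₂ p ∷ ps) → inj₂ (p , ok , ps) }) ⟩
        # (forward? a b) Ω + # (forward? b a) Ω
          ≤⟨ +-mono-≤ (oriented a b hb≢a dist)
                      (oriented b a ha≢b (All.map (λ (d , d′) → (λ e → d′ (cong swap e)) , (λ e → d (cong swap e))) dist)) ⟩
        B + B
          ≡⟨ cong (B +_) (sym (+-identityʳ B)) ⟩
        2 * B
          ≡⟨ sym (*-assoc 2 (2 ^ length es) _) ⟩
        2 ^ suc (length es) * (# (free? h) R) !∸ suc (length es) ∎
        where
        open ≤-Reasoning
        B = 2 ^ length es * (# (free? h) R) !∸ suc (length es)
        Forward : V → V → Pred (Vec V s) 0ℓ
        Forward a b σ = (a , b) ∈ arcs u ls σ × Realises h es σ
        forward? : ∀ a b → Decidable (Forward a b)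
        forward? a b σ = ((a , b) ∈₂? arcs u ls σ) ×-dec realises? h es σ
        uniq : ∀ {σ} → σ ∈ Ω → Unique (toList σ)
        uniq σ∈ = Unique-resp-↭ (arrangements-↭ s len σ∈) (fresh-unique u ls fresh)
        oriented : ∀ a b → h b ≢ just a → All (Distinct (a , b)) es → # (forward? a b) Ω ≤ B
        -- No order counts if `b` already has a prescribed predecessor, which differs from `a`, or
        -- if `b` is not in `R` and so heads no arc. Otherwise prescribing `a` for `b` makes one
        -- free vertex of `R` unfree.
        oriented a b hb≢a dist with h b in hb
        ... | just w = ≤-trans (≤-reflexive (#-none (forward? a b) Ω
                (λ { σ _ (p , ok , _) → hb≢a (cong just (All.lookup ok p w hb)) }))) z≤n
        ... | nothing with b ∈? R
        ...   | no b∉R = ≤-trans (≤-reflexive (#-none (forward? a b) Ω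
                  (λ { σ σ∈ (p , _) → b∉R (∈-resp-↭ (↭-sym (arrangements-↭ s len σ∈)) (head∈ ls p)) }))) z≤n
        ...   | yes b∈R = begin
          # (forward? a b) Ω
            ≤⟨ #-mono (forward? a b) (realises? h′ es) Ω
                 (λ { σ σ∈ (p , ok , ps) → obeys′ (uniq σ∈) p ok , ps }) ⟩
          # (realises? h′ es) Ω
            ≤⟨ #-realises h′ es (All.zipWith unpres′ (dist , unpres)) dists ⟩
          2 ^ length es * (# (free? h′) R) !∸ length es
            ≡⟨ cong (λ f → 2 ^ length es * f !∸ suc (length es))
                 (sym (#-free-prescribe a b h hb b∈R (fresh-unique u ls fresh))) ⟩
          B ∎
          where
          h′ = prescribe a b h
          obeys′ : ∀ {σ} → Unique (toList σ) → (a , b) ∈ arcs u ls σ → Obeys h u ls σ → Obeys h′ u ls σ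
          obeys′ {σ} uniq p ok = All.tabulate allowed
            where
            allowed : ∀ {e} → e ∈ arcs u ls σ → Allowed h′ e
            allowed {c , d} q w eq with prescribe-inv a b h d eq
            ... | inj₁ (refl , refl) = tail-unique ls uniq p q
            ... | inj₂ hd            = All.lookup ok q w hd
          unpres′ : ∀ {e} → Distinct (a , b) e × Unprescribed h e → Unprescribed h′ e
          unpres′ {c , d} ((≢e , ≢swap) , (hd≢c , hc≢d)) =
            (λ eq → [ (λ { (refl , refl) → ≢e refl }) , hd≢c ]′ (prescribe-inv a b h d eq)) ,
            (λ eq → [ (λ { (refl , refl) → ≢swap refl }) , hc≢d ]′ (prescribe-inv a b h c eq))

-- Powers against falling factorials

module Factorials where

  open import Data.Nat.Base
  open import Data.Nat.Properties
  open import Data.Nat.Solver using (module +-*-Solver)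
  open import Data.Product.Base using (∃; _,_)
  open import Data.Sum.Base using (_⊎_; inj₁; inj₂)
  open import Relation.Nullary using (yes; no)
  open import Relation.Binary.PropositionalEquality
  open Walks

  !∸-zero : ∀ m n → m < n → m !∸ n ≡ 0
  !∸-zero zero    (suc n) _         = refl
  !∸-zero (suc m) (suc n) (s≤s m<n) = !∸-zero m n m<n

  -- (1 + 1/m)ʲ ≤ 1 / (1 - j/m).
  [1+m]^j*[m∸j]≤m^[1+j] : ∀ m j → suc m ^ j * (m ∸ j) ≤ m ^ suc j
  [1+m]^j*[m∸j]≤m^[1+j] m zero = ≤-reflexive (trans (+-identityʳ m) (sym (*-identityʳ m)))
  [1+m]^j*[m∸j]≤m^[1+j] m (suc j) = begin
    suc m * suc m ^ j * (m ∸ suc j)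
      ≡⟨ solve 3 (λ a b c → a :* b :* c := b :* (a :* c)) refl (suc m) (suc m ^ j) (m ∸ suc j) ⟩
    suc m ^ j * (suc m * (m ∸ suc j))
      ≤⟨ *-monoʳ-≤ (suc m ^ j) (shrink m j) ⟩
    suc m ^ j * (m * (m ∸ j))
      ≡⟨ solve 3 (λ a b c → b :* (a :* c) := a :* (b :* c)) refl m (suc m ^ j) (m ∸ j) ⟩
    m * (suc m ^ j * (m ∸ j))
      ≤⟨ *-monoʳ-≤ m ([1+m]^j*[m∸j]≤m^[1+j] m j) ⟩
    m * m ^ suc j ∎
    where
    open ≤-Reasoning
    open +-*-Solver
    shrink : ∀ m j → suc m * (m ∸ suc j) ≤ m * (m ∸ j)
    shrink m j with suc j ≤? m
    ... | no  j≮m = ≤-trans (≤-reflexive (trans (cong (suc m *_) (m≤n⇒m∸n≡0 (≰⇒≥ j≮m))) (*-zeroʳ (suc m)))) z≤n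
    ... | yes j<m = begin
      m ∸ suc j + m * (m ∸ suc j) ≤⟨ +-monoˡ-≤ (m * (m ∸ suc j)) (m∸n≤m m (suc j)) ⟩
      m + m * (m ∸ suc j)         ≡⟨ sym (*-suc m (m ∸ suc j)) ⟩
      m * suc (m ∸ suc j)         ≡⟨ cong (m *_) (sym (+-∸-assoc 1 j<m)) ⟩
      m * (m ∸ j) ∎

  -- For j ≤ m/2 the factor 1 / (1 - j/m) is at most 2.
  [1+m]^j≤2*m^j : ∀ m j → j + j ≤ m → suc m ^ j ≤ 2 * m ^ j
  [1+m]^j≤2*m^j zero    zero    _ = s≤s z≤n
  [1+m]^j≤2*m^j (suc m) j 2j≤m = *-cancelʳ-≤ (suc M ^ j) (2 * M ^ j) M (begin
    suc M ^ j * M                ≤⟨ *-monoʳ-≤ (suc M ^ j) M≤2[M∸j] ⟩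
    suc M ^ j * (2 * (M ∸ j))    ≡⟨ solve 2 (λ a b → a :* (con 2 :* b) := con 2 :* (a :* b)) refl (suc M ^ j) (M ∸ j) ⟩
    2 * (suc M ^ j * (M ∸ j))    ≤⟨ *-monoʳ-≤ 2 ([1+m]^j*[m∸j]≤m^[1+j] M j) ⟩
    2 * (M * M ^ j)              ≡⟨ solve 2 (λ a b → con 2 :* (a :* b) := con 2 :* b :* a) refl M (M ^ j) ⟩
    2 * M ^ j * M ∎)
    where
    open ≤-Reasoning
    open +-*-Solver
    M = suc m
    M≤2[M∸j] : M ≤ 2 * (M ∸ j)
    M≤2[M∸j] = begin
      M                       ≡⟨ sym (m∸n+n≡m (m+n≤o⇒m≤o j 2j≤m)) ⟩
      M ∸ j + j               ≤⟨ +-monoʳ-≤ (M ∸ j) (m+n≤o⇒m≤o∸n j 2j≤m) ⟩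
      M ∸ j + (M ∸ j)         ≡⟨ cong (M ∸ j +_) (sym (+-identityʳ (M ∸ j))) ⟩
      2 * (M ∸ j) ∎

  halve : ∀ t → ∃ λ j → t ≡ j + j ⊎ t ≡ suc (j + j)
  halve zero = 0 , inj₁ refl
  halve (suc t) with halve t
  ... | j , inj₁ eq = j , inj₂ (cong suc eq)
  ... | j , inj₂ eq = suc j , inj₁ (cong suc (trans eq (sym (+-suc j j))))

  -- An elementary substitute for the constant e: `t` splits into two halves of at most m/2, each
  -- costing a factor 2, and an odd `t` leaves one more factor (1 + 1/m) ≤ 2.
  [1+m]^t≤8*m^t : ∀ m t → t ≤ m → suc m ^ t ≤ 8 * m ^ t
  [1+m]^t≤8*m^t m t t≤m with halve t
  ... | j , inj₁ refl = begin
    suc m ^ (j + j)             ≡⟨ ^-distribˡ-+-* (suc m) j j ⟩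
    suc m ^ j * suc m ^ j       ≤⟨ *-mono-≤ ([1+m]^j≤2*m^j m j t≤m) ([1+m]^j≤2*m^j m j t≤m) ⟩
    2 * m ^ j * (2 * m ^ j)     ≡⟨ solve 1 (λ a → con 2 :* a :* (con 2 :* a) := con 4 :* (a :* a)) refl (m ^ j) ⟩
    4 * (m ^ j * m ^ j)         ≡⟨ cong (4 *_) (sym (^-distribˡ-+-* m j j)) ⟩
    4 * m ^ (j + j)             ≤⟨ *-monoˡ-≤ (m ^ (j + j)) (m≤m+n 4 4) ⟩
    8 * m ^ (j + j) ∎
    where
    open ≤-Reasoning
    open +-*-Solver
  ... | j , inj₂ refl = begin
    suc m * suc m ^ (j + j)           ≡⟨ cong (suc m *_) (^-distribˡ-+-* (suc m) j j) ⟩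
    suc m * (suc m ^ j * suc m ^ j)   ≤⟨ *-mono-≤ 1+m≤2m (*-mono-≤ ([1+m]^j≤2*m^j m j 2j≤m) ([1+m]^j≤2*m^j m j 2j≤m)) ⟩
    2 * m * (2 * m ^ j * (2 * m ^ j)) ≡⟨ solve 2 (λ m a → con 2 :* m :* (con 2 :* a :* (con 2 :* a)) := con 8 :* (m :* (a :* a))) refl m (m ^ j) ⟩
    8 * (m * (m ^ j * m ^ j))         ≡⟨ cong (λ x → 8 * (m * x)) (sym (^-distribˡ-+-* m j j)) ⟩
    8 * m ^ suc (j + j) ∎
    where
    open ≤-Reasoning
    open +-*-Solver
    2j≤m = ≤-trans (n≤1+n (j + j)) t≤m
    1+m≤2m : suc m ≤ 2 * m
    1+m≤2m = ≤-trans (+-monoˡ-≤ m (≤-trans (s≤s z≤n) t≤m)) (≤-reflexive (cong (m +_) (sym (+-identityʳ m))))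

  -- One factor 8 is paid each time the base of the power drops from `suc m` to `m`.
  s^t*[s!∸t]≤8^t*s! : ∀ s t → s ^ t * s !∸ t ≤ 8 ^ t * s !
  s^t*[s!∸t]≤8^t*s! s zero = ≤-refl
  s^t*[s!∸t]≤8^t*s! zero (suc t) = z≤n
  s^t*[s!∸t]≤8^t*s! (suc m) (suc t) with t ≤? m
  ... | no  t≰m = ≤-trans (≤-reflexive (trans (cong (suc m ^ suc t *_) (!∸-zero m t (≰⇒> t≰m))) (*-zeroʳ (suc m ^ suc t)))) z≤n
  ... | yes t≤m = begin
    suc m * suc m ^ t * m !∸ t      ≤⟨ *-monoˡ-≤ (m !∸ t) (*-monoʳ-≤ (suc m) ([1+m]^t≤8*m^t m t t≤m)) ⟩
    suc m * (8 * m ^ t) * m !∸ t    ≡⟨ solve 3 (λ a b c → a :* (con 8 :* b) :* c := con 8 :* a :* (b :* c)) refl (suc m) (m ^ t) (m !∸ t) ⟩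
    8 * suc m * (m ^ t * m !∸ t)    ≤⟨ *-monoʳ-≤ (8 * suc m) (s^t*[s!∸t]≤8^t*s! m t) ⟩
    8 * suc m * (8 ^ t * m !)       ≡⟨ solve 3 (λ a b c → con 8 :* a :* (b :* c) := con 8 :* b :* (a :* c)) refl (suc m) (8 ^ t) (m !) ⟩
    8 * 8 ^ t * (suc m * m !) ∎
    where
    open ≤-Reasoning
    open +-*-Solver

  [m*n]^k : ∀ m n k → (m * n) ^ k ≡ m ^ k * n ^ k
  [m*n]^k m n zero    = refl
  [m*n]^k m n (suc k) = trans (cong (m * n *_) ([m*n]^k m n k))
    (solve 4 (λ a b c d → a :* b :* (c :* d) := a :* c :* (b :* d)) refl m n (m ^ k) (n ^ k))
    where open +-*-Solver

  -- 32 = 2 · 2 · 8: the two directions of an edge, the loss from `n` to `s`, and the comparison of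
  -- powers with factorials. If `s` is 0, no order contains a nonempty set and the left side
  -- vanishes for positive `t`.
  spread-factorial : ∀ n s t → (n ≤ 2 * s ⊎ s ≡ 0) → 2 ^ t * s !∸ t * n ^ t ≤ 32 ^ t * s !
  spread-factorial n s       zero    _           = ≤-reflexive (*-identityʳ _)
  spread-factorial n .0      (suc t) (inj₂ refl) = ≤-trans (≤-reflexive (cong (_* n ^ suc t) (*-zeroʳ (2 ^ suc t)))) z≤n
  spread-factorial n s       t@(suc _) (inj₁ n≤2s) = begin
    2 ^ t * s !∸ t * n ^ t            ≤⟨ *-monoʳ-≤ (2 ^ t * s !∸ t) (^-monoˡ-≤ t n≤2s) ⟩
    2 ^ t * s !∸ t * (2 * s) ^ t      ≡⟨ cong (2 ^ t * s !∸ t *_) ([m*n]^k 2 s t) ⟩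
    2 ^ t * s !∸ t * (2 ^ t * s ^ t)  ≡⟨ solve 3 (λ a b c → a :* b :* (a :* c) := a :* a :* (c :* b)) refl (2 ^ t) (s !∸ t) (s ^ t) ⟩
    2 ^ t * 2 ^ t * (s ^ t * s !∸ t)  ≤⟨ *-monoʳ-≤ (2 ^ t * 2 ^ t) (s^t*[s!∸t]≤8^t*s! s t) ⟩
    2 ^ t * 2 ^ t * (8 ^ t * s !)     ≡⟨ cong (_* (8 ^ t * s !)) (sym ([m*n]^k 2 2 t)) ⟩
    4 ^ t * (8 ^ t * s !)             ≡⟨ trans (sym (*-assoc (4 ^ t) (8 ^ t) (s !))) (cong (_* s !) (sym ([m*n]^k 4 8 t))) ⟩
    32 ^ t * s ! ∎
    where
    open ≤-Reasoning
    open +-*-Solver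

-- Spread families have no cheap cover

module Spreads where

  open import Data.Nat.Base as ℕ using (ℕ; zero; suc)
  import Data.Nat.Properties as ℕ
  import Data.Integer.Base as ℤ
  import Data.Integer.Properties as ℤ
  open import Data.Rational.Base using (ℚ; 0ℚ; 1ℚ; _+_; _*_; _≤_; _<_; _/_; positive; toℚᵘ)
  open import Data.Rational.Properties
  import Data.Rational.Unnormalised.Base as ℚᵘ
  import Data.Rational.Unnormalised.Properties as ℚᵘ
  open import Data.Rational.Solver using (module +-*-Solver)
  open import Algebra.Definitions.RawSemiring +-*-rawSemiring using (_^_)
  open import Data.Fin.Base using (zero; suc)
  open import Data.Fin.Subset as Sub using (Subset; inside; outside; _⊆_; ∣_∣)
  import Data.Fin.Subset.Properties as Sub
  open import Data.Vec.Base using ([]; _∷_; here; there)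
  open import Data.List.Base using (List; []; _∷_; length)
  open import Data.List.Membership.Propositional using (_∈_)
  open import Data.List.Relation.Unary.Any using (here; there)
  open import Data.Product.Base using (∃; _×_; _,_)
  open import Function.Base using (_∘_)
  open import Relation.Nullary using (Dec; yes; no)
  open import Relation.Unary using (Pred; Decidable)
  open import Relation.Binary.PropositionalEquality
  open import Level using (0ℓ)
  open SubsetSums
  open Survival
  open Counting

  -- Unlike  + n / 1,  this form of the embedding reduces under suc.
  ι : ℕ → ℚ
  ι zero    = 0ℚ
  ι (suc n) = 1ℚ + ι n

  0≤ι : ∀ n → 0ℚ ≤ ι n
  0≤ι zero    = ≤-refl
  0≤ι (suc n) = +-nonNeg 0≤1 (0≤ι n)

  0<ι : ∀ n → 0ℚ < ι (suc n)
  0<ι n = +-mono-<-≤ (positive⁻¹ 1ℚ) (0≤ι n)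

  ι-mono : ∀ {m n} → m ℕ.≤ n → ι m ≤ ι n
  ι-mono {n = n} ℕ.z≤n = 0≤ι n
  ι-mono (ℕ.s≤s m≤n)   = +-monoʳ-≤ 1ℚ (ι-mono m≤n)

  ι-+ : ∀ m n → ι (m ℕ.+ n) ≡ ι m + ι n
  ι-+ zero    n = sym (+-identityˡ (ι n))
  ι-+ (suc m) n = trans (cong (1ℚ +_) (ι-+ m n)) (sym (+-assoc 1ℚ (ι m) (ι n)))

  ι-* : ∀ m n → ι (m ℕ.* n) ≡ ι m * ι n
  ι-* zero    n = sym (*-zeroˡ (ι n))
  ι-* (suc m) n = trans (ι-+ n (m ℕ.* n)) (trans (cong (ι n +_) (ι-* m n)) (factor (ι m) (ι n)))
    where
    open +-*-Solver
    factor : ∀ x y → y + x * y ≡ (1ℚ + x) * y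
    factor = solve 2 (λ x y → y :+ x :* y := (con 1ℚ :+ x) :* y) refl

  ι-^ : ∀ m n → ι (m ℕ.^ n) ≡ ι m ^ n
  ι-^ m zero    = +-identityʳ 1ℚ
  ι-^ m (suc n) = trans (ι-* m (m ℕ.^ n)) (cong (ι m *_) (ι-^ m n))

  toℚᵘ-ι : ∀ n → toℚᵘ (ι n) ℚᵘ.≃ ℚᵘ.mkℚᵘ (ℤ.+ n) 0
  toℚᵘ-ι zero    = ℚᵘ.≃-refl
  toℚᵘ-ι (suc n) = ℚᵘ.≃-trans (toℚᵘ-homo-+ 1ℚ (ι n)) (ℚᵘ.≃-trans
    (ℚᵘ.+-cong (ℚᵘ.≃-refl {ℚᵘ.mkℚᵘ (ℤ.+ 1) 0}) (toℚᵘ-ι n))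
    (ℚᵘ.*≡* (cong (λ z → (ℤ.+ 1 ℤ.+ z) ℤ.* ℤ.+ 1) (ℤ.*-identityʳ (ℤ.+ n)))))

  ι*1/n≡1 : ∀ n → ι (suc n) * (ℤ.+ 1 / suc n) ≡ 1ℚ
  ι*1/n≡1 n = toℚᵘ-injective (ℚᵘ.≃-trans (toℚᵘ-homo-* (ι (suc n)) (ℤ.+ 1 / suc n)) (ℚᵘ.≃-trans
    (ℚᵘ.*-cong (toℚᵘ-ι (suc n)) (toℚᵘ-fromℚᵘ (ℚᵘ.mkℚᵘ (ℤ.+ 1) n)))
    (ℚᵘ.*≡* (trans (ℤ.*-identityʳ _) (trans (ℤ.*-identityʳ (ℤ.+ suc n))
       (trans (cong (λ z → ℤ.+ suc z) (sym (ℕ.+-identityʳ n))) (sym (ℤ.*-identityˡ _))))))))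

  *-^ : ∀ a b n → (a * b) ^ n ≡ a ^ n * b ^ n
  *-^ a b zero    = refl
  *-^ a b (suc n) = trans (cong (a * b *_) (*-^ a b n)) (regroup a b (a ^ n) (b ^ n))
    where
    open +-*-Solver
    regroup : ∀ a b c d → a * b * (c * d) ≡ a * c * (b * d)
    regroup = solve 4 (λ a b c d → a :* b :* (c :* d) := a :* c :* (b :* d)) refl

  1^ : ∀ n → 1ℚ ^ n ≡ 1ℚ
  1^ zero    = refl
  1^ (suc n) = trans (*-identityˡ (1ℚ ^ n)) (1^ n)

  ι-⟦⟧ : ∀ {P : Set} (P? : Dec P) → ι ⟦ P? ⟧ ≡ indicator P?
  ι-⟦⟧ (yes _) = +-identityʳ 1ℚ
  ι-⟦⟧ (no  _) = refl

  Σ-weigh : ∀ {N} q (f : Subset N → ℚ) → Σ⟨ 1ℚ , 1ℚ ⟩ (λ T → q ^ ∣ T ∣ * f T) ≡ Σ⟨ q , 1ℚ ⟩ f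
  Σ-weigh {zero}  q f = *-identityˡ (f [])
  Σ-weigh {suc N} q f = cong₂ _+_
    (trans (*-identityˡ _) (trans (Σ-cong {N} 1ℚ 1ℚ (λ T → *-assoc q (q ^ ∣ T ∣) (f (inside ∷ T))))
      (trans (Σ-* {N} 1ℚ 1ℚ q (λ T → q ^ ∣ T ∣ * f (inside ∷ T))) (cong (q *_) (Σ-weigh q (f ∘ (inside ∷_)))))))
    (cong (1ℚ *_) (Σ-weigh q (f ∘ (outside ∷_))))

  Σ-single : ∀ {N} (f : Subset N → ℚ) → (∀ T → 0ℚ ≤ f T) → ∀ T → f T ≤ Σ⟨ 1ℚ , 1ℚ ⟩ f
  Σ-single {zero}  f 0≤f [] = ≤-refl
  Σ-single {suc N} f 0≤f (inside ∷ T) = ≤-trans (Σ-single (f ∘ (inside ∷_)) (0≤f ∘ (inside ∷_)) T)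
    (≤-trans (≤-reflexive (sym (*-identityˡ _)))
      (p≤p+q (*-nonNeg 0≤1 (Σ-nonNeg 0≤1 0≤1 {N} (0≤f ∘ (outside ∷_))))))
  Σ-single {suc N} f 0≤f (outside ∷ T) = ≤-trans (Σ-single (f ∘ (outside ∷_)) (0≤f ∘ (outside ∷_)) T)
    (≤-trans (≤-reflexive (sym (*-identityˡ _)))
      (p≤q+p (*-nonNeg 0≤1 (Σ-nonNeg 0≤1 0≤1 {N} (0≤f ∘ (inside ∷_))))))

  module Spread {N : ℕ} {X : Set} (S : X → Subset N) (Ω : List X) where

    contains? : ∀ T → Decidable (λ σ → T ⊆ S σ)
    contains? T σ = T Sub.⊆? S σ

    -- Double counting of the pairs of a `σ` in `Ω` and a `T` in `U` with `T ⊆ S σ`: each `σ` lies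
    -- in at least one pair, and each `T` in at most `ι (length Ω) * q ^ ∣ T ∣`.
    spread⇒cost≥1 : ∀ {q} → 0ℚ < ι (length Ω) →
      (∀ T → ι (# (contains? T) Ω) ≤ ι (length Ω) * q ^ ∣ T ∣) →
      ∀ {U : Pred (Subset N) 0ℓ} (U? : Decidable U) →
      (∀ σ → σ ∈ Ω → ∃ λ T → U T × T ⊆ S σ) → 1ℚ ≤ cost q U?
    spread⇒cost≥1 {q} 0<M spread {U} U? cov = *-cancelˡ-≤-pos (ι (length Ω)) {{positive 0<M}} (begin
      ι (length Ω) * 1ℚ
        ≡⟨ *-identityʳ _ ⟩
      ι (length Ω)
        ≤⟨ total Ω cov ⟩
      Σ⟨ 1ℚ , 1ℚ ⟩ (λ T → indicator (U? T) * ι (# (contains? T) Ω))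
        ≤⟨ Σ-mono 0≤1 0≤1 {N} (λ T → *-monoʳ-≤ (0≤indicator (U? T)) (spread T)) ⟩
      Σ⟨ 1ℚ , 1ℚ ⟩ (λ T → indicator (U? T) * (ι (length Ω) * q ^ ∣ T ∣))
        ≡⟨ Σ-cong {N} 1ℚ 1ℚ (λ T → regroup (indicator (U? T)) (ι (length Ω)) (q ^ ∣ T ∣)) ⟩
      Σ⟨ 1ℚ , 1ℚ ⟩ (λ T → ι (length Ω) * (q ^ ∣ T ∣ * indicator (U? T)))
        ≡⟨ Σ-* {N} 1ℚ 1ℚ (ι (length Ω)) _ ⟩
      ι (length Ω) * Σ⟨ 1ℚ , 1ℚ ⟩ (λ T → q ^ ∣ T ∣ * indicator (U? T))
        ≡⟨ cong (ι (length Ω) *_) (Σ-weigh q (λ T → indicator (U? T))) ⟩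
      ι (length Ω) * cost q U? ∎)
      where
      open ≤-Reasoning
      open +-*-Solver using (solve; _:*_; _:+_; _:=_)
      regroup : ∀ a b c → a * (b * c) ≡ b * (c * a)
      regroup = solve 3 (λ a b c → a :* (b :* c) := b :* (c :* a)) refl
      total : ∀ Ω → (∀ σ → σ ∈ Ω → ∃ λ T → U T × T ⊆ S σ) →
              ι (length Ω) ≤ Σ⟨ 1ℚ , 1ℚ ⟩ (λ T → indicator (U? T) * ι (# (contains? T) Ω))
      total []      cov = Σ-nonNeg 0≤1 0≤1 {N} (λ T → *-nonNeg (0≤indicator (U? T)) ≤-refl)
      total (σ ∷ Ω) cov = begin
        1ℚ + ι (length Ω)
          ≤⟨ +-mono-≤ (one (cov σ (here refl))) (total Ω (λ τ τ∈ → cov τ (there τ∈))) ⟩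
        Σ⟨ 1ℚ , 1ℚ ⟩ f + Σ⟨ 1ℚ , 1ℚ ⟩ (λ T → indicator (U? T) * ι (# (contains? T) Ω))
          ≡⟨ sym (Σ-+ {N} 1ℚ 1ℚ _ _) ⟩
        Σ⟨ 1ℚ , 1ℚ ⟩ (λ T → f T + indicator (U? T) * ι (# (contains? T) Ω))
          ≡⟨ Σ-cong {N} 1ℚ 1ℚ (λ T → trans (sym (*-distribˡ-+ (indicator (U? T)) _ _))
               (cong (indicator (U? T) *_) (trans (cong (_+ ι (# (contains? T) Ω)) (sym (ι-⟦⟧ (contains? T σ))))
                 (sym (ι-+ ⟦ contains? T σ ⟧ (# (contains? T) Ω)))))) ⟩
        Σ⟨ 1ℚ , 1ℚ ⟩ (λ T → indicator (U? T) * ι (# (contains? T) (σ ∷ Ω))) ∎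
        where
        f : Subset N → ℚ
        f T = indicator (U? T) * indicator (contains? T σ)
        one : (∃ λ T → U T × T ⊆ S σ) → 1ℚ ≤ Σ⟨ 1ℚ , 1ℚ ⟩ f
        one (T , u , T⊆) = ≤-trans
          (≤-reflexive (sym (cong₂ _*_ (indicator-yes (U? T) u) (indicator-yes (contains? T σ) T⊆))))
          (Σ-single f (λ T → *-nonNeg (0≤indicator (U? T)) (0≤indicator (contains? T σ))) T)

-- Rooted path systems as a spread family of edge sets

module CombFamilies where

  open import Defs using (potentialEdges; Graph; Adjacent; IsEndpoint; DisjointPathsFrom)
  import Data.Rational.Base as ℚ
  import Data.Rational.Properties as ℚ
  open import Data.Nat.Base
  open import Data.Nat.Properties
  open import Data.Bool.Base using (true)
  open import Data.Maybe.Base using (Maybe; just; nothing)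
  open import Data.List.Base using (List; []; _∷_; _++_; map; length; lookup; allFin; cartesianProduct)
  open import Data.List.Properties using (length-map; length-++; length-tabulate)
  open import Data.List.Membership.Propositional using (_∈_; find; lose)
  open import Data.List.Membership.Propositional.Properties as ∈ using (∈-++⁺ˡ; ∈-++⁺ʳ)
  open import Data.List.Relation.Unary.Any as Any using (Any; here; there)
  import Data.List.Relation.Unary.Any.Properties as Any
  open import Data.List.Relation.Unary.All as All using (All; []; _∷_)
  import Data.List.Relation.Unary.All.Properties as All
  open import Data.List.Relation.Unary.AllPairs as AllPairs using ([]; _∷_)
  open import Data.List.Relation.Unary.Unique.Propositional using (Unique)
  open import Data.List.Relation.Binary.Permutation.Propositional as ↭ using (_↭_; ↭-refl; ↭-sym; ↭-trans)
  open import Data.List.Relation.Binary.Permutation.Propositional.Properties using (∈-resp-↭; ↭-length; ++⁺ˡ; shift; shifts)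
  open import Data.Vec.Base as Vec using (Vec; []; _∷_; toList)
  open import Data.Product.Base using (∃; _×_; _,_; proj₁; proj₂)
  open import Data.Sum.Base using (_⊎_; inj₁; inj₂; [_,_]′)
  open import Data.Empty using (⊥; ⊥-elim)
  open import Function.Base using (_∘_; id)
  open import Relation.Nullary using (Dec; yes; ¬_; does)
  open import Relation.Nullary.Decidable using (_×-dec_; _⊎-dec_; dec-true)
  open import Relation.Unary using (Pred; Decidable)
  open import Relation.Binary.Definitions using (DecidableEquality; tri<; tri≈; tri>)
  open import Relation.Binary.PropositionalEquality
  open import Level using (0ℓ)
  open import Data.Fin.Base as Fin using (Fin; zero; suc)
  import Data.Fin.Properties as Fin
  open import Data.Fin.Subset as Sub using (Subset; inside; outside; _⊆_; _∪_; ∣_∣)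
  import Data.Fin.Subset.Properties as Sub
  import Data.List.Relation.Unary.AllPairs.Properties as AllPairs
  import Data.List.Relation.Unary.Unique.Propositional.Properties as Unique
  import Data.Vec.Properties as Vec
  import Data.Vec.Relation.Unary.All as AllV
  import Data.Vec.Relation.Unary.Any as AnyV
  import Data.Vec.Relation.Unary.AllPairs as AllPairsV
  import Data.Vec.Relation.Unary.Unique.Propositional as UniqueV
  import Data.Vec.Membership.Propositional as ∈V
  open import Data.Vec.Relation.Unary.Linked using (Linked; []; [-]; _∷_)
  open Survival
  open Counting
  open Walks
  open Factorials
  open Spreads

  disjoint-++ : ∀ {A : Set} (xs : List A) {ys} → Unique (xs ++ ys) → ∀ {x} → x ∈ xs → x ∈ ys → ⊥
  disjoint-++ (x ∷ xs) (x∉ ∷ uniq) (here refl) x∈ys = All.lookup x∉ (∈-++⁺ʳ xs x∈ys) refl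
  disjoint-++ (x ∷ xs) (x∉ ∷ uniq) (there x∈)  x∈ys = disjoint-++ xs uniq x∈ x∈ys

  unique-++ˡ : ∀ {A : Set} (xs : List A) {ys} → Unique (xs ++ ys) → Unique xs
  unique-++ˡ []       uniq        = []
  unique-++ˡ (x ∷ xs) (x∉ ∷ uniq) = All.++⁻ˡ xs x∉ ∷ unique-++ˡ xs uniq

  ∈-toList : ∀ {A : Set} {n} {xs : Vec A n} {x} → x ∈V.∈ xs → x ∈ toList xs
  ∈-toList (AnyV.here refl) = here refl
  ∈-toList (AnyV.there x∈)  = there (∈-toList x∈)

  unique-fromList : ∀ {A : Set} {n} (xs : Vec A n) → Unique (toList xs) → UniqueV.Unique xs
  unique-fromList []       []          = AllPairsV.[]
  unique-fromList (x ∷ xs) (x∉ ∷ uniq) = all xs x∉ AllPairsV.∷ unique-fromList xs uniq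
    where
    all : ∀ {n} (ys : Vec _ n) → All (x ≢_) (toList ys) → AllV.All (x ≢_) ys
    all []       []         = AllV.[]
    all (y ∷ ys) (x≢y ∷ x∉) = x≢y AllV.∷ all ys x∉

  complement : ∀ {A : Set} (vs : List A) {L} → Unique vs → (∀ {x} → x ∈ vs → x ∈ L) →
               ∃ λ R → L ↭ vs ++ R
  complement []       _ _ = _ , ↭-refl
  complement (v ∷ vs) {L} (v∉ ∷ uniq) vs⊆L with ∈.∈-∃++ (vs⊆L (here refl))
  ... | xs , ys , refl with complement vs {xs ++ ys} uniq vs⊆xs++ys
    where
    vs⊆xs++ys : ∀ {x} → x ∈ vs → x ∈ xs ++ ys
    vs⊆xs++ys x∈ with ∈-resp-↭ (shift v xs ys) (vs⊆L (there x∈))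
    ... | here refl = ⊥-elim (All.lookup v∉ x∈ refl)
    ... | there x∈′ = x∈′
  ... | R , L′↭ = R , ↭-trans (shift v xs ys) (↭.prep v L′↭)

  ∣p∪q∣≤∣p∣+∣q∣ : ∀ {n} (p q : Subset n) → ∣ p ∪ q ∣ ≤ ∣ p ∣ + ∣ q ∣
  ∣p∪q∣≤∣p∣+∣q∣ []            []            = z≤n
  ∣p∪q∣≤∣p∣+∣q∣ (outside ∷ p) (outside ∷ q) = ∣p∪q∣≤∣p∣+∣q∣ p q
  ∣p∪q∣≤∣p∣+∣q∣ (inside ∷ p)  (outside ∷ q) = s≤s (∣p∪q∣≤∣p∣+∣q∣ p q)
  ∣p∪q∣≤∣p∣+∣q∣ (outside ∷ p) (inside ∷ q)  = ≤-trans (s≤s (∣p∪q∣≤∣p∣+∣q∣ p q)) (≤-reflexive (sym (+-suc ∣ p ∣ ∣ q ∣)))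
  ∣p∪q∣≤∣p∣+∣q∣ (inside ∷ p)  (inside ∷ q)  =
    s≤s (≤-trans (∣p∪q∣≤∣p∣+∣q∣ p q) (+-monoʳ-≤ ∣ p ∣ (n≤1+n ∣ q ∣)))

  lookup-unique : ∀ {A : Set} {xs : List A} → Unique xs → ∀ i j → lookup xs i ≡ lookup xs j → i ≡ j
  lookup-unique (x∉ ∷ uniq) zero    zero    eq = refl
  lookup-unique (x∉ ∷ uniq) zero    (suc j) eq = ⊥-elim (All.lookup x∉ (∈.∈-lookup j) eq)
  lookup-unique (x∉ ∷ uniq) (suc i) zero    eq = ⊥-elim (All.lookup x∉ (∈.∈-lookup i) (sym eq))
  lookup-unique (x∉ ∷ uniq) (suc i) (suc j) eq = cong suc (lookup-unique uniq i j eq)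

  elements : ∀ {n} → Subset n → List (Fin n)
  elements []            = []
  elements (inside ∷ p)  = zero ∷ map suc (elements p)
  elements (outside ∷ p) = map suc (elements p)

  length-elements : ∀ {n} (p : Subset n) → length (elements p) ≡ ∣ p ∣
  length-elements []            = refl
  length-elements (inside ∷ p)  = cong suc (trans (length-map suc (elements p)) (length-elements p))
  length-elements (outside ∷ p) = trans (length-map suc (elements p)) (length-elements p)

  elements-unique : ∀ {n} (p : Subset n) → Unique (elements p)
  elements-unique []            = []
  elements-unique (inside ∷ p)  = All.map⁺ (All.universal (λ _ ()) (elements p)) ∷
                                  Unique.map⁺ Fin.suc-injective (elements-unique p)
  elements-unique (outside ∷ p) = Unique.map⁺ Fin.suc-injective (elements-unique p)

  elements⊆ : ∀ {n} (p : Subset n) → All (Sub._∈ p) (elements p)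
  elements⊆ []            = []
  elements⊆ (inside ∷ p)  = Vec.here ∷ All.map⁺ (All.map Vec.there (elements⊆ p))
  elements⊆ (outside ∷ p) = All.map⁺ (All.map Vec.there (elements⊆ p))

  module Edges (n : ℕ) where

    edge : Fin (length (potentialEdges n)) → Fin n × Fin n
    edge = lookup (potentialEdges n)

    edge-< : ∀ e → proj₁ (edge e) Fin.< proj₂ (edge e)
    edge-< e = proj₂ (∈.∈-filter⁻ (λ e → proj₁ e Fin.<? proj₂ e)
      {xs = cartesianProduct (allFin n) (allFin n)} (∈.∈-lookup {xs = potentialEdges n} e))

    edge-injective : ∀ {e e′} → edge e ≡ edge e′ → e ≡ e′
    edge-injective = lookup-unique
      (Unique.filter⁺ (λ e → proj₁ e Fin.<? proj₂ e) (Unique.cartesianProduct⁺ (Unique.allFin⁺ n) (Unique.allFin⁺ n))) _ _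

    edge-surjective : ∀ {a b} → a Fin.< b → ∃ λ e → edge e ≡ (a , b)
    edge-surjective {a} {b} a<b = Any.index p , sym (Any.lookup-index p)
      where
      p : (a , b) ∈ potentialEdges n
      p = ∈.∈-filter⁺ (λ e → proj₁ e Fin.<? proj₂ e)
            (∈.∈-cartesianProduct⁺ (∈.∈-allFin {n} a) (∈.∈-allFin {n} b)) a<b

    edge-between : ∀ {a b} → a ≢ b → ∃ λ e → edge e ≡ (a , b) ⊎ edge e ≡ (b , a)
    edge-between {a} {b} a≢b with Fin.<-cmp a b
    ... | tri≈ _ a≡b _ = ⊥-elim (a≢b a≡b)
    ... | tri< a<b _ _ = proj₁ (edge-surjective a<b) , inj₁ (proj₂ (edge-surjective a<b))
    ... | tri> _ _ b<a = proj₁ (edge-surjective b<a) , inj₂ (proj₂ (edge-surjective b<a))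

    open Arcs (Fin._≟_ {n})
    open Traversals (Fin._≟_ {n})

    -- Potential edges are listed with the smaller end first, so none is the reverse of another.
    edges-distinct : ∀ {e e′} → e ≢ e′ → Distinct (edge e) (edge e′)
    edges-distinct {e} {e′} e≢e′ = e≢e′ ∘ edge-injective , λ eq →
      Fin.<-asym (edge-< e) (subst (λ (a , b) → b Fin.< a) (sym eq) (edge-< e′))

    Adj : Graph n → Pred (Fin n × Fin n) 0ℓ
    Adj G (a , b) = Adjacent G a b

    adj? : ∀ G → Decidable (Adj G)
    adj? G (a , b) = Fin.any? λ e → (e Sub.∈? G) ×-dec ((edge e ≟₂ (a , b)) ⊎-dec (edge e ≟₂ (b , a)))

    adj-mono : ∀ {G H} → G ⊆ H → ∀ {e} → Adj G e → Adj H e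
    adj-mono G⊆H (e , e∈ , eq) = e , G⊆H e∈ , eq

    -- Keeping one witnessing edge per arc bounds the size of the generators.
    select : ∀ {G} as → All (Adj G) as → ∃ λ T → All (Adj T) as × T ⊆ G × ∣ T ∣ ≤ length as
    select [] [] = Sub.⊥ , [] , Sub.⊆-min _ , ≤-reflexive (Sub.∣⊥∣≡0 (length (potentialEdges n)))
    select {G} (a ∷ as) ((e , e∈ , eq) ∷ ps) with select as ps
    ... | T , qs , T⊆ , ∣T∣≤ = Sub.⁅ e ⁆ ∪ T ,
      (e , Sub.p⊆p∪q T (Sub.x∈⁅x⁆ e) , eq) ∷ All.map (adj-mono {T} {Sub.⁅ e ⁆ ∪ T} (Sub.q⊆p∪q Sub.⁅ e ⁆ T)) qs ,
      (λ x∈ → [ (λ x∈e → subst (Sub._∈ G) (sym (Sub.x∈⁅y⁆⇒x≡y e x∈e)) e∈) , T⊆ ]′ (Sub.x∈p∪q⁻ Sub.⁅ e ⁆ T x∈)) ,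
      ≤-trans (∣p∪q∣≤∣p∣+∣q∣ Sub.⁅ e ⁆ T) (+-mono-≤ (≤-reflexive (Sub.∣⁅x⁆∣≡1 e)) ∣T∣≤)

  module Layout {V : Set} (_≟_ : DecidableEquality V) where
    open Arcs _≟_

    -- The slots of one path on `suc j` vertices, whose root needs no slot. For `j = 0` the path is
    -- the root alone.
    block : V → ∀ j → Slots j
    block v zero    = []
    block v (suc j) = just v ∷ Vec.replicate j nothing

    layout : ∀ {m} → Vec V m → ∀ j → Slots (m * j)
    layout []       j = []
    layout (v ∷ vs) j = block v j Vec.++ layout vs j

    paths : ∀ {m} → Vec V m → ∀ j → Vec V (m * j) → Vec (Vec V (suc j)) m
    paths []       j σ = []
    paths (v ∷ vs) j σ = (v ∷ Vec.take j σ) ∷ paths vs j (Vec.drop j σ)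

    fresh-layout : ∀ {m} u (vs : Vec V m) j {R} → Unique (toList vs ++ R) → Fresh u (layout vs j) R
    fresh-layout u []       j       uniq = uniq
    fresh-layout u (v ∷ vs) zero    (_ ∷ uniq) = fresh-layout u vs zero uniq
    fresh-layout u (v ∷ vs) (suc j) {R} uniq = subst (λ ws → Unique (v ∷ ws ++ R)) (sym (roots-gap j vs)) uniq
      where
      roots-gap : ∀ i {m} (vs : Vec V m) → roots (Vec.replicate i nothing Vec.++ layout vs (suc j)) ≡ toList vs
      roots-gap (suc i) vs       = roots-gap i vs
      roots-gap zero    []       = refl
      roots-gap zero    (v ∷ vs) = cong (v ∷_) (roots-gap j vs)

    module _ {P : Pred (V × V) 0ℓ} where

      -- `u′` is the last vertex of `u ∷ c`. Only its existence is recorded, as the recursion over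
      -- the paths accepts any starting vertex.
      linked-gap : ∀ {j t} u (ls : Slots t) (c : Vec V j) d →
        All P (arcs u (Vec.replicate j nothing Vec.++ ls) (c Vec.++ d)) →
        Linked (λ a b → P (a , b)) (u ∷ c) × ∃ λ u′ → All P (arcs u′ ls d)
      linked-gap u ls []      d ps       = [-] , u , ps
      linked-gap u ls (x ∷ c) d (p ∷ ps) with linked-gap x ls c d ps
      ... | linked , rest = p ∷ linked , rest

      linked-block : ∀ {j t} u v (ls : Slots t) (c : Vec V j) d →
        All P (arcs u (block v j Vec.++ ls) (c Vec.++ d)) →
        Linked (λ a b → P (a , b)) (v ∷ c) × ∃ λ u′ → All P (arcs u′ ls d)
      linked-block u v ls []      d ps       = [-] , u , ps
      linked-block u v ls (x ∷ c) d (p ∷ ps) with linked-gap x ls c d ps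
      ... | linked , rest = p ∷ linked , rest

      linked-paths : ∀ {m} u (vs : Vec V m) j σ → All P (arcs u (layout vs j) σ) →
        ∀ i → Linked (λ a b → P (a , b)) (Vec.lookup (paths vs j σ) i)
      linked-paths u (v ∷ vs) j σ ps i
        with linked-block u v (layout vs j) (Vec.take j σ) (Vec.drop j σ)
               (subst (λ τ → All P (arcs u (block v j Vec.++ layout vs j) τ)) (sym (Vec.take++drop≡id j σ)) ps)
      linked-paths u (v ∷ vs) j σ ps zero    | linked , _ = linked
      linked-paths u (v ∷ vs) j σ ps (suc i) | _ , u′ , rest = linked-paths u′ vs j (Vec.drop j σ) rest i

    head-paths : ∀ {m} (vs : Vec V m) j σ i → Vec.head (Vec.lookup (paths vs j σ) i) ≡ Vec.lookup vs i
    head-paths (v ∷ vs) j σ zero    = refl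
    head-paths (v ∷ vs) j σ (suc i) = head-paths vs j (Vec.drop j σ) i

    vertices-↭ : ∀ {m} v (vs : Vec V m) j (σ : Vec V (suc m * j)) →
      toList (v ∷ vs) ++ toList σ ↭ toList (v ∷ Vec.take j σ) ++ (toList vs ++ toList (Vec.drop j σ))
    vertices-↭ v vs j σ = ↭.prep v (↭-trans
      (↭.↭-reflexive (cong (toList vs ++_) (trans (cong toList (sym (Vec.take++drop≡id j σ)))
        (Vec.toList-++ (Vec.take j σ) (Vec.drop j σ)))))
      (shifts (toList vs) (toList (Vec.take j σ))))

    ∈-paths : ∀ {m} (vs : Vec V m) j σ i {x} → x ∈V.∈ Vec.lookup (paths vs j σ) i → x ∈ toList vs ++ toList σ
    ∈-paths (v ∷ vs) j σ i x∈ = ∈-resp-↭ (↭-sym (vertices-↭ v vs j σ)) (member i x∈)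
      where
      member : ∀ i {x} → x ∈V.∈ Vec.lookup (paths (v ∷ vs) j σ) i →
               x ∈ toList (v ∷ Vec.take j σ) ++ (toList vs ++ toList (Vec.drop j σ))
      member zero    x∈ = ∈-++⁺ˡ (∈-toList x∈)
      member (suc i) x∈ = ∈-++⁺ʳ (toList (v ∷ Vec.take j σ)) (∈-paths vs j (Vec.drop j σ) i x∈)

    unique-paths : ∀ {m} (vs : Vec V m) j σ → Unique (toList vs ++ toList σ) →
      (∀ i → UniqueV.Unique (Vec.lookup (paths vs j σ) i)) ×
      (∀ i i′ → i ≢ i′ → ∀ x → ¬ (x ∈V.∈ Vec.lookup (paths vs j σ) i × x ∈V.∈ Vec.lookup (paths vs j σ) i′))
    unique-paths []       j σ uniq = (λ ()) , (λ ())
    unique-paths (v ∷ vs) j σ uniq = unique , disjoint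
      where
      first = toList (v ∷ Vec.take j σ)
      uniq′ = Unique-resp-↭ (vertices-↭ v vs j σ) uniq
      rest  = unique-paths vs j (Vec.drop j σ) (unique-++ʳ first uniq′)
      unique : ∀ i → UniqueV.Unique (Vec.lookup (paths (v ∷ vs) j σ) i)
      unique zero    = unique-fromList (v ∷ Vec.take j σ) (unique-++ˡ first uniq′)
      unique (suc i) = proj₁ rest i
      disjoint : ∀ i i′ → i ≢ i′ → ∀ x →
        ¬ (x ∈V.∈ Vec.lookup (paths (v ∷ vs) j σ) i × x ∈V.∈ Vec.lookup (paths (v ∷ vs) j σ) i′)
      disjoint zero    zero     i≢i′ x _         = i≢i′ refl
      disjoint zero    (suc i′) i≢i′ x (p , q)   =
        disjoint-++ first uniq′ (∈-toList p) (∈-paths vs j (Vec.drop j σ) i′ q)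
      disjoint (suc i) zero     i≢i′ x (p , q)   =
        disjoint-++ first uniq′ (∈-toList q) (∈-paths vs j (Vec.drop j σ) i p)
      disjoint (suc i) (suc i′) i≢i′ x           = proj₂ rest i i′ (i≢i′ ∘ cong suc) x

    -- Without this an arc might correspond to no potential edge.
    fresh⇒loopless : ∀ {s} u (ls : Slots s) σ → Fresh u ls (toList σ) → ∀ {a b} → (a , b) ∈ arcs u ls σ → a ≢ b
    fresh⇒loopless u (l ∷ ls) (x ∷ σ) (t∉ ∷ _)    (here refl) = All.lookup t∉ (∈-++⁺ʳ (roots ls) (here refl))
    fresh⇒loopless u (l ∷ ls) (x ∷ σ) (_ ∷ uniq) (there p)   = fresh⇒loopless x ls σ (fresh-next x ls uniq) p
    fresh⇒loopless u [] [] _ ()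

  -- `u` is a dummy predecessor for the first slot, always overridden by a root; it also witnesses
  -- that `n` is positive.
  module Combs (n m j : ℕ) (v : Fin m → Fin n) (v-inj : ∀ {i i′} → v i ≡ v i′ → i ≡ i′)
               (n≡ : n ≡ m * suc j) (u : Fin n) where

    open Edges n
    open Arcs (Fin._≟_ {n})
    open Traversals (Fin._≟_ {n})
    open Layout (Fin._≟_ {n})

    s = m * j

    vs : Vec (Fin n) m
    vs = Vec.tabulate v

    roots-unique : Unique (toList vs)
    roots-unique = subst Unique (sym (tabulate-toList v)) (Unique.tabulate⁺ v-inj)
      where
      tabulate-toList : ∀ {m} (v : Fin m → Fin n) → toList (Vec.tabulate v) ≡ Data.List.Base.tabulate v
      tabulate-toList {zero}  v = refl
      tabulate-toList {suc m} v = cong (v zero ∷_) (tabulate-toList (v ∘ suc))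

    split : ∃ λ R → allFin n ↭ toList vs ++ R
    split = complement (toList vs) roots-unique (λ {x} _ → ∈.∈-allFin x)

    R : List (Fin n)
    R = proj₁ split

    vertices-unique : Unique (toList vs ++ R)
    vertices-unique = Unique-resp-↭ (proj₂ split) (Unique.allFin⁺ n)

    length-R : length R ≡ s
    length-R = +-cancelˡ-≡ m (length R) s (begin
      m + length R                     ≡⟨ cong (_+ length R) (sym (Vec.length-toList vs)) ⟩
      length (toList vs) + length R    ≡⟨ sym (length-++ (toList vs)) ⟩
      length (toList vs ++ R)          ≡⟨ sym (↭-length (proj₂ split)) ⟩
      length (allFin n)                ≡⟨ length-tabulate {n = n} id ⟩
      n                                ≡⟨ n≡ ⟩
      m * suc j                        ≡⟨ *-suc m j ⟩
      m + s ∎)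
      where open ≡-Reasoning

    slots : Slots s
    slots = layout vs j

    fresh : Fresh u slots R
    fresh = fresh-layout u vs j vertices-unique

    orders : List (Vec (Fin n) s)
    orders = Ω u slots R length-R fresh

    arcsOf : Vec (Fin n) s → List (Fin n × Fin n)
    arcsOf = arcs u slots

    -- A sufficient form of the goal in which every root comes first on its path. Its members are
    -- exactly the graphs that realise all arcs of one of the orders, which are the sample space of
    -- the spread argument.
    HasCombs : Pred (Graph n) 0ℓ
    HasCombs G = Any (λ σ → All (Adj G) (arcsOf σ)) orders

    hasCombs? : Decidable HasCombs
    hasCombs? G = Any.any? (λ σ → All.all? (adj? G) (arcsOf σ)) orders

    hasCombs-increasing : Increasing HasCombs
    hasCombs-increasing {G} {H} G⊆H = Any.map (All.map (adj-mono {G} {H} G⊆H))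

    hasCombs-generated : GeneratedBelow n HasCombs
    hasCombs-generated G any with find any
    ... | σ , σ∈ , ps with select {G} (arcsOf σ) ps
    ... | T , qs , T⊆G , ∣T∣≤ = T , lose σ∈ qs , T⊆G ,
      ≤-trans ∣T∣≤ (≤-trans (≤-reflexive (length-arcs u slots σ))
        (≤-trans (*-monoʳ-≤ m (n≤1+n j)) (≤-reflexive (sym n≡))))

    hasCombs⇒paths : ∀ {G} → HasCombs G → DisjointPathsFrom (suc j) m v G
    hasCombs⇒paths {G} any with find any
    ... | σ , σ∈ , ps = paths vs j σ , (λ i → (proj₁ unique i , linked-paths u vs j σ ps i) , endpoint i) , proj₂ unique
      where
      unique = unique-paths vs j σ
        (Unique-resp-↭ (++⁺ˡ (toList vs) (arrangements-↭ s length-R σ∈)) vertices-unique)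
      endpoint : ∀ i → IsEndpoint (v i) (Vec.lookup (paths vs j σ) i)
      endpoint i with Vec.lookup (paths vs j σ) i | head-paths vs j σ i
      ... | x ∷ xs | eq = inj₁ (sym (trans eq (Vec.lookup∘tabulate v i)))

    support : Vec (Fin n) s → Graph n
    support σ = Vec.tabulate (λ e → does (traversed? (arcsOf σ) (edge e)))

    ∈-support⁻ : ∀ σ {e} → e Sub.∈ support σ → Traversed (arcsOf σ) (edge e)
    ∈-support⁻ σ {e} e∈ = true⇒holds (traversed? (arcsOf σ) (edge e))
      (trans (sym (Vec.lookup∘tabulate (λ e → does (traversed? (arcsOf σ) (edge e))) e)) (Vec.[]=⇒lookup e∈))
      where
      true⇒holds : ∀ {P : Set} (P? : Dec P) → does P? ≡ true → P
      true⇒holds (yes p) _ = p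

    ∈-support⁺ : ∀ σ {e} → Traversed (arcsOf σ) (edge e) → e Sub.∈ support σ
    ∈-support⁺ σ {e} t = Vec.lookup⇒[]= e (support σ)
      (trans (Vec.lookup∘tabulate (λ e → does (traversed? (arcsOf σ) (edge e))) e) (dec-true (traversed? (arcsOf σ) (edge e)) t))

    support-hasCombs : ∀ σ → σ ∈ orders → HasCombs (support σ)
    support-hasCombs σ σ∈ = lose σ∈ (All.tabulate adjacent)
      where
      fresh′ : Fresh u slots (toList σ)
      fresh′ = fresh-layout u vs j (Unique-resp-↭ (++⁺ˡ (toList vs) (arrangements-↭ s length-R σ∈)) vertices-unique)
      adjacent : ∀ {a} → a ∈ arcsOf σ → Adj (support σ) a
      adjacent {a , b} p with edge-between (fresh⇒loopless u slots σ fresh′ p)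
      ... | e , inj₁ eq = e , ∈-support⁺ σ (inj₁ (subst (_∈ arcsOf σ) (sym eq) p)) , inj₁ eq
      ... | e , inj₂ eq = e , ∈-support⁺ σ (inj₂ (subst (λ (a , b) → (b , a) ∈ arcsOf σ) (sym eq) p)) , inj₂ eq

    open Spread support orders

    unprescribed : Fin n → Maybe (Fin n)
    unprescribed _ = nothing

    #-free-all : ∀ (xs : List (Fin n)) → # (free? unprescribed) xs ≡ length xs
    #-free-all []       = refl
    #-free-all (x ∷ xs) = cong suc (#-free-all xs)

    #-contains : ∀ T → # (contains? T) orders ≤ 2 ^ ∣ T ∣ * s !∸ ∣ T ∣
    #-contains T = begin
      # (contains? T) orders
        ≤⟨ #-mono (contains? T) (realises? u slots R length-R fresh unprescribed es) orders
             (λ σ _ T⊆ → All.universal (λ _ _ ()) (arcsOf σ) ,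
                All.map⁺ (All.map (λ e∈ → ∈-support⁻ σ (T⊆ e∈)) (elements⊆ T))) ⟩
      # (realises? u slots R length-R fresh unprescribed es) orders
        ≤⟨ #-realises u slots R length-R fresh unprescribed es (All.universal (λ _ → (λ ()) , (λ ())) es)
             (AllPairs.map⁺ (AllPairs.map edges-distinct (elements-unique T))) ⟩
      2 ^ length es * (# (free? unprescribed) R) !∸ length es
        ≡⟨ cong₂ (λ t f → 2 ^ t * f !∸ t) (trans (length-map edge (elements T)) (length-elements T))
             (trans (#-free-all R) length-R) ⟩
      2 ^ ∣ T ∣ * s !∸ ∣ T ∣ ∎
      where
      open ≤-Reasoning
      es = map edge (elements T)

    -- Unless every path is a single root, the roots are at most half of the vertices.
    n≤2s : n ≤ 2 * s ⊎ s ≡ 0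
    n≤2s = cases j refl
      where
      cases : ∀ i → j ≡ i → n ≤ 2 * s ⊎ s ≡ 0
      cases zero    refl = inj₂ (*-zeroʳ m)
      cases (suc i) refl = inj₁ (begin
        n              ≡⟨ trans n≡ (*-suc m (suc i)) ⟩
        m + s          ≤⟨ +-monoˡ-≤ s (m≤m*n m (suc i)) ⟩
        s + s          ≡⟨ cong (s +_) (sym (+-identityʳ s)) ⟩
        2 * s ∎)
        where open ≤-Reasoning

    length-orders : length orders ≡ s !
    length-orders = length-arrangements s R length-R

    uncoverable : ∀ {q} → ι n ℚ.* q ≡ ι 32 → ℚ.0ℚ ℚ.≤ q → ∀ {U : Pred (Graph n) 0ℓ} (U? : Decidable U) →
                  Covers U HasCombs → ℚ.1ℚ ℚ.≤ cost q U?
    uncoverable {q} nq≡32 0≤q U? cov = spread⇒cost≥1 0<M spread U? (λ σ σ∈ → cov (support σ) (support-hasCombs σ σ∈))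
      where
      open ℚ.≤-Reasoning
      open import Algebra.Definitions.RawSemiring ℚ.+-*-rawSemiring renaming (_^_ to _^ℚ_)
      0<M : ℚ.0ℚ ℚ.< ι (length orders)
      0<M = subst (λ M → ℚ.0ℚ ℚ.< ι M) (sym length-orders) (positive! s)
        where
        positive! : ∀ s → ℚ.0ℚ ℚ.< ι (s !)
        positive! s with s ! | s !≢0
        ... | suc x | _ = 0<ι x
      spread : ∀ T → ι (# (contains? T) orders) ℚ.≤ ι (length orders) ℚ.* q ^ℚ ∣ T ∣
      -- Since q = 32/n, multiplying by `n ^ t` reduces the claim to an inequality of natural
      -- numbers.
      spread T = ℚ.*-cancelˡ-≤-pos (ι (n ^ t)) {{ℚ.positive (pos-^ n u t)}} (begin
        ι (n ^ t) ℚ.* ι (# (contains? T) orders)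
          ≡⟨ trans (ℚ.*-comm _ (ι (# (contains? T) orders))) (sym (ι-* (# (contains? T) orders) (n ^ t))) ⟩
        ι (# (contains? T) orders * n ^ t)
          ≤⟨ ι-mono (≤-trans (*-monoˡ-≤ (n ^ t) (#-contains T)) (spread-factorial n s t n≤2s)) ⟩
        ι (32 ^ t * s !)
          ≡⟨ trans (ι-* (32 ^ t) (s !)) (cong₂ ℚ._*_ (ι-^ 32 t) (cong ι (sym length-orders))) ⟩
        ι 32 ^ℚ t ℚ.* ι (length orders)
          ≡⟨ cong (λ x → x ^ℚ t ℚ.* ι (length orders)) (sym nq≡32) ⟩
        (ι n ℚ.* q) ^ℚ t ℚ.* ι (length orders)
          ≡⟨ cong (ℚ._* ι (length orders)) (trans (*-^ (ι n) q t) (cong (ℚ._* q ^ℚ t) (sym (ι-^ n t)))) ⟩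
        ι (n ^ t) ℚ.* q ^ℚ t ℚ.* ι (length orders)
          ≡⟨ trans (ℚ.*-assoc (ι (n ^ t)) _ _) (cong (ι (n ^ t) ℚ.*_) (ℚ.*-comm (q ^ℚ t) _)) ⟩
        ι (n ^ t) ℚ.* (ι (length orders) ℚ.* q ^ℚ t) ∎)
        where
        t = ∣ T ∣
        pos-^ : ∀ n → Fin n → ∀ t → ℚ.0ℚ ℚ.< ι (n ^ t)
        pos-^ (suc n) _ t with suc n ^ t | m^n≢0 (suc n) t
        ... | suc x | _ = 0<ι x

-- Iterating the rounds

module Rounds where

  open import Data.Nat.Base as ℕ using (zero; suc)
  import Data.Nat.Properties as ℕ
  import Data.Integer.Base as ℤ
  open import Data.Rational.Base using (ℚ; 0ℚ; 1ℚ; ½; _+_; _*_; _≤_; _/_)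
  open import Data.Rational.Properties
  open import Data.Rational.Solver using (module +-*-Solver)
  open import Algebra.Definitions.RawSemiring +-*-rawSemiring using (_^_)
  open import Data.Product.Base using (∃; _×_; _,_)
  open import Relation.Nullary using (yes; no)
  open import Relation.Binary.PropositionalEquality
  open SubsetSums
  open Survival
  open Spreads

  0≤½ : 0ℚ ≤ ½
  0≤½ = nonNegative⁻¹ ½

  ^-antiʳ-≤ : ∀ {a} → 0ℚ ≤ a → a ≤ 1ℚ → ∀ {m n} → m ℕ.≤ n → a ^ n ≤ a ^ m
  ^-antiʳ-≤ 0≤a a≤1 {n = zero}  ℕ.z≤n = ≤-refl
  ^-antiʳ-≤ {a} 0≤a a≤1 {n = suc n} ℕ.z≤n = ≤-trans
    (≤-trans (*-monoˡ-≤ (^-nonNeg 0≤a n) a≤1) (≤-reflexive (*-identityˡ (a ^ n)))) (^-antiʳ-≤ 0≤a a≤1 {n = n} ℕ.z≤n)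
  ^-antiʳ-≤ 0≤a a≤1 (ℕ.s≤s m≤n) = *-monoʳ-≤ 0≤a (^-antiʳ-≤ 0≤a a≤1 m≤n)

  ^-double : ∀ a n → a ^ (2 ℕ.* n) ≡ (a * a) ^ n
  ^-double a zero    = refl
  ^-double a (suc n) = trans (cong (a ^_) (cong suc (ℕ.+-suc n (n ℕ.+ 0))))
    (trans (sym (*-assoc a a (a ^ (2 ℕ.* n)))) (cong (a * a *_) (^-double a n)))

  ⅛ 1/32 : ℚ
  ⅛    = ℤ.+ 1 / 8
  1/32 = ℤ.+ 1 / 32

  -- The last round, at density 4ʰ q, takes the sets of size h to ∅; each earlier
  -- one, at density 32 q, halves the size.
  survival : ∀ N q h J → 0ℚ ≤ q →
    SurvivalBound N q (2 ℕ.^ J ℕ.* h) (ι J * (ι 32 * q) + (2ℚ * 2ℚ) ^ h * q) (ι J * ⅛ ^ h + ½ ^ h)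
  survival N q h zero 0≤q {A} A? inc gen d 0≤d uncov p p₀≤p p≤1 =
    subst (λ ε → 𝔼 p (missing A?) ≤ ε + d) (last-error h)
      (subst (λ q → SurvivalBound N q h (p₁ + 0ℚ) (0ℚ + ρ ^ 1 * 2ℚ ^ h)) ρp₁≡q
        (survival-step {ε = 0ℚ} 0≤p₁ ≤-refl 0≤ρ ρ≤1 (survival-zero {N} {ρ * p₁}))
        A? inc gen′ d 0≤d uncov p (≤-trans (≤-reflexive p₁+0≡) p₀≤p) p≤1)
    where
    open +-*-Solver
    -- With `r = 0` every nonempty fragment is large and the error is `ρ * 2ℚ ^ h`. This `ρ` turns
    -- it into `½ ^ h`, and the density needed is `q` divided by `ρ`.
    ρ = (½ * ½) ^ h
    p₁ = (2ℚ * 2ℚ) ^ h * q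
    0≤¼ : 0ℚ ≤ ½ * ½
    0≤¼ = nonNegative⁻¹ (½ * ½)
    0≤ρ : 0ℚ ≤ ρ
    0≤ρ = ^-nonNeg 0≤¼ h
    ρ≤1 : ρ ≤ 1ℚ
    ρ≤1 = ^-antiʳ-≤ 0≤¼ (p≤p+q {½ * ½} {½ + ½ * ½} (nonNegative⁻¹ (½ + ½ * ½))) {0} {h} ℕ.z≤n
    0≤p₁ : 0ℚ ≤ p₁
    0≤p₁ = *-nonNeg (^-nonNeg (*-nonNeg 0≤2 0≤2) h) 0≤q
    ρp₁≡q : ρ * p₁ ≡ q
    ρp₁≡q = trans (sym (*-assoc ρ _ q)) (trans (cong (_* q) (trans (sym (*-^ (½ * ½) (2ℚ * 2ℚ) h)) (1^ h))) (*-identityˡ q))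
    p₁+0≡ : p₁ + 0ℚ ≡ 0ℚ * (ι 32 * q) + p₁
    p₁+0≡ = solve 2 (λ a b → a :+ con 0ℚ := con 0ℚ :* b :+ a) refl p₁ (ι 32 * q)
    gen′ : GeneratedBelow h A
    gen′ = subst (λ ℓ → GeneratedBelow ℓ A) (ℕ.*-identityˡ h) gen
    last-error : ∀ h → 0ℚ + (½ * ½) ^ h * 1ℚ * 2ℚ ^ h ≡ 0ℚ * ⅛ ^ h + ½ ^ h
    last-error h = trans (solve 3 (λ x y z → con 0ℚ :+ x :* con 1ℚ :* y := con 0ℚ :* z :+ x :* y) refl ((½ * ½) ^ h) (2ℚ ^ h) (⅛ ^ h))
      (cong (0ℚ * ⅛ ^ h +_) (sym (*-^ (½ * ½) 2ℚ h)))
  survival N q h (suc J) 0≤q {A} A? inc gen d 0≤d uncov p p₀≤p p≤1 = ≤-trans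
    (subst (λ q → SurvivalBound N q (2 ℕ.* r) (p₁ + P) (E + 1/32 ^ suc r * 2ℚ ^ (2 ℕ.* r))) ρp₁≡q
      (survival-step {ε = E} 0≤p₁ 0≤P 0≤ρ ρ≤1 (subst (λ q → SurvivalBound N q r P E) (sym ρp₁≡q) (survival N q h J 0≤q)))
      A? inc gen′ d 0≤d uncov p (≤-trans (≤-reflexive p-split) p₀≤p) p≤1)
    (+-monoˡ-≤ d (≤-trans (+-monoʳ-≤ E error) (≤-reflexive e-split)))
    where
    open +-*-Solver
    r = 2 ℕ.^ J ℕ.* h
    p₁ = ι 32 * q
    L = (2ℚ * 2ℚ) ^ h * q
    P = ι J * (ι 32 * q) + L
    E = ι J * ⅛ ^ h + ½ ^ h
    0≤ρ : 0ℚ ≤ 1/32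
    0≤ρ = nonNegative⁻¹ 1/32
    ρ≤1 : 1/32 ≤ 1ℚ
    ρ≤1 = p≤p+q {1/32} {ℤ.+ 31 / 32} (nonNegative⁻¹ (ℤ.+ 31 / 32))
    0≤⅛ : 0ℚ ≤ ⅛
    0≤⅛ = nonNegative⁻¹ ⅛
    ⅛≤1 : ⅛ ≤ 1ℚ
    ⅛≤1 = p≤p+q {⅛} {ℤ.+ 7 / 8} (nonNegative⁻¹ (ℤ.+ 7 / 8))
    0≤p₁ : 0ℚ ≤ p₁
    0≤p₁ = *-nonNeg (0≤ι 32) 0≤q
    0≤P : 0ℚ ≤ P
    0≤P = +-nonNeg (*-nonNeg (0≤ι J) 0≤p₁) (*-nonNeg (^-nonNeg (*-nonNeg 0≤2 0≤2) h) 0≤q)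
    ρp₁≡q : 1/32 * p₁ ≡ q
    ρp₁≡q = trans (sym (*-assoc 1/32 (ι 32) q)) (*-identityˡ q)
    p-split : p₁ + P ≡ (1ℚ + ι J) * p₁ + L
    p-split = solve 3 (λ a j l → a :+ (j :* a :+ l) := (con 1ℚ :+ j) :* a :+ l) refl p₁ (ι J) L
    e-split : E + ⅛ ^ h ≡ (1ℚ + ι J) * ⅛ ^ h + ½ ^ h
    e-split = solve 3 (λ j a b → j :* a :+ b :+ a := (con 1ℚ :+ j) :* a :+ b) refl (ι J) (⅛ ^ h) (½ ^ h)
    gen′ : GeneratedBelow (2 ℕ.* r) A
    gen′ = subst (λ ℓ → GeneratedBelow ℓ A) (ℕ.*-assoc 2 (2 ℕ.^ J) h) gen
    h≤r : h ℕ.≤ r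
    h≤r = ℕ.m≤n*m h (2 ℕ.^ J) {{ℕ.m^n≢0 2 J}}
    -- The rate 1/32 leaves ⅛ per element after the 4^r subsets are paid for. A rate leaving ¼ would
    -- not do, as up to 4^(h+1) such errors are added. Every halving has `r` at least `h`, so one
    -- bound serves them all.
    error : 1/32 ^ suc r * 2ℚ ^ (2 ℕ.* r) ≤ ⅛ ^ h
    error = begin
      1/32 * 1/32 ^ r * 2ℚ ^ (2 ℕ.* r)   ≡⟨ cong (1/32 * 1/32 ^ r *_) (^-double 2ℚ r) ⟩
      1/32 * 1/32 ^ r * (2ℚ * 2ℚ) ^ r   ≡⟨ *-assoc 1/32 (1/32 ^ r) ((2ℚ * 2ℚ) ^ r) ⟩
      1/32 * (1/32 ^ r * (2ℚ * 2ℚ) ^ r) ≡⟨ cong (1/32 *_) (sym (*-^ 1/32 (2ℚ * 2ℚ) r)) ⟩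
      1/32 * ⅛ ^ r                        ≤⟨ *-monoˡ-≤ (^-nonNeg 0≤⅛ r) ρ≤1 ⟩
      1ℚ * ⅛ ^ r                          ≡⟨ *-identityˡ (⅛ ^ r) ⟩
      ⅛ ^ r                               ≤⟨ ^-antiʳ-≤ 0≤⅛ ⅛≤1 h≤r ⟩
      ⅛ ^ h ∎
      where open ≤-Reasoning

  -- The halvings contribute at most 4 · 4^h · 8^-h = 4 · 2^-h, the last round one more 2^-h.
  survival-error : ∀ h J → J ℕ.≤ 4 ℕ.^ suc h → ι J * ⅛ ^ h + ½ ^ h ≤ ι 5 * ½ ^ h
  survival-error h J J≤ = begin
    ι J * ⅛ ^ h + ½ ^ h                  ≤⟨ +-monoˡ-≤ (½ ^ h) (*-monoˡ-≤ (^-nonNeg (nonNegative⁻¹ ⅛) h) (ι-mono J≤)) ⟩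
    ι (4 ℕ.^ suc h) * ⅛ ^ h + ½ ^ h      ≡⟨ cong (λ x → x * ⅛ ^ h + ½ ^ h) (ι-^ 4 (suc h)) ⟩
    ι 4 * ι 4 ^ h * ⅛ ^ h + ½ ^ h        ≡⟨ cong (_+ ½ ^ h) (*-assoc (ι 4) (ι 4 ^ h) (⅛ ^ h)) ⟩
    ι 4 * (ι 4 ^ h * ⅛ ^ h) + ½ ^ h      ≡⟨ cong (λ x → ι 4 * x + ½ ^ h) (sym (*-^ (ι 4) ⅛ h)) ⟩
    ι 4 * ½ ^ h + ½ ^ h                  ≡⟨ solve 1 (λ x → con (ι 4) :* x :+ x := con (ι 5) :* x) refl (½ ^ h) ⟩
    ι 5 * ½ ^ h ∎
    where
    open ≤-Reasoning
    open +-*-Solver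

  logarithm : ∀ b n → 1 ℕ.≤ n → ∃ λ h → suc (suc b) ℕ.^ h ℕ.≤ n × n ℕ.< suc (suc b) ℕ.^ suc h
  logarithm b (suc zero) _ = 0 , ℕ.≤-refl , ℕ.s≤s (ℕ.s≤s ℕ.z≤n)
  logarithm b (suc n@(suc _)) _ with logarithm b n (ℕ.s≤s ℕ.z≤n)
  ... | h , lower , upper with suc n ℕ.<? suc (suc b) ℕ.^ suc h
  ...   | yes below = h , ℕ.≤-trans lower (ℕ.n≤1+n n) , below
  ...   | no ≥B = suc h , ℕ.≮⇒≥ ≥B , ℕ.≤-<-trans upper
          (ℕ.^-monoʳ-< (suc (suc b)) (ℕ.s≤s (ℕ.s≤s ℕ.z≤n)) {suc h} ℕ.≤-refl)

  -- The density suffices for ⌊log₂ n⌋ + 1 halvings and a last round with h = ⌊log₄ ⌊log₂ n⌋⌋.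
  survival-log : ∀ N q n Λ h → 0ℚ ≤ q → n ℕ.< 2 ℕ.^ suc Λ → 1 ℕ.≤ h → 4 ℕ.^ h ℕ.≤ Λ → Λ ℕ.< 4 ℕ.^ suc h →
    SurvivalBound N q n (ι 65 * (ι Λ * q)) (ι 5 * ½ ^ h)
  survival-log N q n Λ h 0≤q n< 1≤h 4^h≤Λ Λ< {A} A? inc gen d 0≤d uncov p p₀≤p p≤1 = ≤-trans
    (survival N q h (suc Λ) 0≤q A? inc gen′ d 0≤d uncov p (≤-trans density p₀≤p) p≤1)
    (+-monoˡ-≤ d (survival-error h (suc Λ) Λ<))
    where
    gen′ : GeneratedBelow (2 ℕ.^ suc Λ ℕ.* h) A
    gen′ S a with gen S a
    ... | T , aT , T⊆ , ∣T∣≤n = T , aT , T⊆ , ℕ.≤-trans ∣T∣≤n (ℕ.≤-trans (ℕ.<⇒≤ n<)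
            (ℕ.m≤m*n (2 ℕ.^ suc Λ) h {{ℕ.>-nonZero 1≤h}}))
    1≤Λ : 1 ℕ.≤ Λ
    1≤Λ = ℕ.≤-trans (ℕ.m^n>0 4 h) 4^h≤Λ
    -- 65 = 2 · 32 + 1: there are Λ + 1 ≤ 2Λ halvings at density 32 q, and the last round has
    -- density 4^h q ≤ Λ q.
    density : ι (suc Λ) * (ι 32 * q) + (2ℚ * 2ℚ) ^ h * q ≤ ι 65 * (ι Λ * q)
    density = begin
      ι (suc Λ) * (ι 32 * q) + (2ℚ * 2ℚ) ^ h * q
        ≤⟨ +-mono-≤ (*-monoˡ-≤ (*-nonNeg (0≤ι 32) 0≤q)
                      (≤-trans (ι-mono (ℕ.+-monoˡ-≤ Λ 1≤Λ)) (≤-reflexive (ι-+ Λ Λ))))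
                    (*-monoˡ-≤ 0≤q (≤-trans (≤-reflexive (sym (ι-^ 4 h))) (ι-mono 4^h≤Λ))) ⟩
      (ι Λ + ι Λ) * (ι 32 * q) + ι Λ * q
        ≡⟨ solve 2 (λ l q → (l :+ l) :* (con (ι 32) :* q) :+ l :* q := con (ι 65) :* (l :* q)) refl (ι Λ) q ⟩
      ι 65 * (ι Λ * q) ∎
      where
      open ≤-Reasoning
      open +-*-Solver

-- Bounds on the partial sums that define the logarithm

module Logarithms where

  open import Defs using (mercator)
  open import Data.Nat.Base as ℕ using (ℕ; zero; suc)
  import Data.Nat.Properties as ℕ
  import Data.Integer.Base as ℤ
  open import Data.Rational.Base using (ℚ; 0ℚ; 1ℚ; ½; _+_; _*_; _-_; -_; _≤_; _/_; positive)
  open import Data.Rational.Properties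
  open import Data.Rational.Solver using (module +-*-Solver)
  open import Algebra.Definitions.RawSemiring +-*-rawSemiring using (_^_)
  open import Relation.Binary.PropositionalEquality
  open SubsetSums
  open Spreads
  open Rounds

  1/1+_ : ℕ → ℚ
  1/1+ i = ℤ.+ 1 / suc i

  0≤1/1+ : ∀ i → 0ℚ ≤ 1/1+ i
  0≤1/1+ i = nonNegative⁻¹ (1/1+ i) {{normalize-nonNeg 1 (suc i)}}

  module Logarithm (a : ℕ) where
    n = suc a
    x = 1/1+ a
    r = ℤ.+ a / n
    open +-*-Solver

    n*x≡1 : ι n * x ≡ 1ℚ
    n*x≡1 = ι*1/n≡1 a

    r≡a*x : r ≡ ι a * x
    r≡a*x = *-cancelˡ-ι (begin
        ι n * r               ≡⟨ ι*a/n≡a ⟩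
        ι a                   ≡⟨ sym (*-identityʳ (ι a)) ⟩
        ι a * 1ℚ              ≡⟨ cong (ι a *_) (sym n*x≡1) ⟩
        ι a * (ι n * x)       ≡⟨ solve 3 (λ a n x → a :* (n :* x) := n :* (a :* x)) refl (ι a) (ι n) x ⟩
        ι n * (ι a * x) ∎)
      where
      open ≡-Reasoning
      import Data.Integer.Properties as ℤ
      import Data.Rational.Unnormalised.Base as ℚᵘ
      import Data.Rational.Unnormalised.Properties as ℚᵘ
      *-cancelˡ-ι : ∀ {p q} → ι n * p ≡ ι n * q → p ≡ q
      *-cancelˡ-ι eq = ≤-antisym (*-cancelˡ-≤-pos (ι n) {{positive (0<ι a)}} (≤-reflexive eq))
                                 (*-cancelˡ-≤-pos (ι n) {{positive (0<ι a)}} (≤-reflexive (sym eq)))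
      ι*a/n≡a : ι n * r ≡ ι a
      ι*a/n≡a = toℚᵘ-injective (ℚᵘ.≃-trans (toℚᵘ-homo-* (ι n) r) (ℚᵘ.≃-trans
        (ℚᵘ.*-cong (toℚᵘ-ι n) (toℚᵘ-fromℚᵘ (ℚᵘ.mkℚᵘ (ℤ.+ a) a)))
        (ℚᵘ.≃-trans (ℚᵘ.*≡* (trans (ℤ.*-identityʳ _) (trans (ℤ.*-comm (ℤ.+ n) (ℤ.+ a))
           (cong (λ z → ℤ.+ a ℤ.* ℤ.+ suc z) (sym (ℕ.+-identityʳ a)))))) (ℚᵘ.≃-sym (toℚᵘ-ι a)))))

    r+x≡1 : r + x ≡ 1ℚ
    r+x≡1 = trans (cong (_+ x) r≡a*x)
      (trans (solve 2 (λ a x → a :* x :+ x := (con 1ℚ :+ a) :* x) refl (ι a) x) n*x≡1)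

    0≤x : 0ℚ ≤ x
    0≤x = 0≤1/1+ a

    0≤r : 0ℚ ≤ r
    0≤r = subst (0ℚ ≤_) (sym r≡a*x) (*-nonNeg (0≤ι a) 0≤x)

    r≤1 : r ≤ 1ℚ
    r≤1 = subst (r ≤_) r+x≡1 (p≤p+q 0≤x)

    S : ℕ → ℚ
    S = mercator r

    term : ℕ → ℚ
    term i = r ^ suc i * 1/1+ i

    0≤term : ∀ i → 0ℚ ≤ term i
    0≤term i = *-nonNeg (^-nonNeg 0≤r (suc i)) (0≤1/1+ i)

    S-mono : ∀ {i j} → i ℕ.≤ j → S i ≤ S j
    S-mono {i} {j} i≤j = subst (λ k → S i ≤ S k) (ℕ.m∸n+n≡m i≤j) (go (j ℕ.∸ i))
      where
      go : ∀ d → S i ≤ S (d ℕ.+ i)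
      go zero    = ≤-refl
      go (suc d) = ≤-trans (go d) (p≤p+q (0≤term (d ℕ.+ i)))

    0≤S : ∀ i → 0ℚ ≤ S i
    0≤S i = S-mono {0} {i} ℕ.z≤n

    1/1+-anti : ∀ {i w y} → suc i ℕ.≤ y → 0ℚ ≤ w → ι y * w ≡ 1ℚ → w ≤ 1/1+ i
    1/1+-anti {i} {w} {y} i<y 0≤w y*w≡1 = begin
      w                            ≡⟨ sym (*-identityˡ w) ⟩
      1ℚ * w                       ≡⟨ cong (_* w) (sym (ι*1/n≡1 i)) ⟩
      ι (suc i) * 1/1+ i * w       ≤⟨ *-monoˡ-≤ 0≤w (*-monoˡ-≤ (0≤1/1+ i) (ι-mono i<y)) ⟩
      ι y * 1/1+ i * w             ≡⟨ solve 3 (λ y v w → y :* v :* w := y :* w :* v) refl (ι y) (1/1+ i) w ⟩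
      ι y * w * 1/1+ i             ≡⟨ cong (_* 1/1+ i) y*w≡1 ⟩
      1ℚ * 1/1+ i                  ≡⟨ *-identityˡ _ ⟩
      1/1+ i ∎
      where open ≤-Reasoning

    bernoulli : ∀ j → 1ℚ - ι j * x ≤ r ^ j
    bernoulli zero = ≤-reflexive (solve 1 (λ x → con 1ℚ :- con 0ℚ :* x := con 1ℚ) refl x)
    bernoulli (suc j) = begin
      1ℚ - (1ℚ + ι j) * x
        ≤⟨ p≤p+q (*-nonNeg (0≤ι j) (*-nonNeg 0≤x 0≤x)) ⟩
      1ℚ - (1ℚ + ι j) * x + ι j * (x * x)
        ≡⟨ solve 2 (λ j x → con 1ℚ :- (con 1ℚ :+ j) :* x :+ j :* (x :* x) :=
             (con 1ℚ :- x) :* (con 1ℚ :- j :* x)) refl (ι j) x ⟩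
      (1ℚ - x) * (1ℚ - ι j * x)
        ≡⟨ cong (_* (1ℚ - ι j * x)) (sym r≡1-x) ⟩
      r * (1ℚ - ι j * x)
        ≤⟨ *-monoʳ-≤ 0≤r (bernoulli j) ⟩
      r * r ^ j ∎
      where
      open ≤-Reasoning
      r≡1-x : r ≡ 1ℚ - x
      r≡1-x = trans (solve 2 (λ r x → r := r :+ x :- x) refl r x) (cong (_- x) r+x≡1)

    ½≤r^ : ∀ j → 2 ℕ.* j ℕ.≤ n → ½ ≤ r ^ j
    ½≤r^ j 2j≤n = ≤-trans (0≤q-p⇒p≤q (subst (0ℚ ≤_) halves (*-nonNeg 0≤½ (p≤q⇒0≤q-p 2jx≤1)))) (bernoulli j)
      where
      2jx≤1 : ι 2 * ι j * x ≤ 1ℚ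
      2jx≤1 = ≤-trans (*-monoˡ-≤ 0≤x (≤-trans (≤-reflexive (sym (ι-* 2 j))) (ι-mono 2j≤n))) (≤-reflexive n*x≡1)
      halves : ½ * (1ℚ - ι 2 * ι j * x) ≡ 1ℚ - ι j * x - ½
      halves = solve 2 (λ j x → con ½ :* (con 1ℚ :- con (ι 2) :* j :* x) := con 1ℚ :- j :* x :- con ½) refl (ι j) x

    growth : ∀ c b d → (∀ i → i ℕ.< d ℕ.+ b → c ≤ term i) → S b + ι d * c ≤ S (d ℕ.+ b)
    growth c b zero    _  = ≤-reflexive (trans (cong (S b +_) (*-zeroˡ c)) (+-identityʳ (S b)))
    growth c b (suc d) c≤ = begin
      S b + (1ℚ + ι d) * c      ≡⟨ solve 3 (λ s d c → s :+ (con 1ℚ :+ d) :* c := (s :+ d :* c) :+ c) refl (S b) (ι d) c ⟩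
      S b + ι d * c + c         ≤⟨ +-mono-≤ (growth c b d (λ i i< → c≤ i (ℕ.m≤n⇒m≤1+n i<))) (c≤ (d ℕ.+ b) ℕ.≤-refl) ⟩
      S (d ℕ.+ b) + term (d ℕ.+ b) ∎
      where open ≤-Reasoning

    ¼ : ℚ
    ¼ = ½ * ½

    -- Oresme's grouping of the harmonic series. The block has 2^b terms r^j / j with j ≤ 2^(b+1) ≤
    -- n/2, so that r^j ≥ ½ by Bernoulli's inequality and each term is at least ½ · 2^-(b+1).
    doubling : ∀ b → 2 ℕ.^ suc (suc b) ℕ.≤ n → S (2 ℕ.^ b) + ¼ ≤ S (2 ℕ.^ suc b)
    doubling b 2y≤n = ≤-trans (≤-reflexive (cong (S B +_) (sym B*c≡¼)))
      (subst (λ z → S B + ι B * c ≤ S z) (cong (B ℕ.+_) (sym (ℕ.+-identityʳ B))) (growth c B B c≤term))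
      where
      B = 2 ℕ.^ b
      y = 2 ℕ.* B
      w = ½ * ½ ^ b
      c = ½ * w
      2^*½^ : ∀ b → ι (2 ℕ.^ b) * ½ ^ b ≡ 1ℚ
      2^*½^ b = trans (cong (_* ½ ^ b) (ι-^ 2 b)) (trans (sym (*-^ (ι 2) ½ b)) (1^ b))
      0≤w : 0ℚ ≤ w
      0≤w = *-nonNeg 0≤½ (^-nonNeg 0≤½ b)
      y*w≡1 : ι y * w ≡ 1ℚ
      y*w≡1 = 2^*½^ (suc b)
      B*c≡¼ : ι B * c ≡ ¼
      B*c≡¼ = trans (solve 2 (λ u v → u :* (con ½ :* (con ½ :* v)) := con ½ :* con ½ :* (u :* v)) refl (ι B) (½ ^ b))
        (trans (cong (¼ *_) (2^*½^ b)) (*-identityʳ ¼))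
      c≤term : ∀ i → i ℕ.< B ℕ.+ B → c ≤ term i
      c≤term i i<2B = *-mono-≤ 0≤½ (0≤1/1+ i)
        (½≤r^ (suc i) (ℕ.≤-trans (ℕ.*-monoʳ-≤ 2 i<y) 2y≤n)) (1/1+-anti i<y 0≤w y*w≡1)
        where
        i<y : i ℕ.< y
        i<y = subst (i ℕ.<_) (cong (B ℕ.+_) (sym (ℕ.+-identityʳ B))) i<2B

    S-harmonic : ∀ b → 2 ℕ.^ suc b ℕ.≤ n → ι b * ¼ ≤ S (2 ℕ.^ b)
    S-harmonic zero    _    = ≤-trans (≤-reflexive (*-zeroˡ ¼)) (0≤S 1)
    S-harmonic (suc b) 2y≤n = begin
      (1ℚ + ι b) * ¼      ≡⟨ solve 1 (λ b → (con 1ℚ :+ b) :* con ¼ := b :* con ¼ :+ con ¼) refl (ι b) ⟩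
      ι b * ¼ + ¼         ≤⟨ +-monoˡ-≤ ¼ (S-harmonic b (ℕ.≤-trans (ℕ.^-monoʳ-≤ 2 (ℕ.n≤1+n (suc b))) 2y≤n)) ⟩
      S (2 ℕ.^ b) + ¼     ≤⟨ doubling b 2y≤n ⟩
      S (2 ℕ.^ suc b) ∎
      where open ≤-Reasoning

    log-lower : ∀ Λ → 2 ℕ.≤ Λ → 2 ℕ.^ Λ ℕ.≤ n → ∀ i → n ℕ.≤ i → ι Λ ≤ ι 8 * S i
    log-lower (suc b) (ℕ.s≤s 1≤b) 2^Λ≤n i n≤i = begin
      -- Only b = Λ - 1 blocks of ¼ fit below n/2; the factor 8 = 2 · 4 comes from b + 1 ≤ 2b and
      -- from these quarters.
      1ℚ + ι b              ≤⟨ +-monoˡ-≤ (ι b) (≤-trans (≤-reflexive (sym (+-identityʳ 1ℚ))) (ι-mono 1≤b)) ⟩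
      ι b + ι b             ≡⟨ solve 1 (λ b → b :+ b := con (ι 8) :* (b :* con ¼)) refl (ι b) ⟩
      ι 8 * (ι b * ¼)       ≤⟨ *-monoʳ-≤ (0≤ι 8) (≤-trans (S-harmonic b 2^Λ≤n)
                                 (S-mono (ℕ.≤-trans (ℕ.≤-trans (ℕ.^-monoʳ-≤ 2 (ℕ.n≤1+n b)) 2^Λ≤n) n≤i))) ⟩
      ι 8 * S i ∎
      where open ≤-Reasoning

    geometric : ℕ → ℚ
    geometric zero    = 0ℚ
    geometric (suc i) = geometric i + r ^ suc i

    -- As `x` is 1 - r, the product telescopes to r - r^(i+1).
    geometric*x≤1 : ∀ i → geometric i * x ≤ 1ℚ
    geometric*x≤1 i = ≤-trans (p≤p+q (^-nonNeg 0≤r (suc i))) (≤-trans (≤-reflexive (telescope i)) r≤1)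
      where
      telescope : ∀ i → geometric i * x + r ^ suc i ≡ r
      telescope zero    = solve 2 (λ x r → con 0ℚ :* x :+ r :* con 1ℚ := r) refl x r
      telescope (suc i) = trans (solve 4 (λ g x r p → (g :+ p) :* x :+ r :* p := g :* x :+ p :* (r :+ x)) refl
          (geometric i) x r (r ^ suc i))
        (trans (cong (λ z → geometric i * x + r ^ suc i * z) r+x≡1)
          (trans (cong (geometric i * x +_) (*-identityʳ (r ^ suc i))) (telescope i)))

    S≤ι : ∀ i → S i ≤ ι i
    S≤ι zero    = ≤-refl
    S≤ι (suc i) = ≤-trans (+-mono-≤ (S≤ι i) (*-mono-≤ (^-nonNeg 0≤r (suc i)) 0≤1 r^≤1 1/≤1))
      (≤-reflexive (trans (cong (ι i +_) (*-identityˡ 1ℚ)) (+-comm (ι i) 1ℚ)))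
      where
      r^≤1 : r ^ suc i ≤ 1ℚ
      r^≤1 = ^-antiʳ-≤ 0≤r r≤1 {0} {suc i} ℕ.z≤n
      1/≤1 : 1/1+ i ≤ 1ℚ
      1/≤1 = ≤-trans (≤-trans (≤-reflexive (sym (*-identityˡ (1/1+ i))))
        (*-monoˡ-≤ (0≤1/1+ i) (p≤p+q {1ℚ} (0≤ι i)))) (≤-reflexive (ι*1/n≡1 i))

    -- The first `suc M` terms are at most 1 each; a later one is a power of `r` divided by more
    -- than `suc M`.
    S-tail : ∀ M d → S (d ℕ.+ suc M) ≤ ι (suc M) + 1/1+ M * geometric (d ℕ.+ suc M)
    S-tail M zero = ≤-trans (S≤ι (suc M)) (p≤p+q (*-nonNeg (0≤1/1+ M) (0≤geometric (suc M))))
      where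
      0≤geometric : ∀ i → 0ℚ ≤ geometric i
      0≤geometric zero    = ≤-refl
      0≤geometric (suc i) = +-nonNeg (0≤geometric i) (^-nonNeg 0≤r (suc i))
    S-tail M (suc d) = begin
      S i + term i                                              ≤⟨ +-mono-≤ (S-tail M d) (*-monoʳ-≤ (^-nonNeg 0≤r (suc i))
                                                                     (1/1+-anti′ (ℕ.≤-trans (ℕ.n≤1+n M) (ℕ.m≤n+m (suc M) d)))) ⟩
      ι (suc M) + 1/1+ M * geometric i + r ^ suc i * 1/1+ M     ≡⟨ solve 4 (λ m v g p → m :+ v :* g :+ p :* v := m :+ v :* (g :+ p)) refl
                                                                     (ι (suc M)) (1/1+ M) (geometric i) (r ^ suc i) ⟩
      ι (suc M) + 1/1+ M * (geometric i + r ^ suc i) ∎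
      where
      open ≤-Reasoning
      i = d ℕ.+ suc M
      1/1+-anti′ : ∀ {i} → M ℕ.≤ i → 1/1+ i ≤ 1/1+ M
      1/1+-anti′ {i} M≤i = 1/1+-anti (ℕ.s≤s M≤i) (0≤1/1+ i) (ι*1/n≡1 i)

    -- Shows that (log n)/n is small at all late indices: `M` is chosen for the second summand, and
    -- then `n` large for the first.
    log-upper : ∀ M i → suc M ℕ.≤ i → S i * x ≤ ι (suc M) * x + 1/1+ M
    log-upper M i M<i = begin
      S i * x                                            ≤⟨ *-monoˡ-≤ 0≤x (subst (λ k → S k ≤ ι (suc M) + 1/1+ M * geometric k)
                                                              (ℕ.m∸n+n≡m M<i) (S-tail M (i ℕ.∸ suc M))) ⟩
      (ι (suc M) + 1/1+ M * geometric i) * x             ≡⟨ solve 4 (λ m v g x → (m :+ v :* g) :* x := m :* x :+ v :* (g :* x)) refl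
                                                              (ι (suc M)) (1/1+ M) (geometric i) x ⟩
      ι (suc M) * x + 1/1+ M * (geometric i * x)         ≤⟨ +-monoʳ-≤ (ι (suc M) * x) (*-monoʳ-≤ (0≤1/1+ M) (geometric*x≤1 i)) ⟩
      ι (suc M) * x + 1/1+ M * 1ℚ                        ≡⟨ cong (ι (suc M) * x +_) (*-identityʳ (1/1+ M)) ⟩
      ι (suc M) * x + 1/1+ M ∎
      where open ≤-Reasoning

-- From rational densities to the limit

open import Defs
open import Data.Nat.Base as ℕ using (ℕ; zero; suc)
import Data.Nat.Properties as ℕ
open import Data.Nat.DivMod using (_/_; m/n*n≡m)
open import Data.Nat.Divisibility using (_∣_)
open import Data.Integer.Base as ℤ using (+_)
import Data.Integer.Properties as ℤ
open import Data.Rational.Base as ℚ using (ℚ; 0ℚ; 1ℚ; ½) renaming (_/_ to _/ℚ_)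
import Data.Rational.Properties as ℚ
import Data.Rational.Unnormalised.Base as ℚᵘ
import Data.Rational.Unnormalised.Properties as ℚᵘ
open import Data.Rational.Solver using (module +-*-Solver)
open import Algebra.Definitions.RawSemiring ℚ.+-*-rawSemiring using (_^_)
open import Data.Fin.Base as Fin using (Fin)
open import Data.Fin.Subset using (Subset; inside; outside)
open import Data.Vec.Base using ([]; _∷_)
open import Data.List.Base as List using (List; []; _∷_; _++_)
open import Data.Product.Base using (∃; _×_; _,_; proj₁; proj₂)
open import Function.Base using (_∘_)
open import Function.Bundles using (_↣_; module Injection)
open import Relation.Nullary using (Dec; yes; no)
open import Relation.Nullary.Decidable using (¬?)
open import Relation.Unary using (Pred; Decidable)
open import Relation.Binary.PropositionalEquality
open import Level using (0ℓ)
open SubsetSums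
open Survival
open Spreads
open Rounds
open Logarithms
open CombFamilies

sumOver : ∀ {A : Set} → (A → ℚ) → List A → ℚ
sumOver f = List.foldr (λ x acc → f x ℚ.+ acc) 0ℚ

module _ {A : Set} (f : A → ℚ) where

  sumOver-++ : ∀ xs ys → sumOver f (xs ++ ys) ≡ sumOver f xs ℚ.+ sumOver f ys
  sumOver-++ []       ys = sym (ℚ.+-identityˡ _)
  sumOver-++ (x ∷ xs) ys = trans (cong (f x ℚ.+_) (sumOver-++ xs ys)) (sym (ℚ.+-assoc (f x) _ _))

  sumOver-map : ∀ {B : Set} (g : B → A) xs → sumOver f (List.map g xs) ≡ sumOver (f ∘ g) xs
  sumOver-map g []       = refl
  sumOver-map g (x ∷ xs) = cong (f (g x) ℚ.+_) (sumOver-map g xs)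

  sumOver-* : ∀ c {g : A → ℚ} xs → (∀ x → g x ≡ c ℚ.* f x) → sumOver g xs ≡ c ℚ.* sumOver f xs
  sumOver-* c []       eq = sym (ℚ.*-zeroʳ c)
  sumOver-* c (x ∷ xs) eq = trans (cong₂ ℚ._+_ (eq x) (sumOver-* c xs eq)) (sym (ℚ.*-distribˡ-+ c (f x) _))

  sumOver-filter : {P : Pred A 0ℓ} (P? : Decidable P) → ∀ xs →
    sumOver f (List.filter P? xs) ≡ sumOver (λ x → indicator (P? x) ℚ.* f x) xs
  sumOver-filter P? []       = refl
  sumOver-filter P? (x ∷ xs) with P? x
  ... | yes _ = cong₂ ℚ._+_ (sym (ℚ.*-identityˡ (f x))) (sumOver-filter P? xs)
  ... | no  _ = trans (sym (ℚ.+-identityˡ _)) (cong₂ ℚ._+_ (sym (ℚ.*-zeroˡ (f x))) (sumOver-filter P? xs))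

module _ (p : ℝ) (i : ℕ) where

  weighted : ∀ {N} → (Subset N → ℚ) → Subset N → ℚ
  weighted f S = f S ℚ.* seq (weight p S) i

  seq-sum : ∀ {N} (xs : List (Subset N)) →
    seq (sum (List.map (weight p) xs)) i ≡ sumOver (λ S → seq (weight p S) i) xs
  seq-sum []       = refl
  seq-sum (S ∷ xs) = cong (seq (weight p S) i ℚ.+_) (seq-sum xs)

  sumOver-subsets : ∀ {N} (f : Subset N → ℚ) → sumOver (weighted f) (subsets N) ≡ 𝔼 (seq p i) f
  sumOver-subsets {zero}  f = trans (ℚ.+-identityʳ (f [] ℚ.* 1ℚ)) (ℚ.*-identityʳ (f []))
  sumOver-subsets {suc N} f = trans
    (sumOver-++ (weighted f) (List.map (inside ∷_) (subsets N)) (List.map (outside ∷_) (subsets N)))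
    (cong₂ ℚ._+_ (half inside (seq p i) (λ _ → refl)) (half outside (1ℚ ℚ.- seq p i) (λ _ → refl)))
    where
    half : ∀ s c → (∀ S → seq (weight p (s ∷ S)) i ≡ c ℚ.* seq (weight p S) i) →
           sumOver (weighted f) (List.map (s ∷_) (subsets N)) ≡ c ℚ.* 𝔼 (seq p i) (f ∘ (s ∷_))
    half s c eq = trans (sumOver-map (weighted f) (s ∷_) (subsets N)) (trans
      (sumOver-* (weighted (f ∘ (s ∷_))) c (subsets N) (λ S → trans (cong (f (s ∷ S) ℚ.*_) (eq S))
        (swap (f (s ∷ S)) c (seq (weight p S) i))))
      (cong (c ℚ.*_) (sumOver-subsets (f ∘ (s ∷_)))))
      where
      open +-*-Solver using (solve; _:*_; _:=_)
      swap : ∀ a b c → a ℚ.* (b ℚ.* c) ≡ b ℚ.* (a ℚ.* c)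
      swap = solve 3 (λ a b c → a :* (b :* c) := b :* (a :* c)) refl

  -- An exact identity at every index, valid for any rational density because the weights always
  -- total 1. The failure probability is the quantity that the rounds bound.
  seq-Pr : ∀ {N} {A : Pred (Subset N) 0ℓ} (A? : Decidable A) →
           seq (sum (List.map (weight p) (List.filter A? (subsets N)))) i ≡ 1ℚ ℚ.- 𝔼 (seq p i) (missing A?)
  seq-Pr {N} A? = begin
    seq (sum (List.map (weight p) (List.filter A? (subsets N)))) i
      ≡⟨ seq-sum (List.filter A? (subsets N)) ⟩
    sumOver (λ S → seq (weight p S) i) (List.filter A? (subsets N))
      ≡⟨ sumOver-filter (λ S → seq (weight p S) i) A? (subsets N) ⟩
    sumOver (weighted (λ G → indicator (A? G))) (subsets N)
      ≡⟨ sumOver-subsets (λ G → indicator (A? G)) ⟩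
    E
      ≡⟨ add-sub E F ⟩
    E ℚ.+ F ℚ.- F
      ≡⟨ cong (ℚ._- F) (sym (Σ-+ {N} P (1ℚ ℚ.- P) (λ G → indicator (A? G)) (missing A?))) ⟩
    𝔼 {N} P (λ G → indicator (A? G) ℚ.+ missing A? G) ℚ.- F
      ≡⟨ cong (ℚ._- F) (trans (Σ-cong {N} P (1ℚ ℚ.- P) (λ G → total (A? G))) (𝔼-const {N} P 1ℚ)) ⟩
    1ℚ ℚ.- F ∎
    where
    open ≡-Reasoning
    open +-*-Solver using (solve; _:+_; _:-_; _:=_)
    P = seq p i
    E = 𝔼 {N} P (λ G → indicator (A? G))
    F = 𝔼 {N} P (missing A?)
    add-sub : ∀ x y → x ≡ x ℚ.+ y ℚ.- y
    add-sub = solve 2 (λ x y → x := x :+ y :- y) refl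
    total : ∀ {Q : Set} (Q? : Dec Q) → indicator Q? ℚ.+ indicator (¬? Q?) ≡ 1ℚ
    total (yes _) = refl
    total (no  _) = refl

paths-likely : ∀ a k .{{_ : ℕ.NonZero k}} → k ∣ suc a → (v : Fin (suc a / k) ↣ Fin (suc a)) →
  ∀ Λ h → suc a ℕ.< 2 ℕ.^ suc Λ → 1 ℕ.≤ h → 4 ℕ.^ h ℕ.≤ Λ → Λ ℕ.< 4 ℕ.^ suc h →
  ∀ p → ι 65 ℚ.* (ι Λ ℚ.* (ι 32 ℚ.* 1/1+ a)) ℚ.≤ p → p ℚ.≤ 1ℚ →
  𝔼 p (missing (disjointPathsFrom? k (suc a / k) (Injection.to v))) ℚ.≤ ι 5 ℚ.* ½ ^ h
paths-likely a k@(suc j) k∣n v Λ h n< 1≤h 4^h≤Λ Λ< p p₀≤p p≤1 = begin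
  𝔼 p (missing (disjointPathsFrom? k (n / k) (Injection.to v)))
    ≤⟨ Σ-mono 0≤p (p≤q⇒0≤q-p p≤1) (λ G → indicator-mono (¬? (disjointPathsFrom? k (n / k) (Injection.to v) G))
         (¬? (hasCombs? G)) (λ ¬paths combs → ¬paths (hasCombs⇒paths combs))) ⟩
  𝔼 p (missing hasCombs?)
    ≤⟨ survival-log (List.length (potentialEdges n)) q n Λ h 0≤q n< 1≤h 4^h≤Λ Λ< hasCombs? hasCombs-increasing
         hasCombs-generated 0ℚ ℚ.≤-refl
         -- The deficit starts at 0, since every cover has cost at least 1 outright.
         (λ U? cov → ℚ.≤-trans (uncoverable nq≡32 0≤q U? cov) (ℚ.≤-reflexive (sym (ℚ.+-identityʳ _))))
         p p₀≤p p≤1 ⟩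
  ι 5 ℚ.* ½ ^ h ℚ.+ 0ℚ
    ≡⟨ ℚ.+-identityʳ _ ⟩
  ι 5 ℚ.* ½ ^ h ∎
  where
  open ℚ.≤-Reasoning
  n = suc a
  q = ι 32 ℚ.* 1/1+ a
  open Combs n (n / k) j (Injection.to v) (Injection.injective v) (sym (m/n*n≡m k∣n)) Fin.zero
  0≤q : 0ℚ ℚ.≤ q
  0≤q = *-nonNeg (0≤ι 32) (0≤1/1+ a)
  0≤p : 0ℚ ℚ.≤ p
  0≤p = ℚ.≤-trans (*-nonNeg (0≤ι 65) (*-nonNeg (0≤ι Λ) 0≤q)) p₀≤p
  nq≡32 : ι n ℚ.* q ≡ ι 32
  nq≡32 = trans (swap (ι n) (ι 32) (1/1+ a)) (trans (cong (ι 32 ℚ.*_) (ι*1/n≡1 a)) (ℚ.*-identityʳ (ι 32)))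
    where
    open +-*-Solver using (solve; _:*_; _:=_)
    swap : ∀ a b c → a ℚ.* (b ℚ.* c) ≡ b ℚ.* (a ℚ.* c)
    swap = solve 3 (λ a b c → a :* (b :* c) := b :* (a :* c)) refl

archimedean : ∀ δ → 0ℚ ℚ.< δ → ∃ λ M → 1ℚ ℚ.≤ ι M ℚ.* δ
archimedean (ℚ.mkℚ (+ 0)       d _) (ℚ.*<* (ℤ.+<+ ()))
archimedean (ℚ.mkℚ (ℤ.-[1+ _ ]) d _) (ℚ.*<* ())
archimedean δ@(ℚ.mkℚ ℤ.+[1+ b ] d _) _ = suc d , ℚ.toℚᵘ-cancel-≤ (ℚᵘ.≤-trans
  (ℚᵘ.*≤* {ℚᵘ.mkℚᵘ (+ 1) 0} {ℚᵘ.mkℚᵘ (+ suc d) 0 ℚᵘ.* ℚᵘ.mkℚᵘ ℤ.+[1+ b ] d} cross)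
  (ℚᵘ.≤-reflexive (ℚᵘ.≃-sym (ℚᵘ.≃-trans (ℚ.toℚᵘ-homo-* (ι (suc d)) δ)
    (ℚᵘ.*-cong (toℚᵘ-ι (suc d)) (ℚᵘ.≃-refl {ℚᵘ.mkℚᵘ ℤ.+[1+ b ] d}))))))
  where
  cross : + 1 ℤ.* + suc (d ℕ.+ 0) ℤ.≤ (+ suc d ℤ.* ℤ.+[1+ b ]) ℤ.* + 1
  cross = subst₂ ℤ._≤_ (trans (cong (λ z → + suc z) (sym (ℕ.+-identityʳ d))) (sym (ℤ.*-identityˡ _)))
    (sym (trans (ℤ.*-identityʳ _) (sym (ℤ.pos-* (suc d) (suc b))))) (ℤ.+≤+ (ℕ.m≤m*n (suc d) (suc b)))

-- `M` bounds 1/δ, and the crude 5M ≤ h ≤ 2^h suffices.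
half-power-small : ∀ M δ → 0ℚ ℚ.≤ δ → 1ℚ ℚ.≤ ι M ℚ.* δ → ∀ h → 5 ℕ.* M ℕ.≤ h → ι 5 ℚ.* ½ ^ h ℚ.≤ δ
half-power-small M δ 0≤δ 1≤Mδ h 5M≤h = begin
  ι 5 ℚ.* ½ ^ h
    ≡⟨ cong (ℚ._* ½ ^ h) (sym (ℚ.*-identityʳ (ι 5))) ⟩
  ι 5 ℚ.* 1ℚ ℚ.* ½ ^ h
    ≤⟨ *-monoˡ-≤ (^-nonNeg 0≤½ h) (*-monoʳ-≤ (0≤ι 5) 1≤Mδ) ⟩
  ι 5 ℚ.* (ι M ℚ.* δ) ℚ.* ½ ^ h
    ≡⟨ solve 4 (λ a m d t → a :* (m :* d) :* t := d :* (a :* m :* t)) refl (ι 5) (ι M) δ (½ ^ h) ⟩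
  δ ℚ.* (ι 5 ℚ.* ι M ℚ.* ½ ^ h)
    ≤⟨ *-monoʳ-≤ 0≤δ (*-monoˡ-≤ (^-nonNeg 0≤½ h)
         (ℚ.≤-trans (ℚ.≤-reflexive (sym (ι-* 5 M))) (ι-mono (ℕ.≤-trans 5M≤h (n≤2^n h))))) ⟩
  δ ℚ.* (ι (2 ℕ.^ h) ℚ.* ½ ^ h)
    ≡⟨ cong (δ ℚ.*_) (trans (cong (ℚ._* ½ ^ h) (ι-^ 2 h)) (trans (sym (*-^ (ι 2) ½ h)) (1^ h))) ⟩
  δ ℚ.* 1ℚ
    ≡⟨ ℚ.*-identityʳ δ ⟩
  δ ∎
  where
  open ℚ.≤-Reasoning
  open +-*-Solver using (solve; _:*_; _:=_)
  n≤2^n : ∀ n → n ℕ.≤ 2 ℕ.^ n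
  n≤2^n zero    = ℕ.z≤n
  n≤2^n (suc n) = ℕ.≤-trans (ℕ.+-mono-≤ (ℕ.m^n>0 2 n) (n≤2^n n))
    (ℕ.≤-reflexive (cong (2 ℕ.^ n ℕ.+_) (sym (ℕ.+-identityʳ (2 ℕ.^ n)))))

log-density≤1 : ∀ c a → 2 ℕ.* (suc c ℕ.* (2 ℕ.* suc c)) ℕ.≤ suc a → ∀ i → 2 ℕ.* suc c ℕ.≤ i →
  ι (suc c) ℚ.* seq (log (suc a)) i ℚ.* 1/1+ a ℚ.≤ 1ℚ
log-density≤1 c a n-large i i-large = begin
  C ℚ.* S i ℚ.* x
    ≡⟨ ℚ.*-assoc C (S i) x ⟩
  C ℚ.* (S i ℚ.* x)
    ≤⟨ *-monoʳ-≤ (0≤ι (suc c)) (log-upper M i i-large) ⟩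
  C ℚ.* (ι (2 ℕ.* suc c) ℚ.* x ℚ.+ w)
    ≡⟨ cong (λ d → C ℚ.* (d ℚ.* x ℚ.+ w)) (ι-* 2 (suc c)) ⟩
  C ℚ.* (ι 2 ℚ.* C ℚ.* x ℚ.+ w)
    ≡⟨ solve 3 (λ c x w → c :* (con (ι 2) :* c :* x :+ w) :=
         con ½ :* (con (ι 2) :* (c :* (con (ι 2) :* c)) :* x :+ con (ι 2) :* c :* w)) refl C x w ⟩
  ½ ℚ.* (ι 2 ℚ.* (C ℚ.* (ι 2 ℚ.* C)) ℚ.* x ℚ.+ ι 2 ℚ.* C ℚ.* w)
    ≡⟨ cong₂ (λ y z → ½ ℚ.* (y ℚ.* x ℚ.+ z ℚ.* w)) (sym expand) (sym (ι-* 2 (suc c))) ⟩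
  ½ ℚ.* (ι (2 ℕ.* (suc c ℕ.* (2 ℕ.* suc c))) ℚ.* x ℚ.+ ι (2 ℕ.* suc c) ℚ.* w)
    ≤⟨ *-monoʳ-≤ 0≤½ (ℚ.+-mono-≤ (ℚ.≤-trans (*-monoˡ-≤ 0≤x (ι-mono n-large)) (ℚ.≤-reflexive n*x≡1))
                                   (ℚ.≤-reflexive (ι*1/n≡1 M))) ⟩
  ½ ℚ.* (1ℚ ℚ.+ 1ℚ)
    ≡⟨⟩
  1ℚ ∎
  where
  open ℚ.≤-Reasoning
  open +-*-Solver
  open Logarithm a
  C = ι (suc c)
  -- Chosen so that `suc M` is `2 ℕ.* suc c` by computation. Both summands of `log-upper`,
  -- multiplied by `C`, are then at most ½, the first because n ≥ 4C².
  M = c ℕ.+ (suc c ℕ.+ 0)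
  w = 1/1+ M
  expand : ι (2 ℕ.* (suc c ℕ.* (2 ℕ.* suc c))) ≡ ι 2 ℚ.* (C ℚ.* (ι 2 ℚ.* C))
  expand = trans (ι-* 2 (suc c ℕ.* (2 ℕ.* suc c))) (cong (ι 2 ℚ.*_)
    (trans (ι-* (suc c) (2 ℕ.* suc c)) (cong (C ℚ.*_) (ι-* 2 (suc c)))))

log-density≥ : ∀ a Λ → 2 ℕ.≤ Λ → 2 ℕ.^ Λ ℕ.≤ suc a → ∀ i → suc a ℕ.≤ i →
  ι 65 ℚ.* (ι Λ ℚ.* (ι 32 ℚ.* 1/1+ a)) ℚ.≤ ι 65 ℚ.* ι 32 ℚ.* ι 8 ℚ.* seq (log (suc a)) i ℚ.* 1/1+ a
log-density≥ a Λ 2≤Λ 2^Λ≤n i n≤i = ℚ.≤-trans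
  (*-monoʳ-≤ (0≤ι 65) (*-monoˡ-≤ (*-nonNeg (0≤ι 32) 0≤x) (log-lower Λ 2≤Λ 2^Λ≤n i n≤i)))
  (ℚ.≤-reflexive (solve 5 (λ k l m s x → k :* ((m :* s) :* (l :* x)) := k :* l :* m :* s :* x) refl
    (ι 65) (ι 32) (ι 8) (S i) x))
  where
  open Logarithm a
  open +-*-Solver

ι-*₃ : ∀ {m} a b d → m ≡ a ℕ.* b ℕ.* d → ι m ≡ ι a ℚ.* ι b ℚ.* ι d
ι-*₃ a b d refl = trans (ι-* (a ℕ.* b) d) (cong (ℚ._* ι d) (ι-* a b))

-- Opaque because ι computes in unary.
opaque
  c : ℕ
  c = 16639

  1+c≡65*32*8 : suc c ≡ 65 ℕ.* 32 ℕ.* 8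
  1+c≡65*32*8 = refl

-- 65 is the total density of the rounds in units of Λ q, 32 comes from q = 32/n, and 8 from
-- comparing log₂ n with the partial sums of log n. The form `suc c` makes it visibly positive.
κ : ℚ
κ = ι (suc c)

density : ∀ n .{{_ : ℕ.NonZero n}} → ℝ
density n = fromℚ κ * log n * fromℚ (+ 1 /ℚ n)

seq-density : ∀ a i → seq (density (suc a)) i ≡ κ ℚ.* seq (log (suc a)) i ℚ.* 1/1+ a
seq-density a i = refl

-- Quantifying over `k` and `v` inside keeps the thresholds uniform in them.
Good : ℕ → ℚ → ℚ → Set
Good n δ p = 0ℚ ℚ.≤ p × p ℚ.≤ 1ℚ ×
  (∀ k .{{_ : ℕ.NonZero k}} → k ∣ n → (v : Fin (n / k) ↣ Fin n) →
   𝔼 p (missing (disjointPathsFrom? k (n / k) (Injection.to v))) ℚ.≤ δ)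

-- The index `i₀` may grow with `n`, because the partial sums for log n are under control only from
-- about the n-th on.
EventuallyGood : ℚ → ℕ → Set
EventuallyGood δ N = ∀ n .{{_ : ℕ.NonZero n}} → N ℕ.≤ n →
  ∃ λ i₀ → ∀ i → i₀ ℕ.≤ i → Good n δ (seq (density n) i)

density-good : ∀ δ → 0ℚ ℚ.< δ → ∃ (EventuallyGood δ)
density-good δ 0<δ = N₁ ℕ.+ N₂ , bound
  where
  M  = proj₁ (archimedean δ 0<δ)
  -- `5 ℕ.* M` is what `half-power-small` asks of `h`; the successor secures `1 ≤ h`.
  h₀ = suc (5 ℕ.* M)
  -- `h` is the base 4 logarithm of the base 2 logarithm of `n`, hence the double exponential to
  -- force `h₀ ≤ h`.
  N₁ = 2 ℕ.^ (4 ℕ.^ h₀)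
  N₂ = 2 ℕ.* (suc c ℕ.* (2 ℕ.* suc c))
  bound : EventuallyGood δ (N₁ ℕ.+ N₂)
  bound (suc a) N≤n = suc a ℕ.+ 2 ℕ.* suc c , λ i i₀≤i → subst (Good (suc a) δ) (sym (seq-density a i))
    (let p≤1  = log-density≤1 c a (ℕ.m+n≤o⇒n≤o N₁ N≤n) i (ℕ.m+n≤o⇒n≤o (suc a) i₀≤i)
         p₀≤p = ℚ.≤-trans (log-density≥ a Λ 2≤Λ 2^Λ≤n i (ℕ.m+n≤o⇒m≤o (suc a) i₀≤i))
                  (ℚ.≤-reflexive (cong (λ κ → κ ℚ.* seq (log (suc a)) i ℚ.* 1/1+ a) (sym (ι-*₃ 65 32 8 1+c≡65*32*8))))
     in *-nonNeg (*-nonNeg (0≤ι (suc c)) (Logarithm.0≤S a i)) (0≤1/1+ a) , p≤1 ,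
        λ k k∣n v → ℚ.≤-trans (paths-likely a k k∣n v Λ h n<2^ 1≤h 4^h≤Λ Λ<4^ _ p₀≤p p≤1)
          (half-power-small M δ (ℚ.<⇒≤ 0<δ) (proj₂ (archimedean δ 0<δ)) h (ℕ.≤-trans (ℕ.n≤1+n _) h₀≤h)))
    where
    logs = logarithm 0 (suc a) (ℕ.s≤s ℕ.z≤n)
    Λ     = proj₁ logs
    2^Λ≤n = proj₁ (proj₂ logs)
    n<2^  = proj₂ (proj₂ logs)
    4^h₀≤Λ : 4 ℕ.^ h₀ ℕ.≤ Λ
    4^h₀≤Λ = ℕ.≮⇒≥ λ Λ<4^h₀ → ℕ.<⇒≱ (ℕ.<-≤-trans n<2^ (ℕ.^-monoʳ-≤ 2 Λ<4^h₀)) (ℕ.m+n≤o⇒m≤o N₁ N≤n)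
    logs′ = logarithm 2 Λ (ℕ.≤-trans (ℕ.m^n>0 4 h₀) 4^h₀≤Λ)
    h     = proj₁ logs′
    4^h≤Λ = proj₁ (proj₂ logs′)
    Λ<4^  = proj₂ (proj₂ logs′)
    h₀≤h : h₀ ℕ.≤ h
    h₀≤h = ℕ.≮⇒≥ λ h<h₀ → ℕ.<⇒≱ (ℕ.<-≤-trans Λ<4^ (ℕ.^-monoʳ-≤ 4 h<h₀)) 4^h₀≤Λ
    1≤h : 1 ℕ.≤ h
    1≤h = ℕ.≤-trans (ℕ.s≤s ℕ.z≤n) h₀≤h
    2≤Λ : 2 ℕ.≤ Λ
    2≤Λ = ℕ.≤-trans (ℕ.≤-trans (ℕ.m≤m+n 2 2) (ℕ.^-monoʳ-≤ 4 1≤h)) 4^h≤Λ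

Pr-bounds : ∀ {n} {A : Pred (Graph n) 0ℓ} (A? : Decidable A) p i {x δ} → seq p i ≡ x →
  0ℚ ℚ.≤ x → x ℚ.≤ 1ℚ → 𝔼 x (missing A?) ℚ.≤ δ →
  1ℚ ℚ.- δ ℚ.≤ seq (Pr n p A?) i × seq (Pr n p A?) i ℚ.≤ 1ℚ
Pr-bounds {n} A? p i {x} pᵢ≡x 0≤x x≤1 F≤δ =
  ℚ.≤-trans (ℚ.+-monoʳ-≤ 1ℚ (ℚ.neg-antimono-≤ F≤δ)) (ℚ.≤-reflexive (sym Pr≡)) ,
  ℚ.≤-trans (ℚ.≤-reflexive Pr≡) (ℚ.+-monoʳ-≤ 1ℚ (ℚ.neg-antimono-≤ 0≤F))
  where
  N = List.length (potentialEdges n)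
  Pr≡ : seq (Pr n p A?) i ≡ 1ℚ ℚ.- 𝔼 {N} x (missing A?)
  Pr≡ = trans (seq-Pr p i A?) (cong (λ x → 1ℚ ℚ.- 𝔼 {N} x (missing A?)) pᵢ≡x)
  0≤F : 0ℚ ℚ.≤ 𝔼 {N} x (missing A?)
  0≤F = Σ-nonNeg 0≤x (p≤q⇒0≤q-p x≤1) {N} (λ G → 0≤indicator (¬? (A? G)))

-- The order demands a fixed rational gap. Allowing failure only ½e, where `ε` is eventually at
-- least `e`, leaves ½e as the gap below; above, where the probability is at most 1, the whole of
-- `e` is left.
near-one : ∀ P ε {e} → 0ℚ ℚ.< e →
  (∃ λ i₀ → ∀ i → i₀ ℕ.≤ i → 0ℚ ℚ.+ e ℚ.≤ seq ε i) →
  (∃ λ i₀ → ∀ i → i₀ ℕ.≤ i → 1ℚ ℚ.- ½ ℚ.* e ℚ.≤ seq P i × seq P i ℚ.≤ 1ℚ) →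
  1ℝ - ε < P × P < 1ℝ + ε
near-one P ε {e} 0<e (i₀ , e≤ε) (i₁ , bounds) =
  (½ ℚ.* e , subst (ℚ._< ½ ℚ.* e) (ℚ.*-zeroʳ ½) (ℚ.*-monoʳ-<-pos ½ 0<e) , i₀ ℕ.+ i₁ , lower) ,
  (e , 0<e , i₀ ℕ.+ i₁ , upper)
  where
  open ℚ.≤-Reasoning
  open +-*-Solver
  e≤εᵢ : ∀ i → i₀ ℕ.+ i₁ ℕ.≤ i → e ℚ.≤ seq ε i
  e≤εᵢ i i≥ = ℚ.≤-trans (ℚ.≤-reflexive (sym (ℚ.+-identityˡ e))) (e≤ε i (ℕ.m+n≤o⇒m≤o i₀ i≥))
  lower : ∀ i → i₀ ℕ.+ i₁ ℕ.≤ i → 1ℚ ℚ.- seq ε i ℚ.+ ½ ℚ.* e ℚ.≤ seq P i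
  lower i i≥ = begin
    1ℚ ℚ.- seq ε i ℚ.+ ½ ℚ.* e
      ≤⟨ ℚ.+-monoˡ-≤ (½ ℚ.* e) (ℚ.+-monoʳ-≤ 1ℚ (ℚ.neg-antimono-≤ (e≤εᵢ i i≥))) ⟩
    1ℚ ℚ.- e ℚ.+ ½ ℚ.* e
      ≡⟨ solve 1 (λ e → con 1ℚ :- e :+ con ½ :* e := con 1ℚ :- con ½ :* e) refl e ⟩
    1ℚ ℚ.- ½ ℚ.* e
      ≤⟨ proj₁ (bounds i (ℕ.m+n≤o⇒n≤o i₀ i≥)) ⟩
    seq P i ∎
  upper : ∀ i → i₀ ℕ.+ i₁ ℕ.≤ i → seq P i ℚ.+ e ℚ.≤ 1ℚ ℚ.+ seq ε i
  upper i i≥ = ℚ.+-mono-≤ (proj₂ (bounds i (ℕ.m+n≤o⇒n≤o i₀ i≥))) (e≤εᵢ i i≥)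

½*-pos : ∀ {e} → 0ℚ ℚ.< e → 0ℚ ℚ.< ½ ℚ.* e
½*-pos {e} 0<e = subst (ℚ._< ½ ℚ.* e) (ℚ.*-zeroʳ ½) (ℚ.*-monoʳ-<-pos ½ 0<e)

Pr⟶1 : ∀ (p : ∀ n .{{_ : ℕ.NonZero n}} → ℝ) {A : ∀ n .{{_ : ℕ.NonZero n}} → Pred (Graph n) 0ℓ}
  (A? : ∀ n .{{_ : ℕ.NonZero n}} → Decidable (A n)) →
  (∀ δ → 0ℚ ℚ.< δ → ∃ λ N → ∀ n .{{_ : ℕ.NonZero n}} → N ℕ.≤ n → ∃ λ i₀ → ∀ i → i₀ ℕ.≤ i →
     0ℚ ℚ.≤ seq (p n) i × seq (p n) i ℚ.≤ 1ℚ × 𝔼 (seq (p n) i) (missing (A? n)) ℚ.≤ δ) →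
  (λ n → Pr n (p n) (A? n)) ⟶ 1ℝ
Pr⟶1 p A? small ε (e , 0<e , e≤ε) = proj₁ (small (½ ℚ.* e) (½*-pos 0<e)) , λ n N≤n →
  let (i₀ , below) = proj₂ (small (½ ℚ.* e) (½*-pos 0<e)) n N≤n
  in near-one (Pr n (p n) (A? n)) ε 0<e e≤ε (i₀ , λ i i≥ →
       let (0≤p , p≤1 , F≤) = below i i≥ in Pr-bounds {n} (A? n) (p n) i refl 0≤p p≤1 F≤)

limit : (∀ δ → 0ℚ ℚ.< δ → ∃ (EventuallyGood δ)) →
  ∀ (k : ℕ → ℕ) {{_ : ∀ {n} → ℕ.NonZero (k n)}} → (∀ n → k n ∣ n) → (v : ∀ n → Fin (n / k n) ↣ Fin n) →
  (λ n → Pr n (density n) (disjointPathsFrom? (k n) (n / k n) (Injection.to (v n)))) ⟶ 1ℝ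
limit good k k∣n v = Pr⟶1 density (λ n → disjointPathsFrom? (k n) (n / k n) (Injection.to (v n)))
  λ δ 0<δ → proj₁ (good δ 0<δ) , λ n N≤n →
    proj₁ (proj₂ (good δ 0<δ) n N≤n) , λ i i≥ →
      let (0≤p , p≤1 , F≤) = proj₂ (proj₂ (good δ 0<δ) n N≤n) i i≥
      in 0≤p , p≤1 , F≤ (k n) (k∣n n) (v n)

theorem1p3 : ∀ (D : ℝ) → 0ℝ < D →
    ∃ λ (K : ℝ) → 0ℝ < K ×
    (∀ (k : ℕ → ℕ) {{_ : ∀ {n} → ℕ.NonZero (k n)}} →
    (∀ n → k n ∣ n) →
    (∃ λ n₀ → ∀ n .{{_ : ℕ.NonZero n}} → n₀ ℕ.≤ n → fromℕ (k n) < D * log n) →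
    (v : ∀ n → Fin (n / k n) ↣ Fin n) →
    (λ n → Pr n (K * log n * fromℚ (+ 1 /ℚ n))
    (disjointPathsFrom? (k n) (n / k n) (Injection.to (v n))))
    ⟶ 1ℝ)
theorem1p3 D 0<D = fromℚ κ , (κ , 0<ι c , 0 , λ _ _ → ℚ.≤-reflexive (ℚ.+-identityˡ κ)) ,
  λ k k∣n _ v → limit density-good k k∣n v
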